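{- Let $I$ be an SF instance. Then $I$ admits a stable matching if and only if no GSP of $I$ contains a cycle (cyclic permutation) of odd length greater than 1.
   Context: A Stable Fixtures (SF) instance is $I=(A,\succ,c)$ where $A=\{a_1,\dots,a_n\}$ is a finite set of $n$ agents; each agent $a_i$ has a strict linear order $\succ_i$ over $A\setminus\{a_i\}$ (complete preference list), with the convention that every agent ranks itself last ($a_j\succ_i a_i$ for all $j\neq i$); $a\succeq_i b$ means $a\succ_i b$ or $a=b$. Each agent has an integer capacity $c_i$ with $1\le c_i<n$. A matching is a set $M$ of unordered pairs of distinct agents such that each $a_i$ lies in at most $c_i$ pairs; $M(a_i)$ is the set of partners of $a_i$ and worst$_i(M(a_i))$ its $\succ_i$-worst partner. A blocking pair of $M$ is a pair of distinct agents $a_i,a_j$ with $\{a_i,a_j\}\notin M$, ($|M(a_j)|<c_j$ or $a_i\succ_j$ worst$_j(M(a_j))$), and ($|M(a_i)|<c_i$ or $a_j\succ_i$ worst$_i(M(a_i))$). $M$ is stable if it has no blocking pair. A cyclic permutation of a nonempty set $A_r\subseteq A$ is a permutation $\Pi_r$ of $A_r$ consisting of a single cycle of length $|A_r|$ (length 1: a fixed point $(a_i)$; length 2: a transposition $(a_i\ a_j)$). Two cyclic permutations are distinct if some element is mapped to different elements by them. A GSP (generalised stable partition) of $I$ is a finite collection $\Pi=\{\Pi_1,\dots,\Pi_k\}$ of cyclic permutations $\Pi_r$ of sets $A_r\subseteq A$, pairwise distinct except that fixed points may be repeated, such that: (F1) for every $r$ and every $a_j\in A_r$, $\Pi_r(a_j)\succeq_j\Pi_r^{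 -1}(a_j)$; (F2) there are no distinct $a_i,a_j\in A$ with the transposition $(a_i\ a_j)\notin\Pi$ such that $a_j\succ_i\Pi_r^{ -1}(a_i)$ and $a_i\succ_j\Pi_s^{ -1}(a_j)$ for some $\Pi_r,\Pi_s\in\Pi$ with $a_i\in A_r$, $a_j\in A_s$; (F3) for every $a_i\in A$, the number of indices $r$ with $a_i\in A_r$ equals $c_i$; (F4) for all distinct $a_i,a_j\in A$, $|\{s:\Pi_s(a_i)=a_j\}|+|\{s:\Pi_s(a_j)=a_i\}|\le 2$. -}

module Defs where

open import Data.Nat using (ℕ; zero; suc; _+_; _≤_; _<_)
open import Data.Nat.DivMod using (_mod_)
open import Data.Nat.Divisibility using (_∣_)
open import Data.Fin using (Fin; toℕ)
open import Data.Fin.Properties using (any?)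
open import Data.Fin.Subset using (Subset; _∈_; _∉_; ∣_∣)
open import Data.List using (List; length; filter)
open import Data.List.Base using (allFin)
open import Data.Product using (Σ; ∃; _×_; _,_)
open import Data.Sum using (_⊎_)
open import Relation.Nullary using (¬_; Dec)
open import Relation.Unary using (Decidable)
open import Relation.Binary.PropositionalEquality using (_≡_; _≢_)
open import Function.Definitions using (Injective)

-- SF instances.  Agents are Fin n.  The strict linear order ≻_i of agent i
-- is given by an injective rank function: a ≻_i b  iff  rank i a < rank i b
-- (smaller rank = more preferred).  Every agent ranks itself last.

record SF (n : ℕ) : Set where
  field
    rank     : Fin n → Fin n → ℕ
    rank-inj : ∀ i → Injective _≡_ _≡_ (rank i)
    self-last : ∀ i j → j ≢ i → rank i j < rank i i
    cap      : Fin n → ℕ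
    cap-pos  : ∀ i → 1 ≤ cap i
    cap-lt   : ∀ i → cap i < n

module _ {n : ℕ} (I : SF n) where
  open SF I

  Pref : Fin n → Fin n → Fin n → Set
  Pref i a b = rank i a < rank i b

  PrefEq : Fin n → Fin n → Fin n → Set
  PrefEq i a b = rank i a ≤ rank i b

-- Matchings: a set of unordered pairs, represented by the partner sets
-- M(a_i) (symmetric, irreflexive), respecting capacities.

record Matching {n : ℕ} (I : SF n) : Set where
  field
    partners : Fin n → Subset n
    sym      : ∀ i j → j ∈ partners i → i ∈ partners j
    irrefl   : ∀ i → i ∉ partners i
    capacity : ∀ i → ∣ partners i ∣ ≤ SF.cap I i

module _ {n : ℕ} (I : SF n) (M : Matching I) where
  open SF I
  open Matching M

  IsWorst : Fin n → Fin n → Set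
  IsWorst j k = k ∈ partners j × (∀ k′ → k′ ∈ partners j → PrefEq I j k′ k)

  Accepts : Fin n → Fin n → Set
  Accepts j i = ∣ partners j ∣ < cap j ⊎ Σ (Fin n) (λ k → IsWorst j k × Pref I j i k)

  BlockingPair : Fin n → Fin n → Set
  BlockingPair i j = i ≢ j × j ∉ partners i × Accepts j i × Accepts i j

  Stable : Set
  Stable = ∀ i j → ¬ BlockingPair i j

-- Cyclic permutations.  A cyclic permutation of a set A_r of size suc m is
-- given by an injective enumeration  elem : Fin (suc m) → Fin n  of A_r;
-- it maps elem t to elem (t+1 mod (suc m)).

record Cycle (n : ℕ) : Set where
  field
    m    : ℕ
    elem : Fin (suc m) → Fin n
    inj  : Injective _≡_ _≡_ elem

  len : ℕ
  len = suc m

  next : Fin (suc m) → Fin (suc m)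
  next t = suc (toℕ t) mod suc m

  prev : Fin (suc m) → Fin (suc m)
  prev t = (toℕ t + m) mod suc m

  Mem : Fin n → Set
  Mem a = Σ (Fin (suc m)) (λ t → elem t ≡ a)

  MapsTo : Fin n → Fin n → Set
  MapsTo a b = Σ (Fin (suc m)) (λ t → elem t ≡ a × elem (next t) ≡ b)

  Mem? : (a : Fin n) → Dec (Mem a)
  Mem? a = any? (λ t → elem t Data.Fin.≟ a)

  MapsTo? : (a b : Fin n) → Dec (MapsTo a b)
  MapsTo? a b = any? (λ t → Relation.Nullary.Decidable._×-dec_ (elem t Data.Fin.≟ a) (elem (next t) Data.Fin.≟ b))
    where import Relation.Nullary.Decidable

open Cycle public

SameCycle : ∀ {n} → Cycle n → Cycle n → Set
SameCycle C D =
  (∀ a → Mem C a → Mem D a) × (∀ a → Mem D a → Mem C a) ×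
  (∀ a b → MapsTo C a b → MapsTo D a b)

IsTransposition : ∀ {n} → Cycle n → Fin n → Fin n → Set
IsTransposition C a b = len C ≡ 2 × Mem C a × Mem C b

countIdx : ∀ {k} {P : Fin k → Set} → Decidable P → ℕ
countIdx {k} P? = length (filter P? (allFin k))

record IsGSP {n : ℕ} (I : SF n) {k : ℕ} (Π : Fin k → Cycle n) : Set where
  field
    distinct : ∀ r s → r ≢ s → len (Π r) ≡ 1 ⊎ ¬ SameCycle (Π r) (Π s)
    F1 : ∀ r t → PrefEq I (elem (Π r) t) (elem (Π r) (next (Π r) t))
                                         (elem (Π r) (prev (Π r) t))
    F2 : ∀ i j → i ≢ j → ¬ (Σ (Fin k) λ r → IsTransposition (Π r) i j) →
         ∀ r t s u → elem (Π r) t ≡ i → elem (Π s) u ≡ j →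
         ¬ (Pref I i j (elem (Π r) (prev (Π r) t)) ×
            Pref I j i (elem (Π s) (prev (Π s) u)))
    F3 : ∀ i → countIdx (λ r → Mem? (Π r) i) ≡ SF.cap I i
    F4 : ∀ i j → i ≢ j →
         countIdx (λ r → MapsTo? (Π r) i j) + countIdx (λ r → MapsTo? (Π r) j i) ≤ 2

OddNontrivial : ∀ {n} → Cycle n → Set
OddNontrivial C = 1 < len C × ¬ (2 ∣ len C)

{-# OPTIONS --safe #-}
-- If M is stable and Π is a GSP, compare the weights p (2 on pairs of M) and X (the number of times
-- Π maps one agent to the other). Each edge with p > X is dominated with respect to Π at one of its
-- ends (an up agent), each edge with p < X is dominated with respect to M at one of its ends (a
-- down agent), and double counting shows that such edges always join an up agent to a down agent.
-- The edges of a cycle of length at least 3 have X = 1, so its vertices alternate and its length is even.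
--
-- Conversely, a stable half-integral matching without even cycles is built by raising the capacities
-- one unit at a time. The free unit proposes, as in deferred acceptance, to the best agent willing to
-- accept it, which drops its worst partner, which proposes in turn. If an agent that has received a
-- proposal is about to be dropped, the chain of replacements closes up into a new odd cycle of
-- half-edges; if an odd cycle is met, it is dissolved and absorbs the unit. The result is a GSP once
-- split into transpositions, odd cycles and fixed points; without odd cycles it is a stable matching.
module Submission where

open import Defs
open import Data.Nat using (ℕ)
open import Data.Fin using (Fin)
open import Data.Product using (Σ)
open import Relation.Nullary using (¬_)
open import Function.Bundles using (_⇔_)

open import Data.Bool using (Bool; true; false; _∧_; _∨_; not; if_then_else_)
open import Data.Bool.Properties using (∨-comm; ∧-comm) renaming (_≟_ to _≟ᵇ_)
open import Data.Empty using (⊥; ⊥-elim)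
open import Data.Fin using (zero; suc; _≟_; toℕ; fromℕ)
open import Data.Fin.Properties using (toℕ-fromℕ<; toℕ-fromℕ; toℕ-injective; toℕ<n; any?; all?)
open import Data.Fin.Subset using (Subset; _∈_; _∉_; ∣_∣)
open import Data.Fin.Subset.Properties using (_∈?_)
open import Data.List using (List; []; _∷_; _++_; length; concat; filter; lookup; map; tabulate; reverse; replicate)
open import Data.List.Base using (allFin)
open import Data.List.Membership.Propositional.Properties using (∈-lookup)
open import Data.List.Properties
  using (length-++; ++-identityʳ; map-tabulate; tabulate-lookup; filter-++; unfold-reverse; length-reverse)
open import Data.List.Relation.Unary.All as All using (All; []; _∷_)
open import Data.List.Relation.Unary.All.Properties using (++⁺)
open import Data.List.Relation.Unary.Any using (Any; here; index)
open import Data.List.Relation.Unary.Any.Properties using (lookup-index; ++⁺ˡ; ++⁺ʳ)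
open import Data.Nat using (zero; suc; _+_; _*_; _∸_; _≤_; _<_; z≤n; s≤s)
open import Data.Nat.Divisibility using (_∣_; divides; ∣m+n∣m⇒∣n; ∣1⇒≡1)
open import Data.Nat.DivMod using (_%_; m%n<n; m<n⇒m%n≡m; n%n≡0; [m+n]%n≡m%n)
open import Data.Nat.Properties hiding (_≟_)
open import Data.Nat.Tactic.RingSolver using (solve-∀)
open import Data.Product using (∃; _×_; _,_; proj₁; proj₂)
open import Data.Sum using (_⊎_; inj₁; inj₂; [_,_]′)
open import Data.Unit using (⊤)
open import Data.Vec as Vec using ([]; _∷_)
open import Data.Vec.Properties using ([]=⇒lookup; lookup⇒[]=; lookup∘tabulate)
open import Function using (_∘_; id; flip)
open import Function.Bundles using (mk⇔)
open import Relation.Binary.Definitions using (tri<; tri≈; tri>)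
open import Relation.Binary.PropositionalEquality
open import Relation.Nullary using (Dec; yes; no; does)
open import Relation.Nullary.Decidable using (dec-true; dec-false; _×-dec_; _→-dec_)
open import Relation.Unary using (Decidable)
open import Algebra.Properties.CommutativeMonoid.Sum +-0-commutativeMonoid
  using (sum; sum-cong-≗; sum-replicate-zero; ∑-distrib-+; ∑-comm)

-- The weights are doubled because F4 bounds `X` by 2 off the diagonal, a value that transpositions
-- attain, while `p` takes only the values 0 and 2. The edges of longer cycles, with `X` equal to 1,
-- are then unbalanced whatever the matching is.
--
-- The construction passes through states in which a pair has been broken and its units are not yet
-- placed again. To cover them by one notion of configuration, thresholds only have to bound the
-- ranks of the partners, and an offset accounts for the loose units; every change is then composed
-- of a few elementary moves.
--
-- Termination rests on the permanence of roles within a run. If an agent that has proposed is later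
-- asked to drop its worst partner, that partner has received a proposal, so the chain closes and
-- the run ends. Hence a threshold that worsens through a proposal never improves again during the
-- run.

ind : Bool → ℕ
ind false = 0
ind true  = 1

δ : ∀ {n} → Fin n → Fin n → ℕ
δ a i = ind (does (a ≟ i))

δ-refl : ∀ {n} (a : Fin n) → δ a a ≡ 1
δ-refl a = cong ind (dec-true (a ≟ a) refl)

δ-≢ : ∀ {n} {a i : Fin n} → a ≢ i → δ a i ≡ 0
δ-≢ {a = a} {i} a≢i = cong ind (dec-false (a ≟ i) a≢i)

true≢false : ∀ {b : Bool} → b ≡ true → b ≡ false → ⊥
true≢false refl ()

bool-cases : ∀ (b : Bool) → b ≡ true ⊎ b ≡ false
bool-cases true  = inj₁ refl
bool-cases false = inj₂ refl

sum-bump : ∀ {n} {g h : Fin n → ℕ} (k : Fin n) → (∀ j → j ≢ k → g j ≡ h j) → h k ≡ suc (g k) → sum h ≡ suc (sum g)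
sum-bump {g = g} {h} zero eq bump =
  cong₂ _+_ bump (sum-cong-≗ (λ j → sym (eq (suc j) λ ())))
sum-bump {g = g} {h} (suc k) eq bump =
  trans (cong₂ _+_ (sym (eq zero λ ())) (sum-bump k (λ j j≢k → eq (suc j) λ { refl → j≢k refl }) bump))
        (+-suc (g zero) _)

-- Occurrences, parity and walks in lists.

occ : ∀ {n} → List (Fin n) → Fin n → ℕ
occ []       i = 0
occ (x ∷ xs) i = δ x i + occ xs i

occ-++ : ∀ {n} (xs ys : List (Fin n)) i → occ (xs ++ ys) i ≡ occ xs i + occ ys i
occ-++ []       ys i = refl
occ-++ (x ∷ xs) ys i = trans (cong (δ x i +_) (occ-++ xs ys i)) (sym (+-assoc (δ x i) _ _))

occ-head : ∀ {n} (x : Fin n) xs → 0 < occ (x ∷ xs) x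
occ-head x xs rewrite δ-refl x = s≤s z≤n

split-at : ∀ {n} (xs : List (Fin n)) c → 0 < occ xs c → ∃ λ ys → ∃ λ zs → xs ≡ ys ++ c ∷ zs
split-at (x ∷ xs) c p with x ≟ c
... | yes refl = [] , xs , refl
... | no  _ with split-at xs c p
...   | ys , zs , refl = x ∷ ys , zs , refl

-- The constructor stores two entries at once, so recursion on a proof visits a path pair by pair.
-- This is how alternate edges of an odd cycle get matched or removed.
data EvenLength {A : Set} : List A → Set where
  []  : EvenLength []
  _∷_ : ∀ {xs} (p : A × A) → EvenLength xs → EvenLength (proj₁ p ∷ proj₂ p ∷ xs)

evenLength-resp : ∀ {A : Set} {xs ys : List A} → length xs ≡ length ys → EvenLength xs → EvenLength ys
evenLength-resp {ys = []}         eq []       = []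
evenLength-resp {ys = y ∷ z ∷ ys} eq (p ∷ ev) = (y , z) ∷ evenLength-resp (suc-injective (suc-injective eq)) ev

-- Both ends stay outside the list of inner vertices: a cycle on `a ∷ as` is then `Walk R a as a`,
-- without wrap-around indices.
Walk : ∀ {A : Set} → (A → A → Set) → A → List A → A → Set
Walk R a []       b = R a b
Walk R a (x ∷ xs) b = R a x × Walk R x xs b

walk-split : ∀ {A : Set} {R : A → A → Set} {a} xs {c ys b} →
             Walk R a (xs ++ c ∷ ys) b → Walk R a xs c × Walk R c ys b
walk-split []       (e , w) = e , w
walk-split (x ∷ xs) (e , w) with walk-split xs w
... | w₁ , w₂ = (e , w₁) , w₂

walk-++ : ∀ {A : Set} {R : A → A → Set} {a} xs {c ys b} →
          Walk R a xs c → Walk R c ys b → Walk R a (xs ++ c ∷ ys) b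
walk-++ []       e        w₂ = e , w₂
walk-++ (x ∷ xs) (e , w₁) w₂ = e , walk-++ xs w₁ w₂

-- The implication is asked only between vertices of the walk, because a change of the matrix is
-- known to preserve half-edges only away from the changed pair.
walk-map : ∀ {n} {R S : Fin n → Fin n → Set} {a} xs {b} →
           (∀ i j → 0 < occ (a ∷ b ∷ xs) i → 0 < occ (a ∷ b ∷ xs) j → R i j → S i j) → Walk R a xs b → Walk S a xs b
walk-map {a = a} [] {b} f e = f a b (occ-head a (b ∷ [])) (≤-trans (occ-head b []) (m≤n+m _ (δ a b))) e
walk-map {a = a} (x ∷ xs) {b} f (e , w) =
  f a x (occ-head a (b ∷ x ∷ xs)) (≤-trans (occ-head x xs) (≤-trans (m≤n+m _ (δ b x)) (m≤n+m _ (δ a x)))) e ,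
  walk-map xs (λ i j p q → f i j (up i p) (up j q)) w
  where
  up : ∀ i → 0 < occ (x ∷ b ∷ xs) i → 0 < occ (a ∷ b ∷ x ∷ xs) i
  up i p = ≤-trans p (≤-trans (≤-reflexive (trans (sym (+-assoc (δ x i) (δ b i) _)) (trans (cong (_+ occ xs i) (+-comm (δ x i) (δ b i))) (+-assoc (δ b i) _ _)))) (m≤n+m _ (δ a i)))

-- Symmetric Boolean matrices and their degrees.

Mat : ℕ → Set
Mat n = Fin n → Fin n → Bool

deg : ∀ {n} → Mat n → Fin n → ℕ
deg T i = sum (λ j → ind (T i j))

module _ {n : ℕ} where

  Ends : (a b i j : Fin n) → Set
  Ends a b i j = (i ≡ a × j ≡ b) ⊎ (i ≡ b × j ≡ a)

  Symmetric : Mat n → Set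
  Symmetric T = ∀ i j → T i j ≡ T j i

  abstract

    edge : Fin n → Fin n → Mat n
    edge a b i j = (does (i ≟ a) ∧ does (j ≟ b)) ∨ (does (i ≟ b) ∧ does (j ≟ a))

    add del : Fin n → Fin n → Mat n → Mat n
    add a b T i j = edge a b i j ∨ T i j
    del a b T i j = not (edge a b i j) ∧ T i j

    edge-true : ∀ a b i j → Ends a b i j → edge a b i j ≡ true
    edge-true a b .a .b (inj₁ (refl , refl)) rewrite dec-true (a ≟ a) refl | dec-true (b ≟ b) refl = refl
    edge-true a b .b .a (inj₂ (refl , refl)) rewrite dec-true (a ≟ a) refl | dec-true (b ≟ b) refl =
      ∨-comm (does (b ≟ a) ∧ does (a ≟ b)) true

    edge-ends : ∀ a b i j → edge a b i j ≡ true → Ends a b i j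
    edge-ends a b i j eq with i ≟ a | j ≟ b
    edge-ends a b i j eq | yes p | yes q = inj₁ (p , q)
    edge-ends a b i j eq | yes p | no q with i ≟ b | j ≟ a
    ... | yes p′ | yes q′ = inj₂ (p′ , q′)
    edge-ends a b i j () | yes p | no q | yes _ | no _
    edge-ends a b i j () | yes p | no q | no _ | _
    edge-ends a b i j eq | no p | _ with i ≟ b | j ≟ a
    ... | yes p′ | yes q′ = inj₂ (p′ , q′)
    edge-ends a b i j () | no p | _ | yes _ | no _
    edge-ends a b i j () | no p | _ | no _ | _

    edge-false : ∀ a b i j → ¬ Ends a b i j → edge a b i j ≡ false
    edge-false a b i j ¬e with bool-cases (edge a b i j)
    ... | inj₁ t = ⊥-elim (¬e (edge-ends a b i j t))
    ... | inj₂ f = f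

    edge-sym : ∀ a b i j → edge a b i j ≡ edge a b j i
    edge-sym a b i j = trans (∨-comm (does (i ≟ a) ∧ does (j ≟ b)) _)
      (cong₂ _∨_ (∧-comm (does (i ≟ b)) _) (∧-comm (does (i ≟ a)) _))

    add-true : ∀ {a b T i j} → add a b T i j ≡ true → Ends a b i j ⊎ T i j ≡ true
    add-true {a} {b} {T} {i} {j} eq with bool-cases (edge a b i j)
    ... | inj₁ t = inj₁ (edge-ends a b i j t)
    ... | inj₂ f rewrite f = inj₂ eq

    add-false : ∀ {a b T i j} → add a b T i j ≡ false → ¬ Ends a b i j × T i j ≡ false
    add-false {a} {b} {T} {i} {j} eq with bool-cases (edge a b i j)
    ... | inj₁ t rewrite t with eq
    ...   | ()
    add-false {a} {b} {T} {i} {j} eq | inj₂ f rewrite f =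
      (λ e → true≢false (edge-true a b i j e) f) , eq

    add-ends : ∀ {a b T i j} → Ends a b i j → add a b T i j ≡ true
    add-ends {a} {b} {T} {i} {j} e rewrite edge-true a b i j e = refl

    add-old : ∀ {a b} {T : Mat n} {i j} → T i j ≡ true → add a b T i j ≡ true
    add-old {a} {b} {T} {i} {j} t rewrite t = ∨-comm (edge a b i j) true

    add-other : ∀ {a b} {T : Mat n} {i j} → ¬ Ends a b i j → add a b T i j ≡ T i j
    add-other {a} {b} {T} {i} {j} ¬e rewrite edge-false a b i j ¬e = refl

    del-true : ∀ {a b} {T : Mat n} {i j} → del a b T i j ≡ true → ¬ Ends a b i j × T i j ≡ true
    del-true {a} {b} {T} {i} {j} eq with bool-cases (edge a b i j)
    ... | inj₁ t rewrite t with eq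
    ...   | ()
    del-true {a} {b} {T} {i} {j} eq | inj₂ f rewrite f =
      (λ e → true≢false (edge-true a b i j e) f) , eq

    del-false : ∀ {a b} {T : Mat n} {i j} → del a b T i j ≡ false → Ends a b i j ⊎ T i j ≡ false
    del-false {a} {b} {T} {i} {j} eq with bool-cases (edge a b i j)
    ... | inj₁ t = inj₁ (edge-ends a b i j t)
    ... | inj₂ f rewrite f = inj₂ eq

    del-ends : ∀ {a b} {T : Mat n} {i j} → Ends a b i j → del a b T i j ≡ false
    del-ends {a} {b} {T} {i} {j} e rewrite edge-true a b i j e = refl

    del-other : ∀ {a b} {T : Mat n} {i j} → ¬ Ends a b i j → del a b T i j ≡ T i j
    del-other {a} {b} {T} {i} {j} ¬e rewrite edge-false a b i j ¬e = refl

    del-old : ∀ {a b} {T : Mat n} {i j} → T i j ≡ false → del a b T i j ≡ false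
    del-old {a} {b} {T} {i} {j} f rewrite f = ∧-comm (not (edge a b i j)) false

    add-sym : ∀ a b {T} → Symmetric T → Symmetric (add a b T)
    add-sym a b s i j = cong₂ _∨_ (edge-sym a b i j) (s i j)

    del-sym : ∀ a b {T} → Symmetric T → Symmetric (del a b T)
    del-sym a b s i j = cong₂ _∧_ (cong not (edge-sym a b i j)) (s i j)

  -- Serves `add` and `del` alike: insertion and deletion differ only in which of the two matrices
  -- is the old one.
  deg-differ : ∀ {a b} {T U : Mat n} → a ≢ b → Symmetric T → Symmetric U → T a b ≡ false → U a b ≡ true →
               (∀ i j → ¬ Ends a b i j → T i j ≡ U i j) → ∀ i → deg U i ≡ deg T i + (δ a i + δ b i)
  deg-differ {a} {b} {T} {U} a≢b sT sU Tab Uab eq i with a ≟ i | b ≟ i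
  ... | yes refl | yes refl = ⊥-elim (a≢b refl)
  ... | yes refl | no b≢i = trans
      (sum-bump b (λ j j≢b → cong ind (eq a j λ { (inj₁ (_ , p)) → j≢b p ; (inj₂ (p , _)) → a≢b p }))
                  (trans (cong ind Uab) (cong suc (sym (cong ind Tab)))))
      (+-comm 1 _)
  ... | no a≢i | yes refl = trans
      (sum-bump a (λ j j≢a → cong ind (eq b j λ { (inj₁ (p , _)) → a≢i (sym p) ; (inj₂ (_ , p)) → j≢a p }))
                  (trans (cong ind (trans (sU b a) Uab)) (cong suc (sym (cong ind (trans (sT b a) Tab))))))
      (+-comm 1 _)
  ... | no a≢i | no b≢i = trans
      (sum-cong-≗ (λ j → cong ind (sym (eq i j λ { (inj₁ (p , _)) → a≢i (sym p) ; (inj₂ (p , _)) → b≢i (sym p) }))))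
      (sym (+-identityʳ _))

  deg-add : ∀ {a b} {T : Mat n} → a ≢ b → Symmetric T → T a b ≡ false → ∀ i → deg (add a b T) i ≡ deg T i + (δ a i + δ b i)
  deg-add {a} {b} {T} a≢b s f = deg-differ a≢b s (add-sym a b s) f (add-ends {T = T} (inj₁ (refl , refl)))
    (λ i j ¬e → sym (add-other {T = T} ¬e))

  deg-del : ∀ {a b} {T : Mat n} → a ≢ b → Symmetric T → T a b ≡ true → ∀ i → deg T i ≡ deg (del a b T) i + (δ a i + δ b i)
  deg-del {a} {b} {T} a≢b s t = deg-differ a≢b (del-sym a b s) s (del-ends {T = T} (inj₁ (refl , refl))) t
    (λ i j ¬e → del-other {T = T} ¬e)

-- Half-integral matchings and their elementary moves.

Paired : ∀ {A : Set} → (A → A → Set) → {xs : List A} → EvenLength xs → Set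
Paired R []             = ⊤
Paired R ((q , f) ∷ ev) = R q f × Paired R ev

walk-paired : ∀ {A : Set} {R : A → A → Set} {a b} {xs : List A} (ev : EvenLength xs) → Walk R a xs b → Paired R ev
walk-paired []             w           = _
walk-paired ((q , f) ∷ ev) (_ , e , w) = e , walk-paired ev w

paired-map : ∀ {n} {R S : Fin n → Fin n → Set} {xs : List (Fin n)} (ev : EvenLength xs) →
             (∀ i j → 0 < occ xs i → 0 < occ xs j → R i j → S i j) → Paired R ev → Paired S ev
paired-map []                      g p       = _
paired-map (_∷_ {xs} (q , f) ev) g (e , p) =
  g q f (occ-head q (f ∷ xs)) (≤-trans (occ-head f xs) (m≤n+m _ (δ q f))) e ,
  paired-map ev (λ i j x y → g i j (up i x) (up j y)) p
  where
  up : ∀ i → 0 < occ xs i → 0 < δ q i + (δ f i + occ xs i)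
  up i p = ≤-trans p (≤-trans (m≤n+m _ (δ f i)) (m≤n+m _ (δ q i)))

module Configurations {n : ℕ} (r : Fin n → Fin n → ℕ) where

  -- The edge {i , j} of an odd cycle, carrying weight 1/2; j is the predecessor of i in the permutation.
  record HalfEdge (T : Mat n) (w : Fin n → ℕ) (i j : Fin n) : Set where
    constructor halfEdge
    field
      distinct  : i ≢ j
      unmatched : T i j ≡ false
      threshold : w i ≡ r i j
      bounded   : r j i ≤ w j

  IsCycle : Mat n → (Fin n → ℕ) → List (Fin n) → Set
  IsCycle T w []       = ⊥
  IsCycle T w (a ∷ as) = EvenLength as × Walk (HalfEdge T w) a as a

  -- A half-integral matching: T has weight 1 and the cycles Cs have weight 1/2 on their edges.
  -- w i bounds the rank of the partners of i; dom says that every edge outside T is dominated at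
  -- one of its ends. The offset e counts capacity units that are set aside and must stay unused.
  record Config (T : Mat n) (Cs : List (List (Fin n))) (w b e : Fin n → ℕ) : Set where
    constructor config
    field
      symm   : Symmetric T
      irr    : ∀ i → T i i ≡ false
      within : ∀ i j → T i j ≡ true → r i j ≤ w i
      dom    : ∀ i j → i ≢ j → T i j ≡ false → w i ≤ r i j ⊎ w j ≤ r j i
      cycles : All (IsCycle T w) Cs
      uniq   : ∀ i → occ (concat Cs) i ≤ 1
      w≤     : ∀ i → w i ≤ r i i
      total≤ : ∀ i → deg T i + occ (concat Cs) i + e i ≤ b i
      full   : ∀ i → w i < r i i → deg T i + occ (concat Cs) i + e i ≡ b i

  cycles-map : ∀ {T T′ w w′} Cs →
    (∀ i j → 0 < occ (concat Cs) i → 0 < occ (concat Cs) j → HalfEdge T w i j → HalfEdge T′ w′ i j) →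
    All (IsCycle T w) Cs → All (IsCycle T′ w′) Cs
  cycles-map []             g []               = []
  cycles-map ((a ∷ as) ∷ Cs) g ((ev , wk) ∷ cs) =
    (ev , walk-map as (λ i j p q → g i j (inL i p) (inL j q)) wk) ∷
    cycles-map Cs (λ i j p q → g i j (inR i p) (inR j q)) cs
    where
    inR : ∀ i → 0 < occ (concat Cs) i → 0 < occ ((a ∷ as) ++ concat Cs) i
    inR i p rewrite occ-++ (a ∷ as) (concat Cs) i = ≤-trans p (m≤n+m _ _)
    pos : ∀ x y → 0 < x + (x + y) → 0 < x + y
    pos zero    y p = p
    pos (suc x) y p = s≤s z≤n
    inL : ∀ i → 0 < occ (a ∷ a ∷ as) i → 0 < occ ((a ∷ as) ++ concat Cs) i
    inL i p rewrite occ-++ (a ∷ as) (concat Cs) i = ≤-trans (pos (δ a i) _ p) (m≤m+n _ _)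

  rotate : ∀ {T w} xs {c ys} → IsCycle T w (xs ++ c ∷ ys) → IsCycle T w (c ∷ (ys ++ xs))
  rotate []       {c} {ys} cyc rewrite ++-identityʳ ys = cyc
  rotate (a ∷ xs) {c} {ys} (ev , wk) with walk-split xs wk
  ... | w₁ , w₂ = evenLength-resp eq ev , walk-++ ys w₂ w₁
    where
    eq : length (xs ++ c ∷ ys) ≡ length (ys ++ a ∷ xs)
    eq rewrite length-++ xs {c ∷ ys} | length-++ ys {a ∷ xs}
             | +-suc (length xs) (length ys) | +-suc (length ys) (length xs) = cong suc (+-comm (length xs) _)

  occ-rotate : ∀ (xs : List (Fin n)) {c ys} i → occ (xs ++ c ∷ ys) i ≡ occ (c ∷ (ys ++ xs)) i
  occ-rotate xs {c} {ys} i rewrite occ-++ xs (c ∷ ys) i | occ-++ ys xs i = lem (occ xs i) (δ c i) (occ ys i)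
    where
    lem : ∀ x y z → x + (y + z) ≡ y + (z + x)
    lem = solve-∀

  extract : ∀ {T w} Cs c → All (IsCycle T w) Cs → 0 < occ (concat Cs) c → ∃ λ as → ∃ λ Cs′ →
    (∀ i → occ (concat Cs) i ≡ occ (c ∷ as) i + occ (concat Cs′) i) × IsCycle T w (c ∷ as) × All (IsCycle T w) Cs′
  extract (L ∷ Cs) c (cyc ∷ cs) p with 0 <? occ L c
  ... | yes q with split-at L c q
  ...   | xs , ys , refl = ys ++ xs , Cs ,
          (λ i → trans (occ-++ (xs ++ c ∷ ys) (concat Cs) i) (cong (_+ occ (concat Cs) i) (occ-rotate xs i))) ,
          rotate xs cyc , cs
  extract (L ∷ Cs) c (cyc ∷ cs) p | no ¬q with extract Cs c cs p′
    where
    p′ : 0 < occ (concat Cs) c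
    p′ = subst (0 <_) (trans (occ-++ L (concat Cs) c) (cong (_+ occ (concat Cs) c) (n≤0⇒n≡0 (≮⇒≥ ¬q)))) p
  ... | as , Cs′ , eq , cyc′ , cs′ = as , L ∷ Cs′ ,
        (λ i → trans (occ-++ L (concat Cs) i) (trans (cong (occ L i +_) (eq i))
               (trans (lem (occ L i) (occ (c ∷ as) i) _) (cong (occ (c ∷ as) i +_) (sym (occ-++ L (concat Cs′) i)))))) ,
        cyc′ , cyc ∷ cs′
    where
    lem : ∀ x y z → x + (y + z) ≡ y + (x + z)
    lem = solve-∀

  module _ {T : Mat n} {Cs w b e} (K : Config T Cs w b e) where
    open Config K

    -- One end off the cycles is enough: the new pair then differs from every cycle edge, so
    -- half-edges stay unmatched. Domination is inherited since fewer pairs are unmatched; each end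
    -- pays with one unit of the offset.
    add-edge : ∀ {x y e′} → x ≢ y → T x y ≡ false → r x y ≤ w x → r y x ≤ w y → occ (concat Cs) x ≡ 0 →
               (∀ i → e i ≡ e′ i + (δ x i + δ y i)) → Config (add x y T) Cs w b e′
    add-edge {x} {y} {e′} x≢y Txy wx wy x∉ eq = record
      { symm = add-sym x y symm
      ; irr = λ i → trans (add-other (λ { (inj₁ (refl , p)) → x≢y p ; (inj₂ (refl , p)) → x≢y (sym p) })) (irr i)
      ; within = λ i j t → [ (λ { (inj₁ (refl , refl)) → wx ; (inj₂ (refl , refl)) → wy }) , within i j ]′ (add-true t)
      ; dom = λ i j i≢j f → dom i j i≢j (proj₂ (add-false f))
      ; cycles = cycles-map Cs keep cycles
      ; uniq = uniq
      ; w≤ = w≤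
      ; total≤ = λ i → subst (_≤ b i) (tot i) (total≤ i)
      ; full = λ i p → trans (sym (tot i)) (full i p)
      }
      where
      keep : ∀ i j → 0 < occ (concat Cs) i → 0 < occ (concat Cs) j → HalfEdge T w i j → HalfEdge (add x y T) w i j
      keep i j p q (halfEdge d u t s) = halfEdge d (trans (add-other λ { (inj₁ (refl , _)) → <⇒≢ p (sym x∉) ; (inj₂ (_ , refl)) → <⇒≢ q (sym x∉) }) u) t s
      lem : ∀ g o k d → g + o + (k + d) ≡ g + d + o + k
      lem = solve-∀
      tot : ∀ i → deg T i + occ (concat Cs) i + e i ≡ deg (add x y T) i + occ (concat Cs) i + e′ i
      tot i rewrite eq i | deg-add x≢y symm Txy i = lem (deg T i) _ (e′ i) _

    -- The removed pair becomes unmatched and has to be dominated; the bound on `w x` achieves this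
    -- at `x`. The two freed units move to the offset.
    del-edge : ∀ {x y e′} → T x y ≡ true → w x ≤ r x y →
               (∀ i → e′ i ≡ e i + (δ x i + δ y i)) → Config (del x y T) Cs w b e′
    del-edge {x} {y} {e′} Txy wx eq = record
      { symm = del-sym x y symm
      ; irr = λ i → del-old (irr i)
      ; within = λ i j t → within i j (proj₂ (del-true t))
      ; dom = λ i j i≢j f → [ (λ { (inj₁ (refl , refl)) → inj₁ wx ; (inj₂ (refl , refl)) → inj₂ wx }) , dom i j i≢j ]′ (del-false f)
      ; cycles = cycles-map Cs (λ { i j _ _ (halfEdge d u t s) → halfEdge d (del-old u) t s }) cycles
      ; uniq = uniq
      ; w≤ = w≤
      ; total≤ = λ i → subst (_≤ b i) (tot i) (total≤ i)
      ; full = λ i p → trans (sym (tot i)) (full i p)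
      }
      where
      x≢y : x ≢ y
      x≢y refl = true≢false Txy (irr x)
      lem : ∀ g o k d → g + d + o + k ≡ g + o + (k + d)
      lem = solve-∀
      tot : ∀ i → deg T i + occ (concat Cs) i + e i ≡ deg (del x y T) i + occ (concat Cs) i + e′ i
      tot i rewrite eq i | deg-del x≢y symm Txy i = lem (deg (del x y T) i) _ (e i) _

    reweight : ∀ {w′} →
      (∀ i j → T i j ≡ true → r i j ≤ w′ i) →
      (∀ i j → i ≢ j → T i j ≡ false → w′ i ≤ r i j ⊎ w′ j ≤ r j i) →
      (∀ i → 0 < occ (concat Cs) i → w′ i ≡ w i) →
      (∀ i → w′ i ≤ r i i) →
      (∀ i → w′ i < r i i → w i < r i i ⊎ deg T i + occ (concat Cs) i + e i ≡ b i) →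
      Config T Cs w′ b e
    reweight {w′} within′ dom′ same w≤′ full′ = record
      { symm = symm ; irr = irr ; within = within′ ; dom = dom′
      ; cycles = cycles-map Cs (λ { i j p q (halfEdge d u t s) →
          halfEdge d u (trans (same i p) t) (subst (r j i ≤_) (sym (same j q)) s) }) cycles
      ; uniq = uniq ; w≤ = w≤′ ; total≤ = total≤
      ; full = λ i p → [ full i , (λ z → z) ]′ (full′ i p) }

    -- A capacity unit that is set aside as soon as it is granted changes nothing else. In this way
    -- `raise` introduces the unit that is to be placed.
    recount : ∀ {b′ e′} → (∀ i → b i + e′ i ≡ b′ i + e i) → Config T Cs w b′ e′
    recount {b′} {e′} eq = record
      { symm = symm ; irr = irr ; within = within ; dom = dom ; cycles = cycles ; uniq = uniq ; w≤ = w≤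
      ; total≤ = λ i → +-cancelʳ-≤ (e i) _ _ (subst₂ _≤_ (lem (deg T i) _ (e i) _) (eq i) (+-monoˡ-≤ (e′ i) (total≤ i)))
      ; full = λ i p → +-cancelʳ-≡ (e i) _ _ (trans (sym (lem (deg T i) _ (e i) _)) (trans (cong (_+ e′ i) (full i p)) (eq i))) }
      where
      lem : ∀ g o k l → g + o + k + l ≡ g + o + l + k
      lem = solve-∀

    drop-cycle : ∀ {L Cs′ e′} → (∀ i → occ (concat Cs) i ≡ occ L i + occ (concat Cs′) i) → All (IsCycle T w) Cs′ →
                 (∀ i → e′ i ≡ e i + occ L i) → Config T Cs′ w b e′
    drop-cycle {L} {Cs′} {e′} occ≡ cs eq = record
      { symm = symm ; irr = irr ; within = within ; dom = dom ; cycles = cs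
      ; uniq = λ i → ≤-trans (m≤n+m _ (occ L i)) (subst (_≤ 1) (occ≡ i) (uniq i)) ; w≤ = w≤
      ; total≤ = λ i → subst (_≤ b i) (tot i) (total≤ i)
      ; full = λ i p → trans (sym (tot i)) (full i p) }
      where
      lem : ∀ g l o k → g + (l + o) + k ≡ g + o + (k + l)
      lem = solve-∀
      tot : ∀ i → deg T i + occ (concat Cs) i + e i ≡ deg T i + occ (concat Cs′) i + e′ i
      tot i rewrite eq i | occ≡ i = lem (deg T i) (occ L i) _ _

    add-cycle : ∀ {L e′} → IsCycle T w L → (∀ i → occ L i + occ (concat Cs) i ≤ 1) →
                (∀ i → e i ≡ e′ i + occ L i) → Config T (L ∷ Cs) w b e′
    add-cycle {L} {e′} cyc uniq′ eq = record
      { symm = symm ; irr = irr ; within = within ; dom = dom ; cycles = cyc ∷ cycles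
      ; uniq = λ i → subst (_≤ 1) (sym (occ-++ L (concat Cs) i)) (uniq′ i) ; w≤ = w≤
      ; total≤ = λ i → subst (_≤ b i) (tot i) (total≤ i)
      ; full = λ i p → trans (sym (tot i)) (full i p) }
      where
      lem : ∀ g l o k → g + o + (k + l) ≡ g + (l + o) + k
      lem = solve-∀
      tot : ∀ i → deg T i + occ (concat Cs) i + e i ≡ deg T i + occ (L ++ concat Cs) i + e′ i
      tot i rewrite eq i | occ-++ L (concat Cs) i = lem (deg T i) (occ L i) _ _

  -- A half-edge meets the bounds required of a full edge: its first end attains its threshold and
  -- its second end stays within its own. The last component lets callers see that the rows of
  -- agents outside `as` are unchanged.
  add-pairs : ∀ {T Cs w b e e′} {as : List (Fin n)} (ev : EvenLength as) → Config T Cs w b e →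
    (∀ i → occ as i + occ (concat Cs) i ≤ 1) → Paired (HalfEdge T w) ev → (∀ i → e i ≡ e′ i + occ as i) →
    ∃ λ T′ → Config T′ Cs w b e′ × (∀ i j → occ as i ≡ 0 → T′ i j ≡ T i j)
  add-pairs {T} [] K u p eq = T , recount K (λ i → cong (_ +_) (sym (trans (eq i) (+-identityʳ _)))) , λ _ _ _ → refl
  add-pairs {T} {Cs} {w} {b} {e} {e′} (_∷_ {xs} (q , f) ev) K u (halfEdge d nt t s , p) eq
    with add-pairs ev (add-edge K {e′ = λ i → e′ i + occ xs i} d nt (≤-reflexive (sym t)) s q∉
                        (λ i → trans (eq i) (lem (e′ i) (δ q i) (δ f i) (occ xs i))))
           (λ i → ≤-trans (+-monoˡ-≤ _ (≤-trans (m≤n+m _ (δ f i)) (m≤n+m _ (δ q i)))) (u i))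
           (paired-map ev keep p) (λ i → refl)
    where
    lem : ∀ k x y z → k + (x + (y + z)) ≡ k + z + (x + y)
    lem = solve-∀
    q∉ : occ (concat Cs) q ≡ 0
    q∉ = n≤0⇒n≡0 (+-cancelˡ-≤ 1 _ _ (≤-trans (+-monoˡ-≤ _ (occ-head q (f ∷ xs))) (u q)))
    q∉xs : occ xs q ≡ 0
    q∉xs = n≤0⇒n≡0 (+-cancelˡ-≤ 1 _ _ (≤-trans (≤-reflexive (cong (_+ occ xs q) (sym (δ-refl q))))
            (≤-trans (+-monoʳ-≤ (δ q q) (m≤n+m _ (δ f q))) (≤-trans (m≤m+n _ _) (u q)))))
    f∉xs : occ xs f ≡ 0
    f∉xs = n≤0⇒n≡0 (+-cancelˡ-≤ 1 _ _ (≤-trans (≤-reflexive (cong (_+ occ xs f) (sym (δ-refl f))))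
            (≤-trans (m≤n+m _ (δ q f)) (≤-trans (m≤m+n _ _) (u f)))))
    keep : ∀ i j → 0 < occ xs i → 0 < occ xs j → HalfEdge T w i j → HalfEdge (add q f T) w i j
    keep i j x y (halfEdge d u t s) = halfEdge d (trans (add-other λ { (inj₁ (refl , _)) → <⇒≢ x (sym q∉xs) ; (inj₂ (refl , _)) → <⇒≢ x (sym f∉xs) }) u) t s
  ... | T′ , K′ , same = T′ , K′ , λ i j z → trans (same i j (m+n≡0⇒n≡0 (δ f i) (m+n≡0⇒n≡0 (δ q i) z)))
        (add-other λ { (inj₁ (refl , _)) → <⇒≢ (occ-head q (f ∷ xs)) (sym z)
                     ; (inj₂ (refl , _)) → <⇒≢ (≤-trans (occ-head f xs) (m≤n+m _ (δ q f))) (sym z) })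

  -- Removing c from an odd cycle leaves a path on evenly many vertices, which is perfectly matched.
  dissolve : ∀ {T Cs w b e} c → Config T Cs w b e → 0 < occ (concat Cs) c →
    ∃ λ T′ → ∃ λ Cs′ → Config T′ Cs′ w b (λ i → e i + δ c i) × occ (concat Cs′) c ≡ 0 ×
      (∀ i → occ (concat Cs′) i ≤ occ (concat Cs) i) × (∀ j → T′ c j ≡ T c j)
  dissolve {T} {Cs} {w} {b} {e} c K p with extract Cs c (Config.cycles K) p
  ... | as , Cs′ , occ≡ , (ev , wk) , cs
    with add-pairs ev (drop-cycle K {L = c ∷ as} {e′ = λ i → e i + occ (c ∷ as) i} occ≡ cs (λ i → refl))
           (λ i → ≤-trans (≤-trans (m≤n+m _ (δ c i)) (≤-reflexive (sym (+-assoc (δ c i) _ _)))) (u i))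
           (walk-paired ev wk) (λ i → sym (+-assoc (e i) _ _))
    where
    u : ∀ i → occ (c ∷ as) i + occ (concat Cs′) i ≤ 1
    u i = subst (_≤ 1) (occ≡ i) (Config.uniq K i)
  ... | T′ , K′ , same = T′ , Cs′ , K′ ,
        n≤0⇒n≡0 (+-cancelˡ-≤ 1 _ _ (≤-trans (+-monoˡ-≤ _ (occ-head c as)) (u c))) ,
        (λ i → ≤-trans (m≤n+m _ _) (≤-reflexive (sym (occ≡ i)))) ,
        λ j → same c j (n≤0⇒n≡0 (+-cancelˡ-≤ 1 _ _ (≤-trans (≤-trans (≤-reflexive (cong (_+ occ as c) (sym (δ-refl c)))) (m≤m+n _ _)) (u c))))
    where
    u : ∀ i → occ (c ∷ as) i + occ (concat Cs′) i ≤ 1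
    u i = subst (_≤ 1) (occ≡ i) (Config.uniq K i)

  -- Break the cycle at the neighbour x of c; the unit freed at x is then matched with the new unit of c.
  absorb : ∀ {T Cs w b e} c → Config T Cs w b (λ i → e i + δ c i) → 0 < occ (concat Cs) c →
    ∃ λ T′ → ∃ λ Cs′ → Config T′ Cs′ w b e
  absorb {T} {Cs} {w} {b} {e} c K p with extract Cs c (Config.cycles K) p
  ... | [] , Cs′ , occ≡ , (ev , wk) , cs = ⊥-elim (HalfEdge.distinct wk refl)
  ... | x ∷ as , Cs′ , occ≡ , (ev , (halfEdge d nt t s , wk)) , cs with dissolve x K x∈
    where
    x∈ : 0 < occ (concat Cs) x
    x∈ = subst (0 <_) (sym (occ≡ x)) (≤-trans (≤-trans (occ-head x as) (m≤n+m _ (δ c x))) (m≤m+n _ _))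
  ... | T′ , Cs″ , K′ , x∉ , _ , same = add x c T′ , Cs″ ,
    add-edge K′ (d ∘ sym) (trans (same c) (trans (Config.symm K x c) nt)) s (≤-reflexive (sym t)) x∉
      (λ i → lem (e i) (δ c i) (δ x i))
    where
    lem : ∀ a b c → a + b + c ≡ a + (c + b)
    lem = solve-∀

-- Optimal elements, pointwise updates and roles.

module _ (_≼_ : ℕ → ℕ → Set) (≼-trans : ∀ {x y z} → x ≼ y → y ≼ z → x ≼ z)
         (≼-refl : ∀ {x} → x ≼ x) (≼-total : ∀ x y → x ≼ y ⊎ y ≼ x) where

  optimum : ∀ {n} {P : Fin n → Set} → Decidable P → (m : Fin n → ℕ) →
            (∃ λ y → P y × ∀ j → P j → m y ≼ m j) ⊎ (∀ j → ¬ P j)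
  optimum {zero}  P? m = inj₂ λ ()
  optimum {suc n} P? m with P? zero | optimum (P? ∘ suc) (m ∘ suc)
  ... | yes p | inj₂ none = inj₁ (zero , p , λ { zero _ → ≼-refl ; (suc j) q → ⊥-elim (none j q) })
  ... | no ¬p | inj₂ none = inj₂ λ { zero → ¬p ; (suc j) → none j }
  ... | no ¬p | inj₁ (y , q , opt) = inj₁ (suc y , q , λ { zero p → ⊥-elim (¬p p) ; (suc j) → opt j })
  ... | yes p | inj₁ (y , q , opt) with ≼-total (m zero) (m (suc y))
  ...   | inj₁ le = inj₁ (zero , p , λ { zero _ → ≼-refl ; (suc j) q′ → ≼-trans le (opt j q′) })
  ...   | inj₂ le = inj₁ (suc y , q , λ { zero _ → le ; (suc j) → opt j })

minimal : ∀ {n} {P : Fin n → Set} → Decidable P → (m : Fin n → ℕ) →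
          (∃ λ y → P y × ∀ j → P j → m y ≤ m j) ⊎ (∀ j → ¬ P j)
minimal = optimum _≤_ ≤-trans ≤-refl ≤-total

maximal : ∀ {n} {P : Fin n → Set} → Decidable P → (m : Fin n → ℕ) →
          (∃ λ y → P y × ∀ j → P j → m j ≤ m y) ⊎ (∀ j → ¬ P j)
maximal = optimum (λ x y → y ≤ x) (λ p q → ≤-trans q p) ≤-refl (λ x y → ≤-total y x)

abstract
  _[_≔_] : ∀ {n} {A : Set} → (Fin n → A) → Fin n → A → Fin n → A
  (f [ k ≔ v ]) i = if does (i ≟ k) then v else f i

  at-≡ : ∀ {n} {A : Set} {f : Fin n → A} {k v} → (f [ k ≔ v ]) k ≡ v
  at-≡ {k = k} rewrite dec-true (k ≟ k) refl = refl

  at-≢ : ∀ {n} {A : Set} {f : Fin n → A} {k v i} → i ≢ k → (f [ k ≔ v ]) i ≡ f i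
  at-≢ {k = k} {i = i} i≢k rewrite dec-false (i ≟ k) i≢k = refl

-- Roles belong to one run: a `proposer` has held the free unit, a `receiver` has dropped its worst
-- partner for a proposer.
data Role : Set where
  none receiver proposer : Role

-- A single proposal and its possible outcomes.

module Insertion {n : ℕ} (r : Fin n → Fin n → ℕ) (r-inj : ∀ i {j k} → r i j ≡ r i k → j ≡ k)
  (r-self : ∀ i j → j ≢ i → r i j < r i i) (r-pos : ∀ i j → 0 < r i j) where

  open Configurations r public

  r≤self : ∀ i j → r i j ≤ r i i
  r≤self i j with j ≟ i
  ... | yes refl = ≤-refl
  ... | no j≢i = <⇒≤ (r-self i j j≢i)

  reoffset : ∀ {T Cs w b e e′} → Config T Cs w b e → (∀ i → deg T i + occ (concat Cs) i + e′ i ≤ b i) →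
             (∀ i → w i < r i i → e′ i ≡ e i) → Config T Cs w b e′
  reoffset K le eq = record { Config K ; total≤ = le
    ; full = λ i p → trans (cong (_ +_) (eq i p)) (Config.full K i p) }

  -- The case decides what a proposal to `i`, or the loss of a partner by `i`, leads to: spare
  -- capacity and odd cycles end the run, `tight` continues it or closes a new cycle, and in the
  -- case `empty` the threshold 0 rules out both events.
  data Saturation (T : Mat n) (Cs : List (List (Fin n))) (w b : Fin n → ℕ) (i : Fin n) : Set where
    slack   : w i ≡ r i i → deg T i + occ (concat Cs) i < b i → Saturation T Cs w b i
    onCycle : 0 < occ (concat Cs) i → Saturation T Cs w b i
    tight   : ∀ u → occ (concat Cs) i ≡ 0 → T i u ≡ true → w i ≡ r i u → Saturation T Cs w b i
    empty   : occ (concat Cs) i ≡ 0 → w i ≡ 0 → Saturation T Cs w b i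

  Result : (Fin n → ℕ) → Set
  Result b = ∃ λ T → ∃ λ Cs → ∃ λ w → Config T Cs w b (λ _ → 0)

  -- One unit of z is still unmatched. By strict, z ranks every agent that would accept z below its
  -- current partners, so that accepting the best of them leaves z full with that agent as its worst partner.
  record Seeking (T : Mat n) (Cs : List (List (Fin n))) (w b : Fin n → ℕ) (z : Fin n) : Set where
    field
      conf   : Config T Cs w b (δ z)
      sat    : ∀ i → i ≢ z → Saturation T Cs w b i
      z-free : occ (concat Cs) z ≡ 0
      z-lack : deg T z + occ (concat Cs) z + δ z z ≡ b z
      strict : ∀ j → T z j ≡ false → r j z < w j → w z < r z j
    open Config conf public

    no-offer : (∀ j → ¬ (T z j ≡ false × r j z < w j)) → Result b
    no-offer unwilling = T , Cs , w [ z ≔ r z z ] ,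
      reoffset (reweight conf within′ dom′ (λ i p → at-≢ (λ { refl → <⇒≢ p (sym z-free) })) w≤′ full′)
        (λ i → ≤-trans (+-monoʳ-≤ _ z≤n) (total≤ i))
        (λ i p → sym (δ-≢ {a = z} {i} λ { refl → <⇒≢ p at-≡ }))
      where
      within′ : ∀ i j → T i j ≡ true → r i j ≤ (w [ z ≔ r z z ]) i
      within′ i j t with i ≟ z
      ... | yes refl rewrite at-≡ {f = w} {z} {r z z} = r≤self z j
      ... | no i≢z rewrite at-≢ {f = w} {z} {r z z} i≢z = within i j t
      dom′ : ∀ i j → i ≢ j → T i j ≡ false → (w [ z ≔ r z z ]) i ≤ r i j ⊎ (w [ z ≔ r z z ]) j ≤ r j i
      dom′ i j i≢j f with i ≟ z | j ≟ z
      ... | yes refl | yes refl = ⊥-elim (i≢j refl)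
      ... | yes refl | no j≢z rewrite at-≢ {f = w} {z} {r z z} j≢z = inj₂ (≮⇒≥ λ p → unwilling j (f , p))
      ... | no i≢z | yes refl rewrite at-≢ {f = w} {z} {r z z} i≢z = inj₁ (≮⇒≥ λ p → unwilling i (trans (symm z i) f , p))
      ... | no i≢z | no j≢z rewrite at-≢ {f = w} {z} {r z z} i≢z | at-≢ {f = w} {z} {r z z} j≢z = dom i j i≢j f
      w≤′ : ∀ i → (w [ z ≔ r z z ]) i ≤ r i i
      w≤′ i with i ≟ z
      ... | yes refl rewrite at-≡ {f = w} {z} {r z z} = ≤-refl
      ... | no i≢z rewrite at-≢ {f = w} {z} {r z z} i≢z = w≤ i
      full′ : ∀ i → (w [ z ≔ r z z ]) i < r i i → w i < r i i ⊎ deg T i + occ (concat Cs) i + δ z i ≡ b i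
      full′ i p with i ≟ z
      ... | yes refl = inj₂ z-lack
      ... | no i≢z rewrite at-≢ {f = w} {z} {r z z} i≢z = inj₁ p

    module Offer (y : Fin n) (Tzy : T z y ≡ false) (willing : r y z < w y)
                 (best : ∀ j → T z j ≡ false × r j z < w j → r z y ≤ r z j) where

      w₁ : Fin n → ℕ
      w₁ = w [ z ≔ r z y ]

      z≢y : z ≢ y
      z≢y refl = <⇒≱ willing (w≤ z)

      wz<rzy : w z < r z y
      wz<rzy = strict y Tzy willing

      w₁z : w₁ z ≡ r z y
      w₁z = at-≡

      w₁≢ : ∀ {i} → i ≢ z → w₁ i ≡ w i
      w₁≢ = at-≢

      -- The threshold of `z` can be relaxed before the edge exists: by `best`, an agent that would
      -- take `z` is ranked no better than `y`, and every other unmatched pair at `z` is dominated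
      -- at its far end.
      offered : Config T Cs w₁ b (δ z)
      offered = reweight conf within′ dom′ (λ i p → w₁≢ (λ { refl → <⇒≢ p (sym z-free) })) w≤′ full′
        where
        within′ : ∀ i j → T i j ≡ true → r i j ≤ w₁ i
        within′ i j t with i ≟ z
        ... | yes refl = ≤-trans (within z j t) (≤-trans (<⇒≤ wz<rzy) (≤-reflexive (sym w₁z)))
        ... | no i≢z rewrite w₁≢ i≢z = within i j t
        dom′ : ∀ i j → i ≢ j → T i j ≡ false → w₁ i ≤ r i j ⊎ w₁ j ≤ r j i
        dom-z : ∀ j → j ≢ z → T z j ≡ false → w₁ z ≤ r z j ⊎ w₁ j ≤ r j z
        dom-z j j≢z f with r j z <? w j
        ... | yes p = inj₁ (≤-trans (≤-reflexive w₁z) (best j (f , p)))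
        ... | no ¬p = inj₂ (≤-trans (≤-reflexive (w₁≢ j≢z)) (≮⇒≥ ¬p))
        dom′ i j i≢j f with i ≟ z | j ≟ z
        ... | yes refl | yes refl = ⊥-elim (i≢j refl)
        ... | yes refl | no j≢z = dom-z j j≢z f
        ... | no i≢z | yes refl = [ inj₂ , inj₁ ]′ (dom-z i i≢z (trans (symm z i) f))
        ... | no i≢z | no j≢z rewrite w₁≢ i≢z | w₁≢ j≢z = dom i j i≢j f
        w≤′ : ∀ i → w₁ i ≤ r i i
        w≤′ i with i ≟ z
        ... | yes refl rewrite w₁z = r≤self z y
        ... | no i≢z rewrite w₁≢ i≢z = w≤ i
        full′ : ∀ i → w₁ i < r i i → w i < r i i ⊎ deg T i + occ (concat Cs) i + δ z i ≡ b i
        full′ i p with i ≟ z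
        ... | yes refl = inj₂ z-lack
        ... | no i≢z rewrite w₁≢ i≢z = inj₁ p

      ryz≤ : r y z ≤ w₁ y
      ryz≤ = ≤-trans (<⇒≤ willing) (≤-reflexive (sym (w₁≢ (z≢y ∘ sym))))

      accept-slack : w y ≡ r y y → deg T y + occ (concat Cs) y < b y → Result b
      accept-slack wy lt = add z y T , Cs , w₁ ,
        add-edge (reoffset {e′ = λ i → δ z i + δ y i} offered le eq) z≢y Tzy (≤-reflexive (sym w₁z)) ryz≤ z-free (λ i → refl)
        where
        le : ∀ i → deg T i + occ (concat Cs) i + (δ z i + δ y i) ≤ b i
        le i with y ≟ i
        ... | yes refl rewrite δ-≢ z≢y = ≤-trans (≤-reflexive (+-comm _ 1)) lt
        ... | no y≢i rewrite +-identityʳ (δ z i) = total≤ i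
        eq : ∀ i → w₁ i < r i i → δ z i + δ y i ≡ δ z i
        eq i p with y ≟ i
        ... | yes refl = ⊥-elim (<⇒≢ p (trans (w₁≢ (z≢y ∘ sym)) wy))
        ... | no _ = +-identityʳ _

      accept-cycle : 0 < occ (concat Cs) y → Result b
      accept-cycle p with dissolve y offered p
      ... | T′ , Cs′ , K′ , y∉ , _ , same = add y z T′ , Cs′ , w₁ ,
        add-edge K′ (z≢y ∘ sym) (trans (same z) (trans (symm y z) Tzy)) ryz≤ (≤-reflexive (sym w₁z)) y∉
          (λ i → +-comm (δ z i) _)

      module Displace (u : Fin n) (y-free : occ (concat Cs) y ≡ 0) (Tyu : T y u ≡ true) (wy : w y ≡ r y u) where

        T₁ : Mat n
        T₁ = add z y (del y u T)

        y≢u : y ≢ u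
        y≢u refl = true≢false Tyu (irr y)

        z≢u : z ≢ u
        z≢u refl = <⇒≢ willing (sym wy)

        -- The rank of `u` equals the threshold of `y`, so the dropped pair is dominated at `y` as
        -- it stands. Dropping it frees a unit at `y`, which goes to `z`, and one at `u`, which is
        -- now the free unit.
        displaced : Config T₁ Cs w₁ b (δ u)
        displaced = add-edge
          (del-edge offered {e′ = λ i → δ z i + (δ y i + δ u i)} Tyu
            (≤-reflexive (trans (w₁≢ (z≢y ∘ sym)) wy)) (λ i → refl))
          z≢y (del-old Tzy) (≤-reflexive (sym w₁z)) ryz≤ z-free (λ i → lem (δ z i) (δ y i) (δ u i))
          where
          lem : ∀ a b c → a + (b + c) ≡ c + (a + b)
          lem = solve-∀

        T₁zy : T₁ z y ≡ true
        T₁zy = add-ends (inj₁ (refl , refl))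

        T₁yu : T₁ y u ≡ false
        T₁yu = trans (add-other λ { (inj₁ (p , _)) → z≢y (sym p) ; (inj₂ (_ , p)) → z≢u (sym p) }) (del-ends (inj₁ (refl , refl)))

        T₁-other : ∀ {i j} → ¬ Ends z y i j → ¬ Ends y u i j → T₁ i j ≡ T i j
        T₁-other ¬e ¬f = trans (add-other ¬e) (del-other ¬f)

        T₁-true : ∀ {i j} → T₁ i j ≡ true → Ends z y i j ⊎ T i j ≡ true
        T₁-true t = [ inj₁ , (λ t′ → inj₂ (proj₂ (del-true t′))) ]′ (add-true t)

        T₁-false : ∀ {i j} → T₁ i j ≡ false → Ends y u i j ⊎ T i j ≡ false
        T₁-false f = del-false (proj₂ (add-false f))

-- Closing a chain of replacements into an odd cycle.

occ-fresh : ∀ {n} (x : Fin n) xs → (∀ i → occ xs i ≤ 1) → occ xs x ≡ 0 → ∀ i → occ (x ∷ xs) i ≤ 1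
occ-fresh x xs u x∉ i with x ≟ i
... | yes refl rewrite x∉ = ≤-refl
... | no  _    = u i

occ-zero : ∀ {n} (xs : List (Fin n)) x → (0 < occ xs x → ⊥) → occ xs x ≡ 0
occ-zero xs x ¬p = n≤0⇒n≡0 (≮⇒≥ ¬p)

occ-cases : ∀ {n} (x : Fin n) xs i → 0 < occ (x ∷ xs) i → i ≡ x ⊎ 0 < occ xs i
occ-cases x xs i p with x ≟ i
... | yes x≡i = inj₁ (sym x≡i)
... | no  _   = inj₂ p

module Closing {n : ℕ} (r : Fin n → Fin n → ℕ) (r-inj : ∀ i {j k} → r i j ≡ r i k → j ≡ k)
  (r-self : ∀ i j → j ≢ i → r i j < r i i) (r-pos : ∀ i j → 0 < r i j) where

  open Insertion r r-inj r-self r-pos public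

  del-pairs : ∀ {T Cs w b e} {as : List (Fin n)} (ev : EvenLength as) → Config T Cs w b e →
    (∀ i → occ as i ≤ 1) → Paired (λ q f → T q f ≡ true × w q ≤ r q f) ev →
    ∃ λ T′ → Config T′ Cs w b (λ i → e i + occ as i) × (∀ i j → T i j ≡ false → T′ i j ≡ false) ×
      Paired (λ q f → T′ q f ≡ false) ev
  del-pairs {T} {e = e} [] K u p = T , recount K (λ i → cong (_ +_) (+-identityʳ (e i))) ,
    (λ _ _ f → f) , _
  del-pairs {T} {b = b} {e} (_∷_ {xs} (q , f) ev) K u ((t , le) , p)
    with del-pairs ev (del-edge K {e′ = λ i → e i + (δ q i + δ f i)} t le (λ i → refl))
           (λ i → ≤-trans (≤-trans (m≤n+m _ (δ f i)) (m≤n+m _ (δ q i))) (u i))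
           (paired-map ev keep p)
    where
    q∉xs : occ xs q ≡ 0
    q∉xs = n≤0⇒n≡0 (+-cancelˡ-≤ 1 _ _ (≤-trans (≤-reflexive (cong (_+ occ xs q) (sym (δ-refl q))))
            (≤-trans (+-monoʳ-≤ (δ q q) (m≤n+m _ (δ f q))) (u q))))
    f∉xs : occ xs f ≡ 0
    f∉xs = n≤0⇒n≡0 (+-cancelˡ-≤ 1 _ _ (≤-trans (≤-reflexive (cong (_+ occ xs f) (sym (δ-refl f))))
            (≤-trans (m≤n+m _ (δ q f)) (u f))))
    keep : ∀ i j → 0 < occ xs i → 0 < occ xs j → T i j ≡ true × _ → del q f T i j ≡ true × _
    keep i j x y (t′ , l) = trans (del-other λ { (inj₁ (refl , _)) → <⇒≢ x (sym q∉xs) ; (inj₂ (refl , _)) → <⇒≢ x (sym f∉xs) }) t′ , l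
  ... | T′ , K′ , mono , p′ = T′ ,
        recount K′ (λ i → cong (b i +_) (sym (lem (e i) (δ q i) (δ f i) (occ xs i)))) ,
        (λ i j z → mono i j (del-old z)) , mono q f (del-ends (inj₁ (refl , refl))) , p′
    where
    lem : ∀ a b c d → a + (b + c) + d ≡ a + (b + (c + d))
    lem = solve-∀

  -- What a run of proposals leaves behind. τ is the time of the last event of an agent, D f the rank
  -- of the partner last dropped by the receiver f. Should f drop its worst partner again, the best
  -- agent willing to replace it is a proposer with a later time stamp (rec-next, rec-later).
  record History (T : Mat n) (Cs : List (List (Fin n))) (w : Fin n → ℕ) (z : Fin n)
                 (role : Fin n → Role) (D τ : Fin n → ℕ) : Set where
    field
      z-role     : role z ≡ proposer
      rec-free   : ∀ {f} → role f ≡ receiver → occ (concat Cs) f ≡ 0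
      prop-free  : ∀ {q} → role q ≡ proposer → occ (concat Cs) q ≡ 0
      rec-full   : ∀ {f} → role f ≡ receiver → w f < r f f
      prop-worst : ∀ {q} → role q ≡ proposer → q ≢ z →
                   ∃ λ f → T q f ≡ true × w q ≡ r q f × role f ≡ receiver × τ q ≤ τ f
      rec-next   : ∀ {f} → role f ≡ receiver → ∃ λ q → role q ≡ proposer × τ f < τ q × T f q ≡ false × r f q ≤ D f ×
                   -- The holder of the free unit may sit exactly at its threshold: its next
                   -- accepted offer worsens that threshold strictly, which restores the strict
                   -- inequality.
                   ((q ≢ z × r q f < w q) ⊎ (q ≡ z × r q f ≤ w q))
      rec-later  : ∀ {f q} → role f ≡ receiver → q ≢ z → T f q ≡ false → r q f < w q → r f q ≤ D f →
                   role q ≡ proposer × τ f < τ q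
      -- Keeps a pair of receivers dominated when both relax their thresholds at once, neither
      -- beyond the partner it last dropped.
      rec-rec    : ∀ {f g} → role f ≡ receiver → role g ≡ receiver → f ≢ g → T f g ≡ false →
                   D f ≤ r f g ⊎ D g ≤ r g f
      rec-early  : ∀ {f} → role f ≡ receiver → τ f < τ z
      latest     : ∀ i → τ i ≤ τ z

  rec≢prop : receiver ≢ proposer
  rec≢prop ()

  -- The worst partner u of y has already received a proposal. Following u to its best willing
  -- replacement q, q to its worst partner f′, f′ to its best willing replacement, and so on, time
  -- increases until z is reached; together with y this path is an odd cycle.
  module Close {T Cs w b z} (S : Seeking T Cs w b z) {role D τ} (H : History T Cs w z role D τ)
    (y : Fin n) (Tzy : T z y ≡ false) (willing : r y z < w y)
    (best : ∀ j → T z j ≡ false × r j z < w j → r z y ≤ r z j)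
    (u : Fin n) (y-free : occ (concat Cs) y ≡ 0) (Tyu : T y u ≡ true) (wy : w y ≡ r y u)
    (u-rec : role u ≡ receiver) where

    open Seeking S
    open History H
    open Offer y Tzy willing best
    open Displace u y-free Tyu wy
    module K₁ = Config displaced

    rec≢z : ∀ {f} → role f ≡ receiver → f ≢ z
    rec≢z p refl = rec≢prop (trans (sym p) z-role)

    rec≢prp : ∀ {f q} → role f ≡ receiver → role q ≡ proposer → f ≢ q
    rec≢prp p p′ refl = rec≢prop (trans (sym p) p′)

    w₁y : w₁ y ≡ r y u
    w₁y = trans (w₁≢ (z≢y ∘ sym)) wy

    record Link (f q f′ : Fin n) : Set where
      field
        f-rec   : role f ≡ receiver
        f≢y     : f ≢ y
        q-prop  : role q ≡ proposer
        q≢y     : q ≢ y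
        unm     : T₁ f q ≡ false
        within-D : r f q ≤ D f
        keen    : r q f < w₁ q
        first   : ∀ j → T₁ f j ≡ false → r j f < w₁ j → r f q ≤ r f j
        matched : T₁ q f′ ≡ true
        worst   : w₁ q ≡ r q f′
        later   : τ f < τ q
        f′-rec  : f′ ≡ y ⊎ (role f′ ≡ receiver × τ q ≤ τ f′)

    data Path : Fin n → List (Fin n) → Set where
      stop : Path y []
      step : ∀ {f q f′ as} → Link f q f′ → Path f′ as → Path f (q ∷ f′ ∷ as)

    T₁-off : ∀ {f q} → role f ≡ receiver → f ≢ y → T f q ≡ false → T₁ f q ≡ false
    T₁-off p f≢y t = trans (add-other λ { (inj₁ (e , _)) → rec≢z p e ; (inj₂ (e , _)) → f≢y e }) (del-old t)

    T-off : ∀ {f q} → f ≢ y → q ≢ y → T₁ f q ≡ false → T f q ≡ false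
    T-off f≢y q≢y t = [ (λ { (inj₁ (e , _)) → ⊥-elim (f≢y e) ; (inj₂ (_ , e)) → ⊥-elim (q≢y e) }) , (λ t′ → t′) ]′ (T₁-false t)

    -- Every link moves forward in time and receivers precede `z`, so the time left until `z` serves
    -- as fuel. The bound by `τ u` keeps `y` from occurring as a proposer: its worst partner is `u`,
    -- so the path would return to `u` at a later time.
    find-path : ∀ k f → role f ≡ receiver → τ u ≤ τ f → τ z ≤ τ f + k → ∃ λ as → Path f as
    find-path zero    f p _ fuel = ⊥-elim (<⇒≱ (rec-early p) (subst (τ z ≤_) (+-identityʳ (τ f)) fuel))
    find-path (suc k) f p τu≤ fuel with f ≟ y
    ... | yes refl = [] , stop
    ... | no f≢y with minimal (λ j → (T₁ f j ≟ᵇ false) ×-dec (r j f <? w₁ j)) (r f)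
    ...   | inj₂ unwilling = ⊥-elim (unwilling c (T₁-off p f≢y Tfc , keen-c c-keen))
      where
      c = proj₁ (rec-next p)
      Tfc = proj₁ (proj₂ (proj₂ (proj₂ (rec-next p))))
      c-keen = proj₂ (proj₂ (proj₂ (proj₂ (proj₂ (rec-next p)))))
      keen-c : (c ≢ z × r c f < w c) ⊎ (c ≡ z × r c f ≤ w c) → r c f < w₁ c
      keen-c (inj₁ (c≢z , lt)) = subst (r c f <_) (sym (w₁≢ c≢z)) lt
      keen-c (inj₂ (e , le)) rewrite e = ≤-<-trans le (subst (w z <_) (sym w₁z) wz<rzy)
    ...   | inj₁ (q , (T₁fq , keen-q) , min) with rec-next p
    ...     | c , _ , _ , Tfc , fc≤D , c-keen = go (q ≟ z)
      where
      keen-c : (c ≢ z × r c f < w c) ⊎ (c ≡ z × r c f ≤ w c) → r c f < w₁ c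
      keen-c (inj₁ (c≢z , lt)) = subst (r c f <_) (sym (w₁≢ c≢z)) lt
      keen-c (inj₂ (e , le)) rewrite e = ≤-<-trans le (subst (w z <_) (sym w₁z) wz<rzy)
      fq≤D : r f q ≤ D f
      fq≤D = ≤-trans (min c (T₁-off p f≢y Tfc , keen-c c-keen)) fc≤D
      go : Dec (q ≡ z) → ∃ λ as → Path f as
      go (yes refl) = z ∷ y ∷ [] , step (record
        { f-rec = p ; f≢y = f≢y ; q-prop = z-role ; q≢y = z≢y ; unm = T₁fq ; within-D = fq≤D ; keen = keen-q
        ; first = λ j t l → min j (t , l) ; matched = T₁zy ; worst = w₁z ; later = rec-early p ; f′-rec = inj₁ refl }) stop
      go (no q≢z) with rec-later p q≢z Tfq keen-q′ fq≤D
        where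
        Tfq : T f q ≡ false
        Tfq with T₁-false T₁fq
        ... | inj₁ (inj₁ (e , _)) = ⊥-elim (f≢y e)
        ... | inj₁ (inj₂ (refl , refl)) = ⊥-elim (<⇒≢ keen-q (sym w₁y))
        ... | inj₂ t = t
        keen-q′ : r q f < w q
        keen-q′ = subst (r q f <_) (w₁≢ q≢z) keen-q
      ... | q-prop , τf<τq with prop-worst q-prop q≢z
      ...   | f′ , Tqf′ , wq , p′ , τq≤ with find-path k f′ p′ (≤-trans τu≤ (≤-trans (<⇒≤ τf<τq) τq≤))
                  (≤-trans fuel (≤-trans (≤-reflexive (+-suc (τ f) k)) (+-monoˡ-≤ k (≤-trans τf<τq τq≤))))
      ...     | as , path = q ∷ f′ ∷ as , step (record
        { f-rec = p ; f≢y = f≢y ; q-prop = q-prop ; q≢y = q≢y ; unm = T₁fq ; within-D = fq≤D ; keen = keen-q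
        ; first = λ j t l → min j (t , l) ; matched = T₁qf′ ; worst = trans (w₁≢ q≢z) wq ; later = τf<τq
        ; f′-rec = inj₂ (p′ , τq≤) }) path
        where
        q≢y : q ≢ y
        q≢y refl with r-inj y (trans (sym wq) wy)
        ... | refl = <⇒≱ τf<τq (≤-trans τq≤ τu≤)
        T₁qf′ : T₁ q f′ ≡ true
        T₁qf′ = add-old (trans (del-other λ { (inj₁ (e , _)) → q≢y e ; (inj₂ (e , _)) → rec≢prp u-rec q-prop (sym e) }) Tqf′)

    -- Every receiver on the path lowers its threshold to the proposer that follows it.
    low : Fin n → List (Fin n) → Fin n → ℕ
    low f (q ∷ f′ ∷ as) = low f′ as [ f ≔ r f q ]
    low f _             = w₁

    low-cases : ∀ {f as} → Path f as → ∀ i → low f as i ≡ w₁ i ⊎ ∃ λ q → ∃ λ f′ → Link i q f′ × low f as i ≡ r i q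
    low-cases stop i = inj₁ refl
    low-cases {f} (step l path) i with i ≟ f
    ... | yes refl = inj₂ (_ , _ , l , at-≡)
    ... | no i≢f with low-cases path i
    ...   | inj₁ eq = inj₁ (trans (at-≢ i≢f) eq)
    ...   | inj₂ (q , f′ , l′ , eq) = inj₂ (q , f′ , l′ , trans (at-≢ i≢f) eq)

    low-hit : ∀ {f as} → Path f as → ∀ i → 0 < occ (f ∷ as) i → role i ≡ receiver → i ≢ y →
              ∃ λ q → ∃ λ f′ → Link i q f′ × low f as i ≡ r i q
    low-hit stop i p i-rec i≢y = ⊥-elim ([ i≢y , (λ ()) ]′ (occ-cases y [] i p))
    low-hit {f} (step {q = q} {f′} {as} l path) i p i-rec i≢y with i ≟ f
    ... | yes refl = _ , _ , l , at-≡
    ... | no i≢f with occ-cases f (q ∷ f′ ∷ as) i p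
    ...   | inj₁ e = ⊥-elim (i≢f e)
    ...   | inj₂ p′ with occ-cases q (f′ ∷ as) i p′
    ...     | inj₁ e = ⊥-elim (rec≢prp i-rec (Link.q-prop l) e)
    ...     | inj₂ p″ with low-hit path i p″ i-rec i≢y
    ...       | q′ , f′ , l′ , eq = q′ , f′ , l′ , trans (at-≢ i≢f) eq

    low-miss : ∀ {f as} → Path f as → ∀ i → (role i ≡ receiver → i ≢ y → ⊥) → low f as i ≡ w₁ i
    low-miss stop i ¬p = refl
    low-miss (step l path) i ¬p = trans (at-≢ λ { refl → ¬p (Link.f-rec l) (Link.f≢y l) }) (low-miss path i ¬p)

    link-unique : ∀ {f q q′ f′ f″} → Link f q f′ → Link f q′ f″ → r f q ≡ r f q′
    link-unique l l′ = ≤-antisym (Link.first l _ (Link.unm l′) (Link.keen l′)) (Link.first l′ _ (Link.unm l) (Link.keen l))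

    path-done : ∀ {f as} → Path f as → f ≡ y → ∀ i → occ as i ≡ 0
    path-done stop       e i = refl
    path-done (step l _) e i = ⊥-elim (Link.f≢y l e)

    -- Increasing time is what rules out repeated vertices in `path-uniq`. The end `y` is exempt
    -- because its present acceptance has no time stamp yet.
    path-later : ∀ {f as} → Path f as → ∀ i → 0 < occ as i → i ≡ y ⊎ τ f < τ i
    path-later (step {q = q} {f′} {as} l path) i p with occ-cases q (f′ ∷ as) i p
    ... | inj₁ refl = inj₂ (Link.later l)
    ... | inj₂ p′ with Link.f′-rec l | occ-cases f′ as i p′
    ...   | inj₁ e | inj₁ e′ = inj₁ (trans e′ e)
    ...   | inj₁ e | inj₂ p″ = ⊥-elim (<⇒≢ p″ (sym (path-done path e i)))
    ...   | inj₂ (_ , le) | inj₁ refl = inj₂ (<-≤-trans (Link.later l) le)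
    ...   | inj₂ (_ , le) | inj₂ p″ with path-later path i p″
    ...     | inj₁ e = inj₁ e
    ...     | inj₂ lt = inj₂ (<-trans (<-≤-trans (Link.later l) le) lt)

    path-uniq : ∀ {f as} → Path f as → ∀ i → occ (f ∷ as) i ≤ 1
    path-uniq stop = occ-fresh y [] (λ i → z≤n) refl
    path-uniq {f} (step {q = q} {f′} {as} l path) = occ-fresh f (q ∷ f′ ∷ as) (occ-fresh q (f′ ∷ as) (path-uniq path) q∉) f∉
      where
      f∉ : occ (q ∷ f′ ∷ as) f ≡ 0
      f∉ = occ-zero (q ∷ f′ ∷ as) f λ p → [ Link.f≢y l , <-irrefl refl ]′ (path-later (step l path) f p)
      q∉ : occ (f′ ∷ as) q ≡ 0
      q∉ = occ-zero (f′ ∷ as) q λ p → [ (λ { refl → true≢false (Link.matched l) (K₁.irr q) }) , deep ]′ (occ-cases f′ as q p)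
        where
        deep : 0 < occ as q → ⊥
        deep p with path-later path q p | Link.f′-rec l
        ... | inj₁ e | _ = Link.q≢y l e
        ... | inj₂ lt | inj₁ e = <⇒≢ p (sym (path-done path e q))
        ... | inj₂ lt | inj₂ (_ , le) = <⇒≱ lt le

    path-free : ∀ {f as} → Path f as → ∀ i → 0 < occ (f ∷ as) i → occ (concat Cs) i ≡ 0
    path-free stop i p = [ (λ { refl → y-free }) , (λ ()) ]′ (occ-cases y [] i p)
    path-free {f} (step {q = q} {f′} {as} l path) i p with occ-cases f (q ∷ f′ ∷ as) i p
    ... | inj₁ refl = rec-free (Link.f-rec l)
    ... | inj₂ p′ = [ (λ { refl → prop-free (Link.q-prop l) }) , path-free path i ]′ (occ-cases q (f′ ∷ as) i p′)

    -- Each link adds one proposer and one receiver, so the starting point `u` makes the cycle odd.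
    path-even : ∀ {f as} → Path f as → EvenLength as
    path-even stop          = []
    path-even (step l path) = _ ∷ path-even path

    -- Non-edges from receiver to proposer alternate with edges from proposer to worst partner.
    -- Deleting the latter gives every vertex after `u` a loose unit, and `u` holds the one it was
    -- dropped with: exactly one unit per vertex, as a cycle of half-edges requires.
    close : Result b
    close with find-path (τ z) u u-rec ≤-refl (m≤n+m _ (τ u))
    ... | as , path = finish (del-pairs (path-even path) lowered as-uniq (removable path (λ i eq → trans (W≡w₁ i eq) refl)))
      where
      W = low u as

      W≡w₁ : ∀ i → (role i ≡ receiver → i ≢ y → ⊥) → W i ≡ w₁ i
      W≡w₁ = low-miss path

      uniq-u : ∀ i → occ (u ∷ as) i ≤ 1
      uniq-u = path-uniq path

      as-uniq : ∀ i → occ as i ≤ 1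
      as-uniq i = ≤-trans (m≤n+m _ (δ u i)) (uniq-u i)

      link-≥ : ∀ {f q f′} → Link f q f′ → w₁ f ≤ r f q
      link-≥ {f} {q} l with K₁.dom f q (rec≢prp (Link.f-rec l) (Link.q-prop l)) (Link.unm l)
      ... | inj₁ le = le
      ... | inj₂ le = ⊥-elim (<⇒≱ (Link.keen l) le)

      w₁≤W : ∀ i → w₁ i ≤ W i
      w₁≤W i with low-cases path i
      ... | inj₁ eq = ≤-reflexive (sym eq)
      ... | inj₂ (q , f′ , l , eq) = ≤-trans (link-≥ l) (≤-reflexive (sym eq))

      dom-W : ∀ i j → i ≢ j → T₁ i j ≡ false → W i ≤ r i j ⊎ W j ≤ r j i
      dom-W i j i≢j t with low-cases path i | low-cases path j
      ... | inj₁ ei | inj₁ ej rewrite ei | ej = K₁.dom i j i≢j t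
      -- Here only `i` has relaxed, and only to its best taker: a `j` that would accept `i` is
      -- ranked no better.
      ... | inj₂ (q , f′ , l , ei) | inj₁ ej rewrite ei | ej with r j i <? w₁ j
      ...   | yes lt = inj₁ (Link.first l j t lt)
      ...   | no ¬lt = inj₂ (≮⇒≥ ¬lt)
      dom-W i j i≢j t | inj₁ ei | inj₂ (q , f′ , l , ej) rewrite ei | ej with r i j <? w₁ i
      ...   | yes lt = inj₂ (Link.first l i (trans (K₁.symm j i) t) lt)
      ...   | no ¬lt = inj₁ (≮⇒≥ ¬lt)
      dom-W i j i≢j t | inj₂ (q , f′ , l , ei) | inj₂ (q′ , f″ , l′ , ej) rewrite ei | ej
        with rec-rec (Link.f-rec l) (Link.f-rec l′) i≢j (T-off (Link.f≢y l) (Link.f≢y l′) t)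
      ... | inj₁ le = inj₁ (≤-trans (Link.within-D l) le)
      ... | inj₂ le = inj₂ (≤-trans (Link.within-D l′) le)

      lowered : Config T₁ Cs W b (δ u)
      lowered = reweight displaced
        (λ i j t → ≤-trans (K₁.within i j t) (w₁≤W i)) dom-W
        (λ i p → W≡w₁ i λ i-rec _ → <⇒≢ p (sym (rec-free i-rec)))
        (λ i → [ (λ eq → subst (_≤ r i i) (sym eq) (K₁.w≤ i)) , (λ { (q , _ , _ , eq) → subst (_≤ r i i) (sym eq) (r≤self i q) }) ]′ (low-cases path i))
        (λ i p → inj₁ ([ (λ eq → subst (_< r i i) eq p) , (λ { (_ , _ , l , _) → subst (_< r i i) (sym (w₁≢ (rec≢z (Link.f-rec l)))) (rec-full (Link.f-rec l)) }) ]′ (low-cases path i)))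

      prop-W : ∀ {q} → role q ≡ proposer → W q ≡ w₁ q
      prop-W {q} p = W≡w₁ q λ p′ _ → rec≢prp p′ p refl

      removable : ∀ {f as′} (path′ : Path f as′) → (∀ i → (role i ≡ receiver → i ≢ y → ⊥) → W i ≡ w₁ i) →
                  Paired (λ q f → T₁ q f ≡ true × W q ≤ r q f) (path-even path′)
      removable stop _ = _
      removable (step l path′) eq = (Link.matched l , ≤-reflexive (trans (prop-W (Link.q-prop l)) (Link.worst l))) , removable path′ eq

      finish : (∃ λ T′ → Config T′ Cs W b (λ i → δ u i + occ as i) × (∀ i j → T₁ i j ≡ false → T′ i j ≡ false) ×
                 Paired (λ q f → T′ q f ≡ false) (path-even path)) → Result b
      finish (T′ , K′ , mono , removed) = T′ , (u ∷ as) ∷ Cs , W ,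
        add-cycle K′ {L = u ∷ as} (path-even path , walk path (λ i p → p) removed) uniq-Cs (λ i → refl)
        where
        uniq-Cs : ∀ i → occ (u ∷ as) i + occ (concat Cs) i ≤ 1
        uniq-Cs i with 0 <? occ (u ∷ as) i
        ... | yes p rewrite path-free path i p | +-identityʳ (occ (u ∷ as) i) = uniq-u i
        ... | no ¬p rewrite occ-zero (u ∷ as) i ¬p = uniq i

        u≤W : r u y ≤ W u
        u≤W = ≤-trans (within u y (trans (symm u y) Tyu)) (≤-trans (≤-reflexive (sym (w₁≢ (z≢u ∘ sym)))) (w₁≤W u))

        walk : ∀ {f as′} (path′ : Path f as′) → (∀ i → 0 < occ (f ∷ as′) i → 0 < occ (u ∷ as) i) →
               Paired (λ q f → T′ q f ≡ false) (path-even path′) → Walk (HalfEdge T′ W) f as′ u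
        -- The closing edge: `y` has just dropped `u`, whose rank is still its threshold.
        walk stop sub rm = halfEdge y≢u (mono y u T₁yu)
          (trans (W≡w₁ y λ _ ¬e → ¬e refl) w₁y) u≤W
        walk {f} (step {q = q} {f′} {as′} l path′) sub (rm , rms) =
          halfEdge (rec≢prp (Link.f-rec l) (Link.q-prop l)) (mono f q (Link.unm l)) Wf (≤-trans (<⇒≤ (Link.keen l)) (≤-reflexive (sym (prop-W (Link.q-prop l))))) ,
          halfEdge (λ { refl → true≢false (Link.matched l) (K₁.irr q) }) rm (trans (prop-W (Link.q-prop l)) (Link.worst l))
            (≤-trans (K₁.within f′ q (trans (K₁.symm f′ q) (Link.matched l))) (w₁≤W f′)) ,
          walk path′ (λ i p → sub i (≤-trans p (≤-trans (m≤n+m _ (δ q i)) (m≤n+m _ (δ f i))))) rms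
          where
          Wf : W f ≡ r f q
          Wf with low-hit path f (sub f (occ-head f (q ∷ f′ ∷ as′))) (Link.f-rec l) (Link.f≢y l)
          ... | _ , _ , l′ , eq = trans eq (link-unique l′ l)

-- The run of proposals, its termination, and the induction on capacities.

sum-mono-≤ : ∀ {n} {g h : Fin n → ℕ} → (∀ i → g i ≤ h i) → sum g ≤ sum h
sum-mono-≤ {zero}  le = z≤n
sum-mono-≤ {suc n} le = +-mono-≤ (le zero) (sum-mono-≤ (le ∘ suc))

sum-mono-< : ∀ {n} {g h : Fin n → ℕ} k → (∀ i → g i ≤ h i) → g k < h k → sum g < sum h
sum-mono-< zero    le lt = +-mono-<-≤ lt (sum-mono-≤ (le ∘ suc))
sum-mono-< (suc k) le lt = +-mono-≤-< (le zero) (sum-mono-< k (le ∘ suc) lt)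

receiver? : ∀ x → Dec (x ≡ receiver)
receiver? none     = no λ ()
receiver? receiver = yes refl
receiver? proposer = no λ ()

module Existence {n : ℕ} (r : Fin n → Fin n → ℕ) (r-inj : ∀ i {j k} → r i j ≡ r i k → j ≡ k)
  (r-self : ∀ i j → j ≢ i → r i j < r i i) (r-pos : ∀ i j → 0 < r i j) where

  open Closing r r-inj r-self r-pos public

  weight : Role → ℕ → ℕ
  weight proposer x = x
  weight _        x = 0

  -- The thresholds of proposers only get worse, which bounds the number of steps.
  potential : (Fin n → Role) → (Fin n → ℕ) → ℕ
  potential role w = sum (λ i → weight (role i) (w i))

  weight≤ : ∀ x {m k} → m ≤ k → weight x m ≤ k
  weight≤ none     le = z≤n
  weight≤ receiver le = z≤n
  weight≤ proposer le = le

  module Step {T Cs w b z} (S : Seeking T Cs w b z) {role D τ} (H : History T Cs w z role D τ)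
    (y : Fin n) (Tzy : T z y ≡ false) (willing : r y z < w y)
    (best : ∀ j → T z j ≡ false × r j z < w j → r z y ≤ r z j)
    (u : Fin n) (y-free : occ (concat Cs) y ≡ 0) (Tyu : T y u ≡ true) (wy : w y ≡ r y u)
    (u≢rec : role u ≢ receiver)
    (v : Fin n) (u-free : occ (concat Cs) u ≡ 0) (Tuv : T u v ≡ true) (wu : w u ≡ r u v) where

    open Seeking S
    open History H
    open Offer y Tzy willing best
    open Displace u y-free Tyu wy
    module K₁ = Config displaced

    y≢z : y ≢ z
    y≢z = z≢y ∘ sym

    -- A proposer other than `z` has a receiver as its worst partner, whereas the worst partner `u`
    -- of `y` is no receiver. This is what makes roles permanent.
    y≢prop : role y ≢ proposer
    y≢prop p with prop-worst p y≢z
    ... | f , _ , wy′ , f-rec , _ with r-inj y (trans (sym wy′) wy)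
    ...   | refl = u≢rec f-rec

    worst-of-y : ∃ λ p → T₁ y p ≡ true × ∀ j → T₁ y j ≡ true → r y j ≤ r y p
    worst-of-y with maximal (λ j → T₁ y j ≟ᵇ true) (r y)
    ... | inj₁ found = found
    ... | inj₂ absurd = ⊥-elim (absurd z (trans (K₁.symm y z) T₁zy))

    p = proj₁ worst-of-y
    T₁yp = proj₁ (proj₂ worst-of-y)

    p≢y : p ≢ y
    p≢y e = true≢false (subst (λ j → T₁ y j ≡ true) e T₁yp) (K₁.irr y)

    rp<ru : r y p < r y u
    rp<ru with T₁-true T₁yp
    ... | inj₁ (inj₁ (e , _)) = ⊥-elim (y≢z e)
    ... | inj₁ (inj₂ (_ , e)) = subst₂ _<_ (cong (r y) (sym e)) wy willing
    ... | inj₂ t = ≤∧≢⇒< (≤-trans (within y p t) (≤-reflexive wy)) λ e →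
          true≢false (subst (λ j → T₁ y j ≡ true) (r-inj y e) T₁yp) T₁yu

    w₂ : Fin n → ℕ
    w₂ = w₁ [ y ≔ r y p ]

    w₂y : w₂ y ≡ r y p
    w₂y = at-≡

    w₂≢ : ∀ {i} → i ≢ y → w₂ i ≡ w₁ i
    w₂≢ = at-≢

    w₂-old : ∀ {i} → i ≢ y → i ≢ z → w₂ i ≡ w i
    w₂-old i≢y i≢z = trans (w₂≢ i≢y) (w₁≢ i≢z)

    w₂z : w₂ z ≡ r z y
    w₂z = trans (w₂≢ z≢y) w₁z

    w₂u : w₂ u ≡ w u
    w₂u = w₂-old (y≢u ∘ sym) (z≢u ∘ sym)

    w₂≤w₁ : ∀ i → w₂ i ≤ w₁ i
    w₂≤w₁ i with i ≟ y
    ... | yes refl = ≤-trans (≤-reflexive w₂y) (≤-trans (<⇒≤ rp<ru) (≤-reflexive (sym (trans (w₁≢ y≢z) wy))))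
    ... | no i≢y = ≤-reflexive (w₂≢ i≢y)

    conf₂ : Config T₁ Cs w₂ b (δ u)
    conf₂ = reweight displaced within₂
      (λ i j i≢j f → [ (λ le → inj₁ (≤-trans (w₂≤w₁ i) le)) , (λ le → inj₂ (≤-trans (w₂≤w₁ j) le)) ]′ (K₁.dom i j i≢j f))
      (λ i q → w₂≢ λ { refl → <⇒≢ q (sym y-free) })
      (λ i → ≤-trans (w₂≤w₁ i) (K₁.w≤ i)) full₂
      where
      within₂ : ∀ i j → T₁ i j ≡ true → r i j ≤ w₂ i
      within₂ i j t with i ≟ y
      ... | yes refl = ≤-trans (proj₂ (proj₂ worst-of-y) j t) (≤-reflexive (sym w₂y))
      ... | no i≢y = ≤-trans (K₁.within i j t) (≤-reflexive (sym (w₂≢ i≢y)))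
      full₂ : ∀ i → w₂ i < r i i → w₁ i < r i i ⊎ deg T₁ i + occ (concat Cs) i + δ u i ≡ b i
      full₂ i lt with i ≟ y
      ... | yes refl = inj₁ (subst (_< r y y) (sym (trans (w₁≢ y≢z) wy)) (r-self y u (y≢u ∘ sym)))
      ... | no i≢y = inj₁ (subst (_< r i i) (w₂≢ i≢y) lt)

    module K₂ = Config conf₂

    off-edges : ∀ {i j} → i ≢ z → i ≢ y → i ≢ u → T₁ i j ≡ T i j
    off-edges i≢z i≢y i≢u = T₁-other (λ { (inj₁ (e , _)) → i≢z e ; (inj₂ (e , _)) → i≢y e })
                                     (λ { (inj₁ (e , _)) → i≢y e ; (inj₂ (e , _)) → i≢u e })

    deg≡ : ∀ {i} → i ≢ z → i ≢ y → i ≢ u → deg T i ≡ deg T₁ i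
    deg≡ {i} i≢z i≢y i≢u = sum-cong-≗ {_} {λ j → ind (T i j)} {λ j → ind (T₁ i j)}
      (λ j → cong ind (sym (off-edges {i} {j} i≢z i≢y i≢u)))

    sat₂ : ∀ i → i ≢ u → Saturation T₁ Cs w₂ b i
    sat₂ i i≢u with i ≟ y | i ≟ z
    ... | yes refl | _ = tight p y-free T₁yp w₂y
    ... | no i≢y | yes refl = tight y z-free T₁zy w₂z
    ... | no i≢y | no i≢z with sat i i≢z
    ...   | slack wi lt = slack (trans (w₂-old i≢y i≢z) wi)
            (subst (λ k → k + occ (concat Cs) i < b i) (deg≡ i≢z i≢y i≢u) lt)
    ...   | onCycle q = onCycle q
    ...   | tight x i-free Tix wi = tight x i-free (trans (off-edges i≢z i≢y i≢u) Tix) (trans (w₂-old i≢y i≢z) wi)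
    ...   | empty i-free wi = empty i-free (trans (w₂-old i≢y i≢z) wi)

    wu<ruu : w u < r u u
    wu<ruu = subst (_< r u u) (sym wu) (r-self u v λ { refl → true≢false Tuv (irr u) })

    T₁uj : ∀ {j} → j ≢ y → T₁ u j ≡ false → T u j ≡ false
    T₁uj j≢y f with T₁-false f
    ... | inj₁ (inj₁ (e , _)) = ⊥-elim (y≢u (sym e))
    ... | inj₁ (inj₂ (_ , e)) = ⊥-elim (j≢y e)
    ... | inj₂ t = t

    -- The threshold of `u` is attained at its partner `v`, so by injectivity of ranks an unmatched
    -- pair dominated at `u` is dominated strictly. The pair with `y` is no exception: `y` has
    -- improved past `u` and would not take it back.
    S₂ : Seeking T₁ Cs w₂ b u
    S₂ = record { conf = conf₂ ; sat = sat₂ ; z-free = u-free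
      ; z-lack = K₂.full u (subst (_< r u u) (sym w₂u) wu<ruu) ; strict = strict₂ }
      where
      strict₂ : ∀ j → T₁ u j ≡ false → r j u < w₂ j → w₂ u < r u j
      strict₂ j f lt with j ≟ y
      ... | yes refl = ⊥-elim (<-asym rp<ru (subst (r y u <_) w₂y lt))
      ... | no j≢y with K₂.dom u j (λ { refl → <⇒≱ lt (K₂.w≤ u) }) f
      ...   | inj₂ le = ⊥-elim (<⇒≱ lt le)
      ...   | inj₁ le = ≤∧≢⇒< le λ e → true≢false
              (subst (λ x → T u x ≡ true) (r-inj u (trans (sym wu) (trans (sym w₂u) e))) Tuv) (T₁uj j≢y f)

    role₂ : Fin n → Role
    role₂ = (role [ y ≔ receiver ]) [ u ≔ proposer ]

    role₂u : role₂ u ≡ proposer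
    role₂u = at-≡

    role₂y : role₂ y ≡ receiver
    role₂y = trans (at-≢ y≢u) at-≡

    role₂≢ : ∀ {i} → i ≢ y → i ≢ u → role₂ i ≡ role i
    role₂≢ i≢y i≢u = trans (at-≢ i≢u) (at-≢ i≢y)

    rec₂ : ∀ {f} → role₂ f ≡ receiver → f ≡ y ⊎ (role f ≡ receiver × f ≢ y)
    rec₂ {f} q with f ≟ y | f ≟ u
    ... | yes e | _ = inj₁ e
    ... | no f≢y | yes refl = ⊥-elim (rec≢prop (trans (sym q) role₂u))
    ... | no f≢y | no f≢u = inj₂ (trans (sym (role₂≢ f≢y f≢u)) q , f≢y)

    prop₂ : ∀ {q} → role₂ q ≡ proposer → q ≡ u ⊎ role q ≡ proposer
    prop₂ {q} e with q ≟ y | q ≟ u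
    ... | _ | yes q≡u = inj₁ q≡u
    ... | yes refl | no q≢u = ⊥-elim (rec≢prop (trans (sym role₂y) e))
    ... | no q≢y | no q≢u = inj₂ (trans (sym (role₂≢ q≢y q≢u)) e)

    -- The clock of a run: `y` receives at the time at which `z` proposes, and `u` proposes one tick
    -- later. Hence the weak inequality in `prop-worst` and the strict one in `rec-next`.
    D₂ τ₂ : Fin n → ℕ
    D₂ = D [ y ≔ w y ]
    τ₂ = (τ [ y ≔ τ z ]) [ u ≔ suc (τ z) ]

    τ₂u : τ₂ u ≡ suc (τ z)
    τ₂u = at-≡

    τ₂y : τ₂ y ≡ τ z
    τ₂y = trans (at-≢ y≢u) at-≡

    τ₂≢ : ∀ {i} → i ≢ y → i ≢ u → τ₂ i ≡ τ i
    τ₂≢ i≢y i≢u = trans (at-≢ i≢u) (at-≢ i≢y)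

    rec≢z : ∀ {f} → role f ≡ receiver → f ≢ z
    rec≢z q refl = rec≢prop (trans (sym q) z-role)

    rec≢u : ∀ {f} → role f ≡ receiver → f ≢ u
    rec≢u q refl = u≢rec q

    T₁fq : ∀ {f q} → role f ≡ receiver → f ≢ y → T₁ f q ≡ T f q
    T₁fq f-rec f≢y = off-edges (rec≢z f-rec) f≢y (rec≢u f-rec)

    prop≢y : ∀ {q} → role q ≡ proposer → q ≢ y
    prop≢y q refl = y≢prop q

    H₂ : History T₁ Cs w₂ u role₂ D₂ τ₂
    H₂ = record
      { z-role = role₂u
      ; rec-free = λ q → [ (λ { refl → y-free }) , (λ { (q′ , _) → rec-free q′ }) ]′ (rec₂ q)
      ; prop-free = λ q → [ (λ { refl → u-free }) , prop-free ]′ (prop₂ q)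
      ; rec-full = λ q → [ (λ { refl → subst (_< r y y) (sym w₂y) (r-self y p p≢y) }) ,
          (λ { (q′ , f≢y) → subst (_< _) (sym (w₂-old f≢y (rec≢z q′))) (rec-full q′) }) ]′ (rec₂ q)
      ; prop-worst = λ q q≢u → [ (λ e → ⊥-elim (q≢u e)) , (λ q′ → prop-worst₂ q′ q≢u) ]′ (prop₂ q)
      ; rec-next = λ q → [ (λ { refl → rec-next-y }) , (λ { (q′ , f≢y) → rec-next₂ q′ f≢y (rec-next q′) }) ]′ (rec₂ q)
      ; rec-later = λ q q≢u f lt le → [ (λ { refl → ⊥-elim (rec-later-y q≢u f lt le) }) , (λ { (q′ , f≢y) → rec-later₂ q′ f≢y q≢u f lt le }) ]′ (rec₂ q)
      ; rec-rec = rec-rec₂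
      ; rec-early = λ q → rec-early₂ q
      ; latest = λ i → subst (τ₂ i ≤_) (sym τ₂u) (latest₂ i)
      }
      where
      latest₂ : ∀ i → τ₂ i ≤ suc (τ z)
      latest₂ i with i ≟ y | i ≟ u
      ... | _ | yes refl = ≤-reflexive τ₂u
      ... | yes refl | no _ = ≤-trans (≤-reflexive τ₂y) (n≤1+n _)
      ... | no i≢y | no i≢u = ≤-trans (≤-reflexive (τ₂≢ i≢y i≢u)) (≤-trans (latest i) (n≤1+n _))

      rec-early₂ : ∀ {f} → role₂ f ≡ receiver → τ₂ f < τ₂ u
      rec-early₂ {f} q with rec₂ q
      ... | inj₁ refl = subst₂ _<_ (sym τ₂y) (sym τ₂u) ≤-refl
      ... | inj₂ (q′ , f≢y) = subst₂ _<_ (sym (τ₂≢ f≢y (rec≢u q′))) (sym τ₂u) (s≤s (latest f))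

      prop-worst₂ : ∀ {q} → role q ≡ proposer → q ≢ u →
        ∃ λ f → T₁ q f ≡ true × w₂ q ≡ r q f × role₂ f ≡ receiver × τ₂ q ≤ τ₂ f
      prop-worst₂ {q} q-prop q≢u with q ≟ z
      ... | yes refl = y , T₁zy , w₂z , role₂y , ≤-reflexive (trans (τ₂≢ z≢y z≢u) (sym τ₂y))
      ... | no q≢z with prop-worst q-prop q≢z
      ...   | f , Tqf , wq , f-rec , le = f , trans (off-edges q≢z (prop≢y q-prop) q≢u) Tqf ,
              trans (w₂-old (prop≢y q-prop) q≢z) wq , role₂f , τ₂≤ (f ≟ y)
        where
        role₂f : role₂ f ≡ receiver
        role₂f with f ≟ y
        ... | yes refl = role₂y
        ... | no f≢y = trans (role₂≢ f≢y (rec≢u f-rec)) f-rec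
        τ₂≤ : Dec (f ≡ y) → τ₂ q ≤ τ₂ f
        τ₂≤ (yes refl) = ≤-trans (≤-reflexive (τ₂≢ (prop≢y q-prop) q≢u)) (≤-trans (latest q) (≤-reflexive (sym τ₂y)))
        τ₂≤ (no f≢y) = ≤-trans (≤-reflexive (τ₂≢ (prop≢y q-prop) q≢u)) (≤-trans le (≤-reflexive (sym (τ₂≢ f≢y (rec≢u f-rec)))))

      -- The witness is the agent just dropped: `D₂ y` is its own rank, and as holder of the free
      -- unit it needs only the weak inequality.
      rec-next-y : ∃ λ q → role₂ q ≡ proposer × τ₂ y < τ₂ q × T₁ y q ≡ false × r y q ≤ D₂ y ×
                   ((q ≢ u × r q y < w₂ q) ⊎ (q ≡ u × r q y ≤ w₂ q))
      rec-next-y = u , role₂u , subst₂ _<_ (sym τ₂y) (sym τ₂u) ≤-refl , T₁yu , ≤-reflexive (sym (trans at-≡ wy)) ,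
        inj₂ (refl , ≤-trans (within u y (trans (symm u y) Tyu)) (≤-reflexive (sym w₂u)))

      rec-next₂ : ∀ {f} → role f ≡ receiver → f ≢ y →
        (∃ λ q → role q ≡ proposer × τ f < τ q × T f q ≡ false × r f q ≤ D f × ((q ≢ z × r q f < w q) ⊎ (q ≡ z × r q f ≤ w q))) →
        ∃ λ q → role₂ q ≡ proposer × τ₂ f < τ₂ q × T₁ f q ≡ false × r f q ≤ D₂ f × ((q ≢ u × r q f < w₂ q) ⊎ (q ≡ u × r q f ≤ w₂ q))
      rec-next₂ {f} f-rec f≢y (q , q-prop , lt , Tfq , le , keen) =
        q , role₂q (q ≟ u) , τ₂< (q ≟ u) , trans (T₁fq f-rec f≢y) Tfq , ≤-trans le (≤-reflexive (sym (at-≢ f≢y))) , keen₂ (q ≟ u) keen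
        where
        role₂q : Dec (q ≡ u) → role₂ q ≡ proposer
        role₂q (yes refl) = role₂u
        role₂q (no q≢u) = trans (role₂≢ (prop≢y q-prop) q≢u) q-prop
        τ₂< : Dec (q ≡ u) → τ₂ f < τ₂ q
        τ₂< (yes refl) = subst₂ _<_ (sym (τ₂≢ f≢y (rec≢u f-rec))) (sym τ₂u) (s≤s (latest f))
        τ₂< (no q≢u) = subst₂ _<_ (sym (τ₂≢ f≢y (rec≢u f-rec))) (sym (τ₂≢ (prop≢y q-prop) q≢u)) lt
        keen₂ : Dec (q ≡ u) → (q ≢ z × r q f < w q) ⊎ (q ≡ z × r q f ≤ w q) → (q ≢ u × r q f < w₂ q) ⊎ (q ≡ u × r q f ≤ w₂ q)
        keen₂ (yes refl) (inj₁ (_ , k)) = inj₂ (refl , ≤-trans (<⇒≤ k) (≤-reflexive (sym w₂u)))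
        keen₂ (yes refl) (inj₂ (e , _)) = ⊥-elim (z≢u (sym e))
        keen₂ (no q≢u) (inj₁ (q≢z , k)) = inj₁ (q≢u , subst (r q f <_) (sym (w₂-old (prop≢y q-prop) q≢z)) k)
        keen₂ (no q≢u) (inj₂ (refl , k)) = inj₁ (q≢u , ≤-<-trans k (subst (w z <_) (sym w₂z) wz<rzy))

      -- Such a `q` was unmatched with `y` before the step and would have taken it, so the old
      -- configuration dominates the pair at `y`. Being no worse than `u`, it would have to be `u`.
      rec-later-y : ∀ {q} → q ≢ u → T₁ y q ≡ false → r q y < w₂ q → r y q ≤ D₂ y → ⊥
      rec-later-y {q} q≢u f lt le with dom y q (λ { refl → <⇒≱ lt (K₂.w≤ y) }) Tyq
        where
        Tyq : T y q ≡ false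
        Tyq with T₁-false f
        ... | inj₁ (inj₁ (_ , e)) = ⊥-elim (q≢u e)
        ... | inj₁ (inj₂ (e , _)) = ⊥-elim (y≢u e)
        ... | inj₂ t = t
      ... | inj₁ le′ = q≢u (r-inj y (≤-antisym (≤-trans le (≤-reflexive (trans at-≡ wy))) (≤-trans (≤-reflexive (sym wy)) le′)))
      ... | inj₂ le′ = <⇒≱ (subst (r q y <_) (w₂-old (λ { refl → <⇒≱ lt (K₂.w≤ y) }) λ { refl → true≢false (trans (K₁.symm y z) T₁zy) f }) lt) le′

      -- Only `z` and `y` have new thresholds. `z` is a proposer later than all old receivers; `y`
      -- has become choosier, so if it qualified now it would have qualified before and would be a
      -- proposer.
      rec-later₂ : ∀ {f q} → role f ≡ receiver → f ≢ y → q ≢ u → T₁ f q ≡ false → r q f < w₂ q → r f q ≤ D₂ f →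
                   role₂ q ≡ proposer × τ₂ f < τ₂ q
      rec-later₂ {f} {q} f-rec f≢y q≢u t lt le = go (q ≟ z) (q ≟ y)
        where
        Tfq : T f q ≡ false
        Tfq = trans (sym (T₁fq f-rec f≢y)) t
        le′ : r f q ≤ D f
        le′ = ≤-trans le (≤-reflexive (at-≢ f≢y))
        up : role q ≡ proposer × τ f < τ q → role₂ q ≡ proposer × τ₂ f < τ₂ q
        up (q-prop , l) = trans (role₂≢ (prop≢y q-prop) q≢u) q-prop ,
          subst₂ _<_ (sym (τ₂≢ f≢y (rec≢u f-rec))) (sym (τ₂≢ (prop≢y q-prop) q≢u)) l
        go : Dec (q ≡ z) → Dec (q ≡ y) → role₂ q ≡ proposer × τ₂ f < τ₂ q
        go (yes refl) _ = up (z-role , rec-early f-rec)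
        go (no q≢z) (yes refl) = ⊥-elim (y≢prop (proj₁ (rec-later f-rec q≢z Tfq
          (<-≤-trans lt (≤-trans (w₂≤w₁ y) (≤-reflexive (w₁≢ y≢z)))) le′)))
        go (no q≢z) (no q≢y) = up (rec-later f-rec q≢z Tfq (subst (r q f <_) (w₂-old q≢y q≢z) lt) le′)

      -- If neither bound held, `y` would have been a willing replacement for `g` within `D g`, and
      -- `rec-later` would make it a proposer.
      rec-rec-y : ∀ {g} → role g ≡ receiver → g ≢ y → T₁ y g ≡ false → D₂ y ≤ r y g ⊎ D₂ g ≤ r g y
      rec-rec-y {g} g-rec g≢y t with r g y <? D g
      ... | no ¬lt = inj₂ (≤-trans (≤-reflexive (at-≢ g≢y)) (≮⇒≥ ¬lt))
      ... | yes lt = inj₁ (≤-trans (≤-reflexive at-≡) (≮⇒≥ λ lt′ → y≢prop (proj₁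
              (rec-later g-rec y≢z (trans (sym (T₁fq g-rec g≢y)) (trans (K₁.symm g y) t)) lt′ (<⇒≤ lt)))))

      rec-rec₂ : ∀ {f g} → role₂ f ≡ receiver → role₂ g ≡ receiver → f ≢ g → T₁ f g ≡ false → D₂ f ≤ r f g ⊎ D₂ g ≤ r g f
      rec-rec₂ {f} {g} f-rec₂ g-rec₂ f≢g t with rec₂ f-rec₂ | rec₂ g-rec₂
      ... | inj₁ refl | inj₁ refl = ⊥-elim (f≢g refl)
      ... | inj₁ refl | inj₂ (g-rec , g≢y) = rec-rec-y g-rec g≢y t
      ... | inj₂ (f-rec , f≢y) | inj₁ refl = [ inj₂ , inj₁ ]′ (rec-rec-y f-rec f≢y (trans (K₁.symm y f) t))
      ... | inj₂ (f-rec , f≢y) | inj₂ (g-rec , g≢y) =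
        [ (λ le → inj₁ (≤-trans (≤-reflexive (at-≢ f≢y)) le)) , (λ le → inj₂ (≤-trans (≤-reflexive (at-≢ g≢y)) le)) ]′
          (rec-rec f-rec g-rec f≢g (trans (sym (T₁fq f-rec f≢y)) t))

    -- The one threshold that improves is that of `y`, which carries no weight. `z` rises strictly
    -- from `w z` to `r z y`, and `u` can only gain weight on becoming a proposer.
    progress : potential role w < potential role₂ w₂
    progress = sum-mono-< z le (subst₂ _<_ (sym (cong (λ x → weight x (w z)) z-role))
        (sym (trans (cong (λ x → weight x (w₂ z)) (trans (role₂≢ z≢y z≢u) z-role)) w₂z)) wz<rzy)
      where
      not-prop : ∀ x {m} → x ≢ proposer → weight x m ≡ 0
      not-prop none     _ = refl
      not-prop receiver _ = refl
      not-prop proposer ¬e = ⊥-elim (¬e refl)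
      le : ∀ i → weight (role i) (w i) ≤ weight (role₂ i) (w₂ i)
      le i with i ≟ y | i ≟ u
      ... | _ | yes refl = ≤-trans (weight≤ (role u) ≤-refl)
              (≤-reflexive (sym (trans (cong (λ x → weight x (w₂ u)) role₂u) w₂u)))
      ... | yes refl | no _ = ≤-trans (≤-reflexive (not-prop (role y) y≢prop)) z≤n
      ... | no i≢y | no i≢u with i ≟ z
      ...   | yes refl = ≤-trans (≤-reflexive (cong (λ x → weight x (w z)) z-role)) (≤-trans (<⇒≤ wz<rzy)
              (≤-reflexive (sym (trans (cong (λ x → weight x (w₂ z)) (trans (role₂≢ z≢y z≢u) z-role)) w₂z))))
      ...   | no i≢z = ≤-reflexive (sym (cong₂ weight (role₂≢ i≢y i≢u) (w₂-old i≢y i≢z)))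

  settle : ∀ {b} k {T Cs w z role D τ} (S : Seeking T Cs w b z) → History T Cs w z role D τ →
           sum (λ i → r i i) < k + potential role w → Result b
  settle zero {role = role} S H fuel = ⊥-elim (<⇒≱ fuel (sum-mono-≤ λ i → weight≤ (role i) (Seeking.w≤ S i)))
  settle {b} (suc k) {T} {Cs} {w} {z} {role} S H fuel with minimal (λ j → (T z j ≟ᵇ false) ×-dec (r j z <? w j)) (r z)
  ... | inj₂ unwilling = Seeking.no-offer S unwilling
  ... | inj₁ (y , (Tzy , willing) , best) = respond (sat y (z≢y ∘ sym))
    where
    open Seeking S
    open Offer y Tzy willing best
    respond : Saturation T Cs w b y → Result b
    respond (slack wy lt) = accept-slack wy lt
    respond (onCycle q) = accept-cycle q
    respond (empty _ wy) = ⊥-elim (<⇒≱ willing (≤-trans (≤-reflexive wy) z≤n))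
    respond (tight u y-free Tyu wy) with receiver? (role u)
    ... | yes u-rec = Close.close S H y Tzy willing best u y-free Tyu wy u-rec
    ... | no u≢rec = release (sat u (z≢u ∘ sym))
      where
      open Displace u y-free Tyu wy
      release : Saturation T Cs w b u → Result b
      release (slack wu lt) = T₁ , Cs , w₁ , reoffset displaced
        (λ i → ≤-trans (+-monoʳ-≤ _ z≤n) (Config.total≤ displaced i))
        (λ i l → sym (δ-≢ {a = u} {i} λ { refl → <⇒≢ l (trans (w₁≢ (z≢u ∘ sym)) wu) }))
      release (onCycle q) with absorb {e = λ _ → 0} u displaced q
      ... | T′ , Cs′ , K′ = T′ , Cs′ , w₁ , K′
      release (empty _ wu) = ⊥-elim (<⇒≱ (r-pos u y) (≤-trans (within u y (trans (symm u y) Tyu)) (≤-reflexive wu)))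
      release (tight v u-free Tuv wu) = settle k S₂ H₂
        (≤-trans fuel (≤-trans (≤-reflexive (sym (+-suc k _))) (+-monoʳ-≤ k progress)))
        where open Step S H y Tzy willing best u y-free Tyu wy u≢rec v u-free Tuv wu

  -- After a run the thresholds are mere bounds, while the next run wants them attained by the worst
  -- partner. Cycle members keep theirs, which the half-edges prescribe; an agent with neither
  -- partner nor spare unit gets 0.
  tighten : ∀ {T Cs w b} → Config T Cs w b (λ _ → 0) → ∃ λ w′ → Config T Cs w′ b (λ _ → 0) × (∀ i → Saturation T Cs w′ b i)
  tighten {T} {Cs} {w} {b} K = (λ i → proj₁ (tightAt i)) , reweight K
      (λ i → proj₁ (proj₂ (proj₂ (tightAt i))))
      (λ i j i≢j f → [ (λ le → inj₁ (≤-trans (proj₁ (proj₂ (tightAt i))) le)) , (λ le → inj₂ (≤-trans (proj₁ (proj₂ (tightAt j))) le)) ]′ (dom i j i≢j f))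
      (λ i → proj₁ (proj₂ (proj₂ (proj₂ (tightAt i)))))
      (λ i → ≤-trans (proj₁ (proj₂ (tightAt i))) (w≤ i))
      (λ i → proj₁ (proj₂ (proj₂ (proj₂ (proj₂ (tightAt i)))))) ,
      λ i → sat i (proj₂ (proj₂ (proj₂ (proj₂ (proj₂ (tightAt i))))))
    where
    open Config K
    tightAt : ∀ i → ∃ λ x → x ≤ w i × (∀ j → T i j ≡ true → r i j ≤ x) × (0 < occ (concat Cs) i → x ≡ w i) ×
              (x < r i i → w i < r i i ⊎ deg T i + occ (concat Cs) i + 0 ≡ b i) ×
              ((x ≡ r i i × deg T i + occ (concat Cs) i < b i) ⊎ 0 < occ (concat Cs) i ⊎
               (∃ λ u → occ (concat Cs) i ≡ 0 × T i u ≡ true × x ≡ r i u) ⊎ (occ (concat Cs) i ≡ 0 × x ≡ 0))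
    tightAt i with 0 <? occ (concat Cs) i | deg T i + occ (concat Cs) i <? b i
    ... | yes q | _ = w i , ≤-refl , within i , (λ _ → refl) , inj₁ , inj₂ (inj₁ q)
    ... | no ¬q | yes lt = w i , ≤-refl , within i , (λ _ → refl) , inj₁ ,
          inj₁ (≤-antisym (w≤ i) (≮⇒≥ λ l → <⇒≢ lt (trans (sym (+-identityʳ _)) (full i l))) , lt)
    ... | no ¬q | no ¬lt with maximal (λ j → T i j ≟ᵇ true) (r i)
    ...   | inj₁ (u , Tiu , max) = r i u , within i u Tiu , max , (λ q → ⊥-elim (¬q q)) ,
            (λ _ → inj₂ (≤-antisym (total≤ i) (≤-trans (≮⇒≥ ¬lt) (≤-reflexive (sym (+-identityʳ _)))))) ,
            inj₂ (inj₂ (inj₁ (u , n≤0⇒n≡0 (≮⇒≥ ¬q) , Tiu , refl)))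
    ...   | inj₂ alone = 0 , z≤n , (λ j t → ⊥-elim (alone j t)) , (λ q → ⊥-elim (¬q q)) ,
            (λ _ → inj₂ (≤-antisym (total≤ i) (≤-trans (≮⇒≥ ¬lt) (≤-reflexive (sym (+-identityʳ _)))))) ,
            inj₂ (inj₂ (inj₂ (n≤0⇒n≡0 (≮⇒≥ ¬q) , refl)))
    sat : ∀ i → _ → Saturation T Cs (λ i → proj₁ (tightAt i)) b i
    sat i (inj₁ (e , lt)) = slack e lt
    sat i (inj₂ (inj₁ q)) = onCycle q
    sat i (inj₂ (inj₂ (inj₁ (u , i-free , Tiu , e)))) = tight u i-free Tiu e
    sat i (inj₂ (inj₂ (inj₂ (i-free , e)))) = empty i-free e

  raise : ∀ {b b′} v → (∀ i → b′ i ≡ b i + δ v i) → Result b → Result b′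
  raise {b} {b′} v eq (T , Cs , w₀ , K₀) with tighten K₀
  ... | w , K , sat = start (sat v)
    where
    open Config K
    K↑ : Config T Cs w b′ (δ v)
    K↑ = recount K (λ i → trans (sym (eq i)) (sym (+-identityʳ _)))
    lift : ∀ i → i ≢ v → Saturation T Cs w b i → Saturation T Cs w b′ i
    lift i i≢v (slack wi lt) = slack wi (≤-trans lt (≤-trans (m≤m+n _ (δ v i)) (≤-reflexive (sym (eq i)))))
    lift i i≢v (onCycle q) = onCycle q
    lift i i≢v (tight u i-free t wi) = tight u i-free t wi
    lift i i≢v (empty i-free wi) = empty i-free wi
    enter : occ (concat Cs) v ≡ 0 → w v < r v v → (∀ j → T v j ≡ false → r j v < w j → w v < r v j) → Result b′
    -- A fresh run has one proposer and no receiver, so the conditions on receivers hold vacuously.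
    -- The fuel exceeds every possible potential.
    enter v-free lt strict = settle (suc (sum (λ i → r i i))) {role = (λ _ → none) [ v ≔ proposer ]} {D = λ _ → 0} {τ = λ _ → 0}
      (record { conf = K↑ ; sat = λ i i≢v → lift i i≢v (sat i) ; z-free = v-free ; z-lack = Config.full K↑ v lt ; strict = strict })
      (record { z-role = at-≡ ; rec-free = λ q → ⊥-elim (no-rec q) ; prop-free = λ q → subst (λ i → occ (concat Cs) i ≡ 0) (sym (only q)) v-free
              ; rec-full = λ q → ⊥-elim (no-rec q) ; prop-worst = λ q q≢v → ⊥-elim (q≢v (only q)) ; rec-next = λ q → ⊥-elim (no-rec q)
              ; rec-later = λ q → ⊥-elim (no-rec q) ; rec-rec = λ q → ⊥-elim (no-rec q) ; rec-early = λ q → ⊥-elim (no-rec q)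
              ; latest = λ _ → z≤n })
      (s≤s (m≤m+n _ _))
      where
      no-rec : ∀ {f} → ((λ _ → none) [ v ≔ proposer ]) f ≡ receiver → ⊥
      no-rec {f} q with f ≟ v
      ... | yes refl = rec≢prop (trans (sym q) at-≡)
      ... | no f≢v with trans (sym q) (at-≢ {f = λ _ → none} f≢v)
      ...   | ()
      only : ∀ {f} → ((λ _ → none) [ v ≔ proposer ]) f ≡ proposer → f ≡ v
      only {f} q with f ≟ v
      ... | yes e = e
      ... | no f≢v with trans (sym q) (at-≢ {f = λ _ → none} f≢v)
      ...   | ()
    start : Saturation T Cs w b v → Result b′
    start (slack wv lt) = T , Cs , w , reoffset K↑ (λ i → ≤-trans (+-monoʳ-≤ _ z≤n) (Config.total≤ K↑ i))
      (λ i l → sym (δ-≢ {a = v} {i} λ { refl → <⇒≢ l wv }))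
    start (onCycle q) with absorb {e = λ _ → 0} v K↑ q
    ... | T′ , Cs′ , K′ = T′ , Cs′ , w , K′
    start (tight u v-free Tvu wv) = enter v-free (subst (_< r v v) (sym wv) (r-self v u λ { refl → true≢false Tvu (irr v) })) strict
      where
      strict : ∀ j → T v j ≡ false → r j v < w j → w v < r v j
      strict j f lt with dom v j (λ { refl → <⇒≱ lt (w≤ v) }) f
      ... | inj₂ le = ⊥-elim (<⇒≱ lt le)
      ... | inj₁ le = ≤∧≢⇒< le λ e → true≢false (subst (λ x → T v x ≡ true) (r-inj v (trans (sym wv) e)) Tvu) f
    start (empty v-free wv) = enter v-free (subst (_< r v v) (sym wv) (r-pos v v)) (λ j _ _ → subst (_< r v j) (sym wv) (r-pos v j))

  -- Induction on the total capacity: with none at all, the threshold 0 dominates every pair;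
  -- otherwise one unit is taken off anywhere and put back by `raise`.
  result : ∀ k b → sum b ≡ k → Result b
  result k b eq with any? (λ i → 0 <? b i)
  result k b eq | no exhausted = (λ _ _ → false) , [] , (λ _ → 0) , record
    { symm = λ _ _ → refl ; irr = λ _ → refl ; within = λ _ _ () ; dom = λ _ _ _ _ → inj₁ z≤n ; cycles = [] ; uniq = λ _ → z≤n
    ; w≤ = λ _ → z≤n ; total≤ = λ i → ≤-trans (≤-reflexive (zero-total i)) z≤n
    ; full = λ i _ → trans (zero-total i) (sym (n≤0⇒n≡0 (≮⇒≥ λ p → exhausted (i , p)))) }
    where
    zero-total : ∀ i → deg {n} (λ _ _ → false) i + 0 + 0 ≡ 0
    zero-total i = trans (+-identityʳ _) (trans (+-identityʳ _) (sum-replicate-zero n))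
  result zero b eq | yes (v , p) = ⊥-elim (<⇒≢ (≤-<-trans z≤n (sum-mono-< {g = λ _ → 0} v (λ _ → z≤n) p)) (sym eq))
  result (suc k) b eq | yes (v , p) = raise v b≡ (result k b₀ (suc-injective (trans (sym sum≡) eq)))
    where
    b₀ : Fin n → ℕ
    b₀ = b [ v ≔ b v ∸ 1 ]
    bv : suc (b v ∸ 1) ≡ b v
    bv = m+[n∸m]≡n p
    b≡ : ∀ i → b i ≡ b₀ i + δ v i
    b≡ i with v ≟ i
    ... | yes refl = trans (sym bv) (trans (+-comm 1 _) (cong (_+ 1) (sym at-≡)))
    ... | no v≢i = trans (sym (at-≢ (v≢i ∘ sym))) (sym (+-identityʳ _))
    sum≡ : sum b ≡ suc (sum b₀)
    sum≡ = sum-bump v (λ j j≢v → at-≢ j≢v) (trans (sym bv) (cong suc (sym at-≡)))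

-- Index arithmetic on a cyclic permutation.

module _ {n} (C : Cycle n) where

  next-suc : ∀ t → toℕ t < m C → toℕ (next C t) ≡ suc (toℕ t)
  next-suc t lt = trans (toℕ-fromℕ< (m%n<n (suc (toℕ t)) (suc (m C)))) (m<n⇒m%n≡m (s≤s lt))

  next-last : ∀ t → toℕ t ≡ m C → toℕ (next C t) ≡ 0
  next-last t eq = trans (toℕ-fromℕ< (m%n<n (suc (toℕ t)) (suc (m C)))) (trans (cong (λ k → suc k % suc (m C)) eq) (n%n≡0 (suc (m C))))

  prev-zero : ∀ t → toℕ t ≡ 0 → toℕ (prev C t) ≡ m C
  prev-zero t eq = trans (toℕ-fromℕ< (m%n<n (toℕ t + m C) (suc (m C)))) (trans (cong (λ k → (k + m C) % suc (m C)) eq) (m<n⇒m%n≡m ≤-refl))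

  prev-suc : ∀ t k → toℕ t ≡ suc k → toℕ (prev C t) ≡ k
  prev-suc t k eq = trans (toℕ-fromℕ< (m%n<n (toℕ t + m C) (suc (m C)))) (trans (cong (λ k → (k + m C) % suc (m C)) eq)
    (trans (cong (_% suc (m C)) (sym (+-suc k (m C)))) (trans ([m+n]%n≡m%n k (suc (m C))) (m<n⇒m%n≡m lt))))
    where
    lt : k < suc (m C)
    lt = ≤-trans (n≤1+n _) (subst (_< suc (m C)) eq (toℕ<n t))

  position : ∀ t → toℕ t < m C ⊎ toℕ t ≡ m C
  position t = m≤n⇒m<n∨m≡n (≤-pred (toℕ<n t))

  prev-next : ∀ t → prev C (next C t) ≡ t
  prev-next t with position t
  ... | inj₁ lt = toℕ-injective (prev-suc _ _ (next-suc t lt))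
  ... | inj₂ eq = toℕ-injective (trans (prev-zero _ (next-last t eq)) (sym eq))

  next-prev : ∀ t → next C (prev C t) ≡ t
  next-prev t = toℕ-injective (go (toℕ t) refl)
    where
    go : ∀ k → toℕ t ≡ k → toℕ (next C (prev C t)) ≡ toℕ t
    go zero    eq = trans (next-last (prev C t) (prev-zero t eq)) (sym eq)
    go (suc k) eq = trans (next-suc (prev C t) (subst (_< m C) (sym (prev-suc t k eq)) (≤-pred (subst (_< suc (m C)) eq (toℕ<n t)))))
                          (trans (cong suc (prev-suc t k eq)) (sym eq))

  next-fixed : ∀ t → next C t ≡ t → m C ≡ 0
  next-fixed t eq with position t
  ... | inj₁ lt = ⊥-elim (<⇒≢ (n<1+n _) (sym (trans (sym (next-suc t lt)) (cong toℕ eq))))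
  ... | inj₂ last = trans (sym last) (trans (sym (cong toℕ eq)) (next-last t last))

  -- Stepping back from `t₀` reaches index 0; the step back from there lands on the last index, from
  -- which all others are reached downwards.
  backwards : ∀ (P : Fin n → Set) t₀ → P (elem C t₀) → (∀ t → P (elem C (next C t)) → P (elem C t)) → ∀ t → P (elem C t)
  backwards P t₀ p₀ back t with to-zero (toℕ t₀) t₀ ≤-refl p₀
    where
    to-zero : ∀ k s → toℕ s ≤ k → P (elem C s) → P (elem C zero)
    to-zero k s le p with toℕ s in eq
    ... | zero = subst (P ∘ elem C) (toℕ-injective {j = zero} eq) p
    to-zero (suc k) s le p | suc j = to-zero k (prev C s) (≤-trans (≤-reflexive (prev-suc s j eq)) (≤-pred le))
      (back (prev C s) (subst (P ∘ elem C) (sym (next-prev s)) p))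
  ... | p-zero = descend (m C ∸ toℕ t) t (m≤n+m∸n (m C) (toℕ t))
    where
    descend : ∀ k s → m C ≤ toℕ s + k → P (elem C s)
    descend k s le with position s
    ... | inj₂ last = back s (subst (P ∘ elem C) (toℕ-injective {i = zero} (sym (next-last s last))) p-zero)
    descend zero s le | inj₁ lt = ⊥-elim (<⇒≱ lt (subst (m C ≤_) (+-identityʳ _) le))
    descend (suc k) s le | inj₁ lt = back s (descend k (next C s)
      (≤-trans le (≤-reflexive (trans (+-suc (toℕ s) k) (cong (_+ k) (sym (next-suc s lt)))))))

-- Counting in lists, and lists turned into cyclic permutations.

count : ∀ {A : Set} {P : A → Set} → Decidable P → List A → ℕ
count P? xs = length (filter P? xs)

module _ {A : Set} {P : A → Set} (P? : Decidable P) where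

  count-∷ : ∀ x xs → count P? (x ∷ xs) ≡ ind (does (P? x)) + count P? xs
  count-∷ x xs with P? x
  ... | yes _ = refl
  ... | no  _ = refl

  count-++ : ∀ xs ys → count P? (xs ++ ys) ≡ count P? xs + count P? ys
  count-++ xs ys = trans (cong length (filter-++ P? xs ys)) (length-++ (filter P? xs))

  count-map : ∀ {B : Set} (f : B → A) xs → count (P? ∘ f) xs ≡ count P? (map f xs)
  count-map f []       = refl
  count-map f (x ∷ xs) = trans (count-map-∷ x xs) (sym (count-∷ (f x) (map f xs)))
    where
    count-map-∷ : ∀ x xs → count (P? ∘ f) (x ∷ xs) ≡ ind (does (P? (f x))) + count P? (map f xs)
    count-map-∷ x xs with P? (f x)
    ... | yes _ = cong suc (count-map f xs)
    ... | no  _ = count-map f xs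

  count-lookup : ∀ xs → countIdx (P? ∘ lookup xs) ≡ count P? xs
  count-lookup xs = trans (count-map (lookup xs) (allFin (length xs)))
    (cong (count P?) (trans (map-tabulate id (lookup xs)) (tabulate-lookup xs)))

  count-tabulate : ∀ {k} (f : Fin k → A) → count P? (tabulate f) ≡ sum (λ i → ind (does (P? (f i))))
  count-tabulate {zero}  f = refl
  count-tabulate {suc k} f = trans (count-∷ (f zero) _) (cong (_ +_) (count-tabulate (f ∘ suc)))

countIdx-sum : ∀ {k} {P : Fin k → Set} (P? : Decidable P) → countIdx P? ≡ sum (λ s → ind (does (P? s)))
countIdx-sum P? = count-tabulate P? id

sum-single : ∀ {n} (g : Fin n → ℕ) k → (∀ i → i ≢ k → g i ≡ 0) → sum g ≡ g k
sum-single {suc n} g zero    z = trans (cong (g zero +_) (trans (sum-cong-≗ (λ i → z (suc i) λ ())) (sum-replicate-zero n))) (+-identityʳ _)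
sum-single {suc n} g (suc k) z = cong₂ _+_ (z zero λ ()) (sum-single (g ∘ suc) k (λ i i≢k → z (suc i) λ { refl → i≢k refl }))

sum-≥ : ∀ {n} (g : Fin n → ℕ) k → g k ≤ sum g
sum-≥ g zero    = m≤m+n _ _
sum-≥ g (suc k) = ≤-trans (sum-≥ (g ∘ suc) k) (m≤n+m _ _)

sum-two : ∀ {n} (g : Fin n → ℕ) j k → j ≢ k → g j + g k ≤ sum g
sum-two g zero    zero    j≢k = ⊥-elim (j≢k refl)
sum-two g zero    (suc k) j≢k = +-monoʳ-≤ (g zero) (sum-≥ (g ∘ suc) k)
sum-two g (suc j) zero    j≢k = ≤-trans (≤-reflexive (+-comm _ (g zero))) (+-monoʳ-≤ (g zero) (sum-≥ (g ∘ suc) j))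
sum-two g (suc j) (suc k) j≢k = ≤-trans (sum-two (g ∘ suc) j k λ { refl → j≢k refl }) (m≤n+m _ _)

module _ {k} {P : Fin k → Set} (P? : Decidable P) where

  countIdx-pos : ∀ s → P s → 1 ≤ countIdx P?
  countIdx-pos s p = ≤-trans (≤-reflexive (sym (cong ind (dec-true (P? s) p))))
    (≤-trans (sum-≥ _ s) (≤-reflexive (sym (countIdx-sum P?))))

  countIdx-two : ∀ s t → s ≢ t → P s → P t → 2 ≤ countIdx P?
  countIdx-two s t s≢t p q = ≤-trans (≤-reflexive (sym (cong₂ _+_ (cong ind (dec-true (P? s) p)) (cong ind (dec-true (P? t) q)))))
    (≤-trans (sum-two _ s t s≢t) (≤-reflexive (sym (countIdx-sum P?))))

  countIdx-none : (∀ s → ¬ P s) → countIdx P? ≡ 0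
  countIdx-none ¬p = trans (countIdx-sum P?) (trans (sum-cong-≗ (λ s → cong ind (dec-false (P? s) (¬p s)))) (sum-replicate-zero k))

  countIdx-one : ∀ s → P s → (∀ t → P t → t ≡ s) → countIdx P? ≡ 1
  countIdx-one s p only = trans (countIdx-sum P?) (trans
    (sum-single _ s (λ t t≢s → cong ind (dec-false (P? t) (t≢s ∘ only t)))) (cong ind (dec-true (P? s) p)))

walk-reverse : ∀ {A : Set} {R : A → A → Set} {a} xs {b} → Walk R a xs b → Walk (flip R) b (reverse xs) a
walk-reverse []       e = e
walk-reverse (x ∷ xs) (e , w) rewrite unfold-reverse x xs = walk-++ (reverse xs) (walk-reverse xs w) e

occ-reverse : ∀ {n} (xs : List (Fin n)) i → occ (reverse xs) i ≡ occ xs i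
occ-reverse []       i = refl
occ-reverse (x ∷ xs) i rewrite unfold-reverse x xs | occ-++ (reverse xs) (x ∷ []) i | occ-reverse xs i | +-identityʳ (δ x i) =
  +-comm (occ xs i) _

occ-lookup : ∀ {n} (xs : List (Fin n)) t → 0 < occ xs (lookup xs t)
occ-lookup (x ∷ xs) zero    = occ-head x xs
occ-lookup (x ∷ xs) (suc t) = ≤-trans (occ-lookup xs t) (m≤n+m _ _)

lookup-occ : ∀ {n} (xs : List (Fin n)) i → 0 < occ xs i → ∃ λ t → lookup xs t ≡ i
lookup-occ (x ∷ xs) i p with occ-cases x xs i p
... | inj₁ refl = zero , refl
... | inj₂ q with lookup-occ xs i q
...   | t , eq = suc t , eq

lookup-injective : ∀ {n} (xs : List (Fin n)) → (∀ i → occ xs i ≤ 1) → ∀ {s t} → lookup xs s ≡ lookup xs t → s ≡ t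
lookup-injective (x ∷ xs) u {zero}  {zero}  eq = refl
lookup-injective (x ∷ xs) u {zero}  {suc t} refl = ⊥-elim (<⇒≱ (s≤s (occ-lookup xs t))
  (≤-trans (≤-reflexive (cong (_+ occ xs x) (sym (δ-refl x)))) (u x)))
lookup-injective (x ∷ xs) u {suc s} {zero}  refl = ⊥-elim (<⇒≱ (s≤s (occ-lookup xs s))
  (≤-trans (≤-reflexive (cong (_+ occ xs x) (sym (δ-refl x)))) (u x)))
lookup-injective (x ∷ xs) u {suc s} {suc t} eq = cong suc (lookup-injective xs (λ i → ≤-trans (m≤n+m _ _) (u i)) eq)

module _ {A : Set} {R : A → A → Set} where

  walk-next : ∀ {a} xs {b} → Walk R a xs b → ∀ (s t : Fin (suc (length xs))) → toℕ t ≡ suc (toℕ s) →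
              R (lookup (a ∷ xs) s) (lookup (a ∷ xs) t)
  walk-next []       w       zero    zero          ()
  walk-next (x ∷ xs) (e , w) zero    (suc zero)    eq = e
  walk-next (x ∷ xs) (e , w) (suc s) (suc t)       eq = walk-next xs w s t (suc-injective eq)

  walk-last : ∀ {a} xs {b} → Walk R a xs b → ∀ (s : Fin (suc (length xs))) → toℕ s ≡ length xs → R (lookup (a ∷ xs) s) b
  walk-last []       w       zero    eq = w
  walk-last (x ∷ xs) (e , w) (suc s) eq = walk-last xs w s (suc-injective eq)

evenLength-∣ : ∀ {A : Set} {xs : List A} → EvenLength xs → 2 ∣ length xs
evenLength-∣ []       = divides 0 refl
evenLength-∣ (p ∷ ev) with evenLength-∣ ev
... | divides k eq = divides (suc k) (cong (λ l → suc (suc l)) eq)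

cycleOf : ∀ {n} (a : Fin n) as → (∀ i → occ (a ∷ as) i ≤ 1) → Cycle n
cycleOf a as u = record { m = length as ; elem = lookup (a ∷ as) ; inj = lookup-injective (a ∷ as) u }

cycleOf-next : ∀ {n} {R : Fin n → Fin n → Set} a as u → Walk R a as a → ∀ t →
               R (elem (cycleOf a as u) t) (elem (cycleOf a as u) (next (cycleOf a as u) t))
cycleOf-next {R = R} a as u wk t with position (cycleOf a as u) t
... | inj₁ lt = walk-next as wk t _ (next-suc (cycleOf a as u) t lt)
... | inj₂ eq = subst (λ s → R (lookup (a ∷ as) t) (lookup (a ∷ as) s))
                  (toℕ-injective {i = zero} (sym (next-last (cycleOf a as u) t eq))) (walk-last as wk t eq)

uniq-head : ∀ {n} (a : Fin n) as Ds → (∀ i → occ ((a ∷ as) ++ concat Ds) i ≤ 1) → ∀ i → occ (a ∷ reverse as) i ≤ 1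
uniq-head a as Ds u i = ≤-trans (≤-reflexive (cong (δ a i +_) (occ-reverse as i)))
  (≤-trans (≤-trans (m≤m+n _ _) (≤-reflexive (sym (occ-++ (a ∷ as) (concat Ds) i)))) (u i))

uniq-tail : ∀ {n} (a : Fin n) as Ds → (∀ i → occ ((a ∷ as) ++ concat Ds) i ≤ 1) → ∀ i → occ (concat Ds) i ≤ 1
uniq-tail a as Ds u i = ≤-trans (m≤n+m _ (occ (a ∷ as) i)) (≤-trans (≤-reflexive (sym (occ-++ (a ∷ as) (concat Ds) i))) (u i))

<⇒≢-Fin : ∀ {n} {i j : Fin n} → toℕ i < toℕ j → i ≢ j
<⇒≢-Fin lt refl = <-irrefl refl lt

concatTab : ∀ {A : Set} {k} → (Fin k → List A) → List A
concatTab {k = zero}  f = []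
concatTab {k = suc k} f = f zero ++ concatTab (f ∘ suc)

count-concatTab : ∀ {A : Set} {P : A → Set} (P? : Decidable P) {k} (f : Fin k → List A) →
                  count P? (concatTab f) ≡ sum (λ i → count P? (f i))
count-concatTab P? {zero}  f = refl
count-concatTab P? {suc k} f = trans (count-++ P? (f zero) _) (cong (count P? (f zero) +_) (count-concatTab P? (f ∘ suc)))

all-concatTab : ∀ {A : Set} {P : A → Set} {k} (f : Fin k → List A) → (∀ i → All P (f i)) → All P (concatTab f)
all-concatTab {k = zero}  f ps = []
all-concatTab {k = suc k} f ps = ++⁺ (ps zero) (all-concatTab (f ∘ suc) (ps ∘ suc))

any-concatTab : ∀ {A : Set} {P : A → Set} {k} (f : Fin k → List A) i → Any P (f i) → Any P (concatTab f)
any-concatTab f zero    p = ++⁺ˡ p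
any-concatTab f (suc i) p = ++⁺ʳ (f zero) (any-concatTab (f ∘ suc) i p)

count-replicate : ∀ {A : Set} {P : A → Set} (P? : Decidable P) k x → count P? (replicate k x) ≡ k * ind (does (P? x))
count-replicate P? zero    x = refl
count-replicate P? (suc k) x = trans (count-∷ P? x _) (cong (ind (does (P? x)) +_) (count-replicate P? k x))

count-mono : ∀ {A : Set} {P Q : A → Set} (P? : Decidable P) (Q? : Decidable Q) → (∀ x → P x → Q x) → ∀ xs → count P? xs ≤ count Q? xs
count-mono P? Q? f [] = z≤n
count-mono P? Q? f (x ∷ xs) rewrite count-∷ P? x xs | count-∷ Q? x xs = +-mono-≤ le (count-mono P? Q? f xs)
  where
  le : ind (does (P? x)) ≤ ind (does (Q? x))
  le with P? x
  ... | no _ = z≤n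
  ... | yes p rewrite dec-true (Q? x) (f x p) = ≤-refl

count-none : ∀ {A : Set} {P : A → Set} (P? : Decidable P) {xs} → All (λ x → ¬ P x) xs → count P? xs ≡ 0
count-none P? [] = refl
count-none P? {x ∷ xs} (¬p ∷ ps) = trans (count-∷ P? x xs) (cong₂ _+_ (cong ind (dec-false (P? x) ¬p)) (count-none P? ps))

fixedPoint : ∀ {n} → Fin n → Cycle n
fixedPoint a = record { m = 0 ; elem = λ _ → a ; inj = λ { {zero} {zero} _ → refl } }

transposition : ∀ {n} (a b : Fin n) → a ≢ b → Cycle n
transposition a b a≢b = record { m = 1 ; elem = λ { zero → a ; (suc zero) → b }
  ; inj = λ { {zero} {zero} _ → refl ; {zero} {suc zero} e → ⊥-elim (a≢b e)
            ; {suc zero} {zero} e → ⊥-elim (a≢b (sym e)) ; {suc zero} {suc zero} _ → refl } }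

-- From a half-integral matching to a partition or a stable matching.

module _ {n : ℕ} (I : SF n) where

  open SF I

  -- Ranks are shifted by one so that the threshold 0 is strictly better than every rank.
  r : Fin n → Fin n → ℕ
  r i j = suc (rank i j)

  r-inj : ∀ i {j k} → r i j ≡ r i k → j ≡ k
  r-inj i eq = rank-inj i (suc-injective eq)

  r-self : ∀ i j → j ≢ i → r i j < r i i
  r-self i j j≢i = s≤s (self-last i j j≢i)

  open Existence r r-inj r-self (λ _ _ → s≤s z≤n)

  module _ {T Cs w} (K : Config T Cs w cap (λ _ → 0)) where
    open Config K

    -- The members of an internal cycle are listed against the direction of the permutation.
    longCycles : ∀ Ds → All (IsCycle T w) Ds → (∀ i → occ (concat Ds) i ≤ 1) → List (Cycle n)
    longCycles []             cs       u = []
    longCycles ((a ∷ as) ∷ Ds) (_ ∷ cs) u = cycleOf a (reverse as) (uniq-head a as Ds u) ∷ longCycles Ds cs (uniq-tail a as Ds u)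

    longs : List (Cycle n)
    longs = longCycles Cs cycles uniq

    pairs : Fin n → Fin n → List (Cycle n)
    pairs i j with toℕ i <? toℕ j | T i j
    ... | yes lt | true  = transposition i j (<⇒≢-Fin lt) ∷ []
    ... | yes lt | false = []
    ... | no _   | _     = []

    singles : Fin n → List (Cycle n)
    singles i = replicate (cap i ∸ (deg T i + occ (concat Cs) i)) (fixedPoint i)

    gsp : List (Cycle n)
    gsp = longs ++ concatTab (λ i → concatTab (pairs i)) ++ concatTab singles

    count-gsp : {P : Cycle n → Set} (P? : Decidable P) → count P? gsp ≡
                count P? longs + (sum (λ i → sum (λ j → count P? (pairs i j))) + sum (λ i → count P? (singles i)))
    count-gsp P? = trans (count-++ P? longs _) (cong (count P? longs +_)
      (trans (count-++ P? (concatTab (λ i → concatTab (pairs i))) _)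
        (cong₂ _+_ (trans (count-concatTab P? (λ i → concatTab (pairs i))) (sum-cong-≗ (λ i → count-concatTab P? (pairs i))))
                   (count-concatTab P? singles))))

    all-gsp : {P : Cycle n → Set} → All P longs → (∀ i j → All P (pairs i j)) → (∀ i → All P (singles i)) → All P gsp
    all-gsp p q s = ++⁺ p (++⁺ (all-concatTab _ (λ i → all-concatTab _ (q i))) (all-concatTab _ s))

    size : Fin n → Fin n → ℕ
    size i j = length (pairs i j)

    size-sum : ∀ i j → size i j + size j i ≡ ind (T i j)
    size-sum i j with toℕ i <? toℕ j | toℕ j <? toℕ i | T i j in eq | T j i in eq′
    ... | yes p | yes q | _ | _ = ⊥-elim (<-asym p q)
    ... | yes p | no _ | true | _ = refl
    ... | yes p | no _ | false | _ = refl
    ... | no _ | yes q | true | true = refl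
    ... | no _ | yes q | false | false = refl
    ... | no _ | yes q | true | false = ⊥-elim (true≢false eq (trans (symm i j) eq′))
    ... | no _ | yes q | false | true = ⊥-elim (true≢false eq′ (trans (symm j i) eq))
    ... | no p | no q | false | _ = refl
    ... | no p | no q | true | _ with toℕ-injective (≤-antisym (≮⇒≥ q) (≮⇒≥ p))
    ...   | refl = ⊥-elim (true≢false eq (irr i))

    δ-* : ∀ x {a b : Fin n} → a ≢ b → x * δ a b ≡ 0
    δ-* x a≢b = trans (cong (x *_) (δ-≢ a≢b)) (*-zeroʳ x)

    δ-*-refl : ∀ x (a : Fin n) → x * δ a a ≡ x
    δ-*-refl x a = trans (cong (x *_) (δ-refl a)) (*-identityʳ x)

    mem-transposition : ∀ (i j : Fin n) i≢j k → ind (does (Mem? (transposition i j i≢j) k)) ≡ δ i k + δ j k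
    mem-transposition i j i≢j k = go (i ≟ k) (j ≟ k)
      where
      C = transposition i j i≢j
      go : Dec (i ≡ k) → Dec (j ≡ k) → ind (does (Mem? C k)) ≡ δ i k + δ j k
      go (yes refl) (yes refl) = ⊥-elim (i≢j refl)
      go (yes refl) (no j≢k) = trans (cong ind (dec-true (Mem? C k) (zero , refl))) (sym (cong₂ _+_ (δ-refl k) (δ-≢ j≢k)))
      go (no i≢k) (yes refl) = trans (cong ind (dec-true (Mem? C k) (suc zero , refl))) (sym (cong₂ _+_ (δ-≢ i≢k) (δ-refl k)))
      go (no i≢k) (no j≢k) = trans (cong ind (dec-false (Mem? C k) λ { (zero , e) → i≢k e ; (suc zero , e) → j≢k e }))
        (sym (cong₂ _+_ (δ-≢ i≢k) (δ-≢ j≢k)))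

    mem-pairs : ∀ k i j → count (λ C → Mem? C k) (pairs i j) ≡ size i j * δ i k + size i j * δ j k
    mem-pairs k i j with toℕ i <? toℕ j | T i j
    ... | yes lt | true  = trans (trans (count-∷ (λ C → Mem? C k) (transposition i j (<⇒≢-Fin lt)) []) (trans (+-identityʳ _) (mem-transposition i j (<⇒≢-Fin lt) k)))
                             (sym (cong₂ _+_ (+-identityʳ (δ i k)) (+-identityʳ (δ j k))))
    ... | yes lt | false = refl
    ... | no _   | _     = refl

    mem-longs : ∀ k Ds cs u → count (λ C → Mem? C k) (longCycles Ds cs u) ≡ occ (concat Ds) k
    mem-longs k [] [] u = refl
    mem-longs k ((a ∷ as) ∷ Ds) (c ∷ cs) u = trans (count-∷ (λ C → Mem? C k) C (longCycles Ds cs (uniq-tail a as Ds u)))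
      (trans (cong₂ _+_ single (mem-longs k Ds cs (uniq-tail a as Ds u))) (sym (occ-++ (a ∷ as) (concat Ds) k)))
      where
      ≤1 : occ (a ∷ as) k ≤ 1
      ≤1 = ≤-trans (≤-trans (m≤m+n _ _) (≤-reflexive (sym (occ-++ (a ∷ as) (concat Ds) k)))) (u k)
      occ≡ : occ (a ∷ reverse as) k ≡ occ (a ∷ as) k
      occ≡ = cong (δ a k +_) (occ-reverse as k)
      C = cycleOf a (reverse as) (uniq-head a as Ds u)
      single : ind (does (Mem? C k)) ≡ occ (a ∷ as) k
      single with 0 <? occ (a ∷ as) k
      ... | yes p = trans (cong ind (dec-true (Mem? C k) (lookup-occ (a ∷ reverse as) k (≤-trans p (≤-reflexive (sym occ≡))))))
                          (≤-antisym p ≤1)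
      ... | no ¬p = trans (cong ind (dec-false (Mem? C k) λ { (t , refl) → ¬p (≤-trans (occ-lookup (a ∷ reverse as) t) (≤-reflexive occ≡)) }))
                          (sym (n≤0⇒n≡0 (≮⇒≥ ¬p)))

    -- The `δ` factors cut the double sum down to row `k` plus column `k` of `size`. A matched pair
    -- is listed in one order only, so together they count each edge at `k` once.
    sum-pairs : ∀ k → sum (λ i → sum (λ j → size i j * δ i k + size i j * δ j k)) ≡ deg T k
    sum-pairs k = begin
      sum (λ i → sum (λ j → size i j * δ i k + size i j * δ j k))
        ≡⟨ sum-cong-≗ (λ i → ∑-distrib-+ (λ j → size i j * δ i k) (λ j → size i j * δ j k)) ⟩
      sum (λ i → sum (λ j → size i j * δ i k) + sum (λ j → size i j * δ j k))
        ≡⟨ ∑-distrib-+ (λ i → sum (λ j → size i j * δ i k)) (λ i → sum (λ j → size i j * δ j k)) ⟩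
      sum (λ i → sum (λ j → size i j * δ i k)) + sum (λ i → sum (λ j → size i j * δ j k))
        ≡⟨ cong₂ _+_
             (trans (sum-single (λ i → sum (λ j → size i j * δ i k)) k
                      (λ i i≢k → trans (sum-cong-≗ (λ j → δ-* (size i j) i≢k)) (sum-replicate-zero n)))
                    (sum-cong-≗ (λ j → δ-*-refl (size k j) k)))
             (sum-cong-≗ (λ i → trans (sum-single (λ j → size i j * δ j k) k (λ j j≢k → δ-* (size i j) j≢k)) (δ-*-refl (size i k) k))) ⟩
      sum (λ j → size k j) + sum (λ i → size i k)
        ≡⟨ sym (∑-distrib-+ (size k) (λ i → size i k)) ⟩
      sum (λ j → size k j + size j k)
        ≡⟨ sum-cong-≗ (size-sum k) ⟩
      deg T k ∎
      where open ≡-Reasoning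

    mem-fixed : ∀ (i k : Fin n) → ind (does (Mem? (fixedPoint i) k)) ≡ δ i k
    mem-fixed i k = go (i ≟ k)
      where
      go : Dec (i ≡ k) → ind (does (Mem? (fixedPoint i) k)) ≡ δ i k
      go (yes refl) = trans (cong ind (dec-true (Mem? (fixedPoint i) k) (zero , refl))) (sym (δ-refl k))
      go (no i≢k) = trans (cong ind (dec-false (Mem? (fixedPoint i) k) λ { (_ , e) → i≢k e })) (sym (δ-≢ i≢k))

    mem-gsp : ∀ k → count (λ C → Mem? C k) gsp ≡ cap k
    mem-gsp k = begin
      count (λ C → Mem? C k) gsp
        ≡⟨ count-gsp (λ C → Mem? C k) ⟩
      count (λ C → Mem? C k) longs + (sum (λ i → sum (λ j → count (λ C → Mem? C k) (pairs i j))) + sum (λ i → count (λ C → Mem? C k) (singles i)))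
        ≡⟨ cong₂ _+_ (mem-longs k Cs cycles uniq) (cong₂ _+_
             (trans (sum-cong-≗ (λ i → sum-cong-≗ (mem-pairs k i))) (sum-pairs k))
             (trans (sum-single _ k (λ i i≢k → trans (single-count i) (δ-* (rest i) i≢k))) (trans (single-count k) (δ-*-refl (rest k) k)))) ⟩
      occ (concat Cs) k + (deg T k + (cap k ∸ (deg T k + occ (concat Cs) k)))
        ≡⟨ trans (lem (occ (concat Cs) k) (deg T k) _) (m+[n∸m]≡n (≤-trans (≤-reflexive (sym (+-identityʳ _))) (total≤ k))) ⟩
      cap k ∎
      where
      open ≡-Reasoning
      lem : ∀ o d x → o + (d + x) ≡ d + o + x
      lem = solve-∀
      rest : Fin n → ℕ
      rest i = cap i ∸ (deg T i + occ (concat Cs) i)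
      single-count : ∀ i → count (λ C → Mem? C k) (singles i) ≡ (cap i ∸ (deg T i + occ (concat Cs) i)) * δ i k
      single-count i = trans (count-replicate (λ C → Mem? C k) (cap i ∸ (deg T i + occ (concat Cs) i)) (fixedPoint i))
        (cong ((cap i ∸ (deg T i + occ (concat Cs) i)) *_) (mem-fixed i k))

    map-transposition : ∀ (i j : Fin n) i≢j a b → a ≢ b → ind (does (MapsTo? (transposition i j i≢j) a b)) ≡ δ i a * δ j b + δ i b * δ j a
    map-transposition i j i≢j a b a≢b = go (i ≟ a) (j ≟ b) (i ≟ b) (j ≟ a)
      where
      C = transposition i j i≢j
      holds : MapsTo C a b → ind (does (MapsTo? C a b)) ≡ 1
      holds p = cong ind (dec-true (MapsTo? C a b) p)
      fails : ¬ MapsTo C a b → ind (does (MapsTo? C a b)) ≡ 0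
      fails ¬p = cong ind (dec-false (MapsTo? C a b) ¬p)
      neither : (i ≢ a ⊎ j ≢ b) → (i ≢ b ⊎ j ≢ a) → ¬ MapsTo C a b
      neither (inj₁ i≢a) _ (zero , e , _) = i≢a e
      neither (inj₂ j≢b) _ (zero , _ , e) = j≢b e
      neither _ (inj₁ i≢b) (suc zero , _ , e) = i≢b e
      neither _ (inj₂ j≢a) (suc zero , e , _) = j≢a e
      product-0 : ∀ {c d} → i ≢ c ⊎ j ≢ d → δ i c * δ j d ≡ 0
      product-0 {c} {d} (inj₁ p) = cong (_* δ j d) (δ-≢ p)
      product-0 {c} {d} (inj₂ p) = δ-* (δ i c) p
      zeros : (i ≢ a ⊎ j ≢ b) → (i ≢ b ⊎ j ≢ a) → ind (does (MapsTo? C a b)) ≡ δ i a * δ j b + δ i b * δ j a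
      zeros p q = trans (fails (neither p q)) (sym (cong₂ _+_ (product-0 p) (product-0 q)))
      go : Dec (i ≡ a) → Dec (j ≡ b) → Dec (i ≡ b) → Dec (j ≡ a) → ind (does (MapsTo? C a b)) ≡ δ i a * δ j b + δ i b * δ j a
      go (yes refl) (yes refl) _ _ = trans (holds (zero , refl , refl))
        (sym (cong₂ _+_ (cong₂ _*_ (δ-refl a) (δ-refl b)) (product-0 (inj₁ a≢b))))
      go (yes refl) (no j≢b) _ _ = zeros (inj₂ j≢b) (inj₁ a≢b)
      go (no i≢a) _ (yes refl) (yes refl) = trans (holds (suc zero , refl , refl))
        (sym (cong₂ _+_ (product-0 (inj₁ i≢a)) (cong₂ _*_ (δ-refl b) (δ-refl a))))
      go (no i≢a) _ (no i≢b) _ = zeros (inj₁ i≢a) (inj₁ i≢b)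
      go (no i≢a) _ _ (no j≢a) = zeros (inj₁ i≢a) (inj₂ j≢a)

    map-pairs : ∀ a b → a ≢ b → ∀ i j → count (λ C → MapsTo? C a b) (pairs i j) ≡ size i j * (δ i a * δ j b + δ i b * δ j a)
    map-pairs a b a≢b i j with toℕ i <? toℕ j | T i j
    ... | yes lt | true  = trans (count-∷ (λ C → MapsTo? C a b) (transposition i j (<⇒≢-Fin lt)) [])
      (trans (cong (_+ 0) (map-transposition i j (<⇒≢-Fin lt) a b a≢b)) (trans (+-identityʳ _) (sym (*-identityˡ _))))
    ... | yes lt | false = refl
    ... | no _   | _     = refl

    sum-map : ∀ a b → a ≢ b → sum (λ i → sum (λ j → size i j * (δ i a * δ j b + δ i b * δ j a))) ≡ ind (T a b)
    sum-map a b a≢b = trans (sum-cong-≗ row) (trans (∑-distrib-+ (λ i → size i b * δ i a) (λ i → size i a * δ i b))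
        (trans (cong₂ _+_ (pick b a) (pick a b)) (size-sum a b)))
      where
      lem : ∀ s x y z t → s * (x * y + z * t) ≡ s * x * y + s * z * t
      lem = solve-∀
      pick : ∀ c d → sum (λ i → size i c * δ i d) ≡ size d c
      pick c d = trans (sum-single _ d (λ i i≢d → δ-* (size i c) i≢d)) (δ-*-refl (size d c) d)
      row : ∀ i → sum (λ j → size i j * (δ i a * δ j b + δ i b * δ j a)) ≡ size i b * δ i a + size i a * δ i b
      row i = trans (sum-cong-≗ (λ j → lem (size i j) (δ i a) (δ j b) (δ i b) (δ j a)))
        (trans (∑-distrib-+ (λ j → size i j * δ i a * δ j b) (λ j → size i j * δ i b * δ j a))
          (cong₂ _+_ (trans (sum-single _ b (λ j j≢b → δ-* (size i j * δ i a) j≢b)) (δ-*-refl (size i b * δ i a) b))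
                     (trans (sum-single _ a (λ j j≢a → δ-* (size i j * δ i b) j≢a)) (δ-*-refl (size i a * δ i b) a))))

    map-singles : ∀ a b → a ≢ b → ∀ i → count (λ C → MapsTo? C a b) (singles i) ≡ 0
    map-singles a b a≢b i = trans (count-replicate (λ C → MapsTo? C a b) (cap i ∸ (deg T i + occ (concat Cs) i)) (fixedPoint i))
      (trans (cong ((cap i ∸ (deg T i + occ (concat Cs) i)) *_) (cong ind (dec-false (MapsTo? (fixedPoint i) a b) λ { (_ , refl , e) → a≢b e }))) (*-zeroʳ (cap i ∸ (deg T i + occ (concat Cs) i))))

    map-gsp : ∀ a b → a ≢ b → count (λ C → MapsTo? C a b) gsp ≡ count (λ C → MapsTo? C a b) longs + ind (T a b)
    map-gsp a b a≢b = trans (count-gsp (λ C → MapsTo? C a b)) (cong (count (λ C → MapsTo? C a b) longs +_)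
      (trans (cong₂ _+_ (trans (sum-cong-≗ (λ i → sum-cong-≗ (map-pairs a b a≢b i))) (sum-map a b a≢b))
                        (trans (sum-cong-≗ (map-singles a b a≢b)) (sum-replicate-zero n)))
             (+-identityʳ _)))

    long-edges : ∀ Ds cs u → All (λ C → ∀ t → HalfEdge T w (elem C (next C t)) (elem C t)) (longCycles Ds cs u)
    long-edges [] cs u = []
    long-edges ((a ∷ as) ∷ Ds) ((ev , wk) ∷ cs) u = cycleOf-next a (reverse as) (uniq-head a as Ds u) (walk-reverse as wk) ∷ long-edges Ds cs (uniq-tail a as Ds u)

    map-longs≤1 : ∀ a b → count (λ C → MapsTo? C a b) longs ≤ 1
    map-longs≤1 a b = ≤-trans (count-mono (λ C → MapsTo? C a b) (λ C → Mem? C a) (λ { _ (t , e , _) → t , e }) longs)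
      (≤-trans (≤-reflexive (mem-longs a Cs cycles uniq)) (uniq a))

    map-longs-matched : ∀ a b → T b a ≡ true → count (λ C → MapsTo? C a b) longs ≡ 0
    map-longs-matched a b t = count-none (λ C → MapsTo? C a b)
      (All.map (λ { e (s , refl , refl) → true≢false t (HalfEdge.unmatched (e s)) }) (long-edges Cs cycles uniq))

    -- A matched pair arises from its transposition alone, an unmatched one only from the disjoint
    -- long cycles. Both the distinctness of cycles and F4 follow from this bound.
    map-gsp≤1 : ∀ a b → a ≢ b → count (λ C → MapsTo? C a b) gsp ≤ 1
    map-gsp≤1 a b a≢b with bool-cases (T a b)
    ... | inj₁ t rewrite map-gsp a b a≢b | map-longs-matched a b (trans (symm b a) t) | t = ≤-refl
    ... | inj₂ f rewrite map-gsp a b a≢b | f | +-identityʳ (count (λ C → MapsTo? C a b) longs) = map-longs≤1 a b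

    -- The first half is F1. The second bounds every predecessor by the threshold, so that
    -- domination with respect to `w` becomes domination with respect to the partition, and `dom`
    -- yields F2.
    Obedient : Cycle n → Set
    Obedient C = ∀ t → PrefEq I (elem C t) (elem C (next C t)) (elem C (prev C t)) × r (elem C t) (elem C (prev C t)) ≤ w (elem C t)

    obedient : All Obedient gsp
    obedient = all-gsp (All.map (λ {C} → long {C}) (long-edges Cs cycles uniq)) pair single
      where
      long : ∀ {C} → (∀ t → HalfEdge T w (elem C (next C t)) (elem C t)) → Obedient C
      long {C} e t = ≤-pred (≤-trans (HalfEdge.bounded (e t)) (≤-reflexive threshold)) , ≤-reflexive (sym threshold)
        where
        threshold : w (elem C t) ≡ r (elem C t) (elem C (prev C t))
        threshold = subst (λ s → w (elem C s) ≡ r (elem C s) (elem C (prev C t))) (next-prev C t) (HalfEdge.threshold (e (prev C t)))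
      pair : ∀ i j → All Obedient (pairs i j)
      pair i j with toℕ i <? toℕ j | T i j in eq
      ... | yes lt | true  = (λ { zero → ≤-refl , within i j eq ; (suc zero) → ≤-refl , within j i (trans (symm j i) eq) }) ∷ []
      ... | yes lt | false = []
      ... | no _   | _     = []
      single : ∀ i → All Obedient (singles i)
      single i with cap i ∸ (deg T i + occ (concat Cs) i) in eq
      ... | zero = []
      ... | suc k = fixed (suc k)
        where
        -- A fixed point is listed only where capacity is left over, and `full` then excludes a
        -- threshold below `r i i`.
        wi : r i i ≤ w i
        wi = ≮⇒≥ λ lt → <⇒≢ (s≤s z≤n) (trans (sym (m≤n⇒m∸n≡0 (≤-reflexive (trans (sym (full i lt)) (+-identityʳ _))))) eq)
        fixed : ∀ l → All Obedient (replicate l (fixedPoint i))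
        fixed zero    = []
        fixed (suc l) = (λ _ → ≤-refl , wi) ∷ fixed l

    matched-transposition : ∀ i j → T i j ≡ true → Any (λ C → IsTransposition C i j) gsp
    matched-transposition i j t with <-cmp-⊎ (toℕ i) (toℕ j) (λ e → true≢false (subst (λ k → T i k ≡ true) (sym (toℕ-injective e)) t) (irr i))
      where
      <-cmp-⊎ : ∀ x y → x ≢ y → x < y ⊎ y < x
      <-cmp-⊎ x y x≢y with x <? y
      ... | yes lt = inj₁ lt
      ... | no ¬lt = inj₂ (≤∧≢⇒< (≮⇒≥ ¬lt) (x≢y ∘ sym))
    ... | inj₁ lt = ++⁺ʳ longs (++⁺ˡ (any-concatTab _ i (any-concatTab _ j here-pair)))
      where
      here-pair : Any (λ C → IsTransposition C i j) (pairs i j)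
      here-pair with toℕ i <? toℕ j | T i j | trans (symm i j) (trans (symm j i) t)
      here-pair | yes _ | true | _ = here (refl , (zero , refl) , (suc zero , refl))
      here-pair | no ¬lt | _ | _ = ⊥-elim (¬lt lt)
    ... | inj₂ lt = ++⁺ʳ longs (++⁺ˡ (any-concatTab _ j (any-concatTab _ i here-pair)))
      where
      here-pair : Any (λ C → IsTransposition C i j) (pairs j i)
      here-pair with toℕ j <? toℕ i | T j i | trans (symm j i) t
      here-pair | yes _ | true | _ = here (refl , (suc zero , refl) , (zero , refl))
      here-pair | no ¬lt | _ | _ = ⊥-elim (¬lt lt)

    isGSP : IsGSP I (lookup gsp)
    isGSP = record { distinct = distinct′ ; F1 = λ s t → proj₁ (All.lookup obedient (∈-lookup s) t) ; F2 = F2′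
      ; F3 = λ i → trans (count-lookup (λ C → Mem? C i) gsp) (mem-gsp i) ; F4 = F4′ }
      where
      mapIdx : ∀ a b → countIdx (λ s → MapsTo? (lookup gsp s) a b) ≡ count (λ C → MapsTo? C a b) gsp
      mapIdx a b = count-lookup (λ C → MapsTo? C a b) gsp

      distinct′ : ∀ s t → s ≢ t → len (lookup gsp s) ≡ 1 ⊎ ¬ SameCycle (lookup gsp s) (lookup gsp t)
      distinct′ s t s≢t = go (m C) refl
        where
        C = lookup gsp s
        a = elem C zero
        b = elem C (next C zero)
        here-s : MapsTo C a b
        here-s = zero , refl , refl
        go : ∀ l → m C ≡ l → len C ≡ 1 ⊎ ¬ SameCycle C (lookup gsp t)
        go zero    eq = inj₁ (cong suc eq)
        -- Equal nontrivial cycles at two indices would map `a` to `b` twice.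
        go (suc l) eq = inj₂ λ { (_ , _ , same) → <⇒≱ (countIdx-two (λ x → MapsTo? (lookup gsp x) a b) s t s≢t here-s (same a b here-s))
                          (≤-trans (≤-reflexive (mapIdx a b)) (map-gsp≤1 a b a≢b)) }
          where
          a≢b : a ≢ b
          a≢b e = <⇒≢ (s≤s z≤n) (trans (sym (next-fixed C zero (sym (inj C e)))) eq)

      F2′ : ∀ i j → i ≢ j → ¬ (Σ _ λ s → IsTransposition (lookup gsp s) i j) → ∀ s t s′ t′ →
            elem (lookup gsp s) t ≡ i → elem (lookup gsp s′) t′ ≡ j →
            ¬ (Pref I i j (elem (lookup gsp s) (prev (lookup gsp s) t)) × Pref I j i (elem (lookup gsp s′) (prev (lookup gsp s′) t′)))
      F2′ _ _ i≢j ¬tr s t s′ t′ refl refl (p , q) with bool-cases (T (elem (lookup gsp s) t) (elem (lookup gsp s′) t′))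
      ... | inj₁ matched = ¬tr (index any , lookup-index any) where any = matched-transposition _ _ matched
      ... | inj₂ unmatched with dom _ _ i≢j unmatched
      ...   | inj₁ le = <⇒≱ (s≤s p) (≤-trans (proj₂ (All.lookup obedient (∈-lookup s) t)) le)
      ...   | inj₂ le = <⇒≱ (s≤s q) (≤-trans (proj₂ (All.lookup obedient (∈-lookup s′) t′)) le)

      F4′ : ∀ i j → i ≢ j → countIdx (λ s → MapsTo? (lookup gsp s) i j) + countIdx (λ s → MapsTo? (lookup gsp s) j i) ≤ 2
      F4′ i j i≢j rewrite mapIdx i j | mapIdx j i = +-mono-≤ (map-gsp≤1 i j i≢j) (map-gsp≤1 j i (i≢j ∘ sym))

  odd-long : ∀ {T w} a as → IsCycle T w (a ∷ as) → ∀ u → OddNontrivial (cycleOf a (reverse as) u)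
  odd-long a [] (ev , wk) u = ⊥-elim (HalfEdge.distinct wk refl)
  odd-long a (x ∷ as) (ev , wk) u rewrite length-reverse (x ∷ as) = s≤s (s≤s z≤n) ,
    λ even → <⇒≢ (s≤s (s≤s z≤n)) (sym (∣1⇒≡1 (∣m+n∣m⇒∣n (subst (2 ∣_) (+-comm 1 _) even) (evenLength-∣ ev))))

  half-integral⇒odd : ∀ {T L Cs w} → Config T (L ∷ Cs) w cap (λ _ → 0) →
                      ∃ λ k → ∃ λ (Π : Fin k → Cycle n) → IsGSP I Π × ∃ λ s → OddNontrivial (Π s)
  half-integral⇒odd {L = []} (config _ _ _ _ (() ∷ _) _ _ _ _)
  half-integral⇒odd {L = a ∷ as} {Cs} K@(config _ _ _ _ (c ∷ cs) u _ _ _) =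
    length (gsp K) , lookup (gsp K) , isGSP K , zero , odd-long a as c (uniq-head a as Cs u)

  card-tabulate : ∀ {k} (f : Fin k → Bool) → ∣ Vec.tabulate f ∣ ≡ sum (λ i → ind (f i))
  card-tabulate {zero}  f = refl
  card-tabulate {suc k} f with f zero
  ... | true  = cong suc (card-tabulate (f ∘ suc))
  ... | false = card-tabulate (f ∘ suc)

  integral⇒stable : ∀ {T w} → Config T [] w cap (λ _ → 0) → Σ (Matching I) (Stable I)
  integral⇒stable {T} {w} K = M , stable
    where
    open Config K
    partners : Fin n → Subset n
    partners i = Vec.tabulate (T i)
    ∈⇒T : ∀ i j → j ∈ partners i → T i j ≡ true
    ∈⇒T i j p = trans (sym (lookup∘tabulate (T i) j)) ([]=⇒lookup p)
    T⇒∈ : ∀ i j → T i j ≡ true → j ∈ partners i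
    T⇒∈ i j t = lookup⇒[]= j _ (trans (lookup∘tabulate (T i) j) t)
    size≡ : ∀ i → ∣ partners i ∣ ≡ deg T i + 0 + 0
    size≡ i = trans (card-tabulate (T i)) (sym (trans (+-identityʳ _) (+-identityʳ _)))
    M : Matching I
    M = record { partners = partners
      ; sym = λ i j p → T⇒∈ j i (trans (symm j i) (∈⇒T i j p))
      ; irrefl = λ i p → true≢false (∈⇒T i i p) (irr i)
      ; capacity = λ i → ≤-trans (≤-reflexive (size≡ i)) (total≤ i) }
    -- A threshold bounded by `r i j` lies below `r i i`, so `full` excludes spare capacity, and
    -- `within` excludes a partner worse than `j`.
    rejects : ∀ i j → i ≢ j → w i ≤ r i j → ¬ Accepts I M i j
    rejects i j i≢j le (inj₁ spare) = <⇒≢ (≤-trans (≤-reflexive (cong suc (sym (size≡ i)))) spare)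
      (full i (≤-<-trans le (r-self i j (i≢j ∘ sym))))
    rejects i j i≢j le (inj₂ (k , (k∈ , _) , better)) = <⇒≱ (s≤s better) (≤-trans (within i k (∈⇒T i k k∈)) le)
    stable : Stable I M
    stable i j (i≢j , j∉ , accept-j , accept-i) with bool-cases (T i j)
    ... | inj₁ t = j∉ (T⇒∈ i j t)
    ... | inj₂ f with dom i j i≢j f
    ...   | inj₁ le = rejects i j i≢j le accept-i
    ...   | inj₂ le = rejects j i (i≢j ∘ sym) le accept-j

  no-odd⇒stable : (∀ k (Π : Fin k → Cycle n) → IsGSP I Π → ∀ s → ¬ OddNontrivial (Π s)) → Σ (Matching I) (Stable I)
  no-odd⇒stable no-odd with result (sum cap) cap refl
  ... | T , [] , w , K = integral⇒stable K
  ... | T , L ∷ Cs , w , K with half-integral⇒odd K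
  ...   | k , Π , isG , s , odd = ⊥-elim (no-odd k Π isG s odd)

-- Sums over a cyclic permutation, parity, and signs of agents.

card-lookup : ∀ {n} (v : Subset n) → ∣ v ∣ ≡ sum (λ j → ind (Vec.lookup v j))
card-lookup []          = refl
card-lookup (true  ∷ v) = cong suc (card-lookup v)
card-lookup (false ∷ v) = card-lookup v

sum-tight : ∀ {n} {g h : Fin n → ℕ} → (∀ i → g i ≤ h i) → sum h ≤ sum g → ∀ i → g i ≡ h i
sum-tight le total i = ≤-antisym (le i) (≮⇒≥ λ lt → <⇒≱ (sum-mono-< i le lt) total)

module _ {n} (C : Cycle n) where

  row-sum : ∀ i → sum (λ j → ind (does (MapsTo? C i j))) ≡ ind (does (Mem? C i))
  row-sum i = go (Mem? C i)
    where
    go : Dec (Mem C i) → sum (λ j → ind (does (MapsTo? C i j))) ≡ ind (does (Mem? C i))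
    go (yes (t , refl)) = trans
      (sum-single _ (elem C (next C t)) λ j j≢ → cong ind (dec-false (MapsTo? C i j)
        λ { (s , e , e′) → j≢ (trans (sym e′) (cong (elem C ∘ next C) (inj C e))) }))
      (trans (cong ind (dec-true (MapsTo? C i _) (t , refl , refl))) (sym (cong ind (dec-true (Mem? C i) (t , refl)))))
    go (no ∉C) = trans
      (trans (sum-cong-≗ λ j → cong ind (dec-false (MapsTo? C i j) λ { (t , e , _) → ∉C (t , e) })) (sum-replicate-zero n))
      (sym (cong ind (dec-false (Mem? C i) ∉C)))

  column-sum : ∀ i → sum (λ j → ind (does (MapsTo? C j i))) ≡ ind (does (Mem? C i))
  column-sum i = go (Mem? C i)
    where
    go : Dec (Mem C i) → sum (λ j → ind (does (MapsTo? C j i))) ≡ ind (does (Mem? C i))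
    go (yes (t , refl)) = trans
      (sum-single _ (elem C (prev C t)) λ j j≢ → cong ind (dec-false (MapsTo? C j i)
        λ { (s , e , e′) → j≢ (trans (sym e) (cong (elem C) (trans (sym (prev-next C s)) (cong (prev C) (inj C e′))))) }))
      (trans (cong ind (dec-true (MapsTo? C _ i) (prev C t , refl , cong (elem C) (next-prev C t)))) (sym (cong ind (dec-true (Mem? C i) (t , refl)))))
    go (no ∉C) = trans
      (trans (sum-cong-≗ λ j → cong ind (dec-false (MapsTo? C j i) λ { (t , _ , e) → ∉C (next C t , e) })) (sum-replicate-zero n))
      (sym (cong ind (dec-false (Mem? C i) ∉C)))

  next²-fixed : ∀ t → next C (next C t) ≡ t → m C ≤ 1
  next²-fixed t e with position C t
  ... | inj₂ last with position C (next C t)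
  ...   | inj₁ lt = ≤-reflexive (trans (sym last) (trans (sym (cong toℕ e))
            (trans (next-suc C (next C t) lt) (cong suc (next-last C t last)))))
  ...   | inj₂ last′ = ≤-trans (≤-reflexive (trans (sym last′) (next-last C t last))) z≤n
  next²-fixed t e | inj₁ lt with position C (next C t)
  ... | inj₁ lt′ = ⊥-elim (<⇒≢ (≤-trans (n<1+n _) (n≤1+n _))
          (trans (sym (cong toℕ e)) (trans (next-suc C (next C t) lt′) (cong suc (next-suc C t lt)))))
  ... | inj₂ last = ≤-reflexive (trans (sym last) (trans (next-suc C t lt)
          (cong suc (trans (sym (cong toℕ e)) (next-last C (next C t) last)))))

  -- The colour at an index records the parity of that index. The step from the last index back to 0
  -- flips it once more, so the last index is odd.
  alternating⇒even : (colour : Fin (suc (m C)) → Bool) → (∀ t → colour (next C t) ≡ not (colour t)) → 2 ∣ len C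
  alternating⇒even colour alt = finish (along (m C) (fromℕ (m C)) (toℕ-fromℕ (m C)))
    where
    not-id : ∀ b → b ≢ not b
    not-id true ()
    not-id false ()
    not-not : ∀ b → not (not b) ≡ b
    not-not true = refl
    not-not false = refl
    along : ∀ l t → toℕ t ≡ l → (colour t ≡ colour zero × 2 ∣ l) ⊎ (colour t ≡ not (colour zero) × 2 ∣ suc l)
    along zero t eq = inj₁ (cong colour (toℕ-injective {j = zero} eq) , divides 0 refl)
    along (suc l) t eq with along l (prev C t) (prev-suc C t l eq) | trans (cong colour (sym (next-prev C t))) (alt (prev C t))
    ... | inj₁ (e , divides q refl) | e′ = inj₂ (trans e′ (cong not e) , divides (suc q) refl)
    ... | inj₂ (e , even) | e′ = inj₁ (trans e′ (trans (cong not e) (not-not _)) , even)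
    wrap : colour zero ≡ not (colour (fromℕ (m C)))
    wrap = trans (cong colour (toℕ-injective {i = zero} (sym (next-last C (fromℕ (m C)) (toℕ-fromℕ (m C)))))) (alt (fromℕ (m C)))
    finish : (colour (fromℕ (m C)) ≡ colour zero × 2 ∣ m C) ⊎ (colour (fromℕ (m C)) ≡ not (colour zero) × 2 ∣ suc (m C)) → 2 ∣ suc (m C)
    finish (inj₁ (e , _)) = ⊥-elim (not-id _ (trans e wrap))
    finish (inj₂ (_ , even)) = even

transposition-maps : ∀ {n} (C : Cycle n) {i j} → i ≢ j → IsTransposition C i j → MapsTo C i j
transposition-maps C i≢j (two , (s , refl) , (t , refl)) = s , refl , cong (elem C) (toℕ-injective (go (position C s) (position C t)))
  where
  m≡1 : m C ≡ 1
  m≡1 = suc-injective two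
  s≢t : toℕ s ≢ toℕ t
  s≢t e = i≢j (cong (elem C) (toℕ-injective e))
  below : ∀ x → toℕ x < m C → toℕ x ≡ 0
  below x lt = n≤0⇒n≡0 (≤-pred (subst (toℕ x <_) m≡1 lt))
  go : toℕ s < m C ⊎ toℕ s ≡ m C → toℕ t < m C ⊎ toℕ t ≡ m C → toℕ (next C s) ≡ toℕ t
  go (inj₁ p) (inj₁ q) = ⊥-elim (s≢t (trans (below s p) (sym (below t q))))
  go (inj₂ p) (inj₂ q) = ⊥-elim (s≢t (trans p (sym q)))
  go (inj₁ p) (inj₂ q) = trans (next-suc C s p) (trans (cong suc (below s p)) (sym (trans q m≡1)))
  go (inj₂ p) (inj₁ q) = trans (next-last C s p) (sym (below t q))

-- up: an edge that M has and the partition lacks is dominated at the agent with respect to the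
-- partition; down: the same with the roles of M and the partition exchanged.
data Side : Set where
  up down flat : Side

-- The difference `gain σ p q - loss σ p q` is p - q times the sign of the side (1, -1 or 0), split
-- in two so as to stay within the natural numbers.
gain loss : Side → ℕ → ℕ → ℕ
gain up   p q = p
gain down p q = q
gain flat p q = 0
loss up   p q = q
loss down p q = p
loss flat p q = 0

sum-gain : ∀ {n} σ (p q : Fin n → ℕ) → sum (λ j → gain σ (p j) (q j)) ≡ gain σ (sum p) (sum q)
sum-gain         up   p q = refl
sum-gain         down p q = refl
sum-gain {n = n} flat p q = sum-replicate-zero n

sum-loss : ∀ {n} σ (p q : Fin n → ℕ) → sum (λ j → loss σ (p j) (q j)) ≡ loss σ (sum p) (sum q)
sum-loss         up   p q = refl
sum-loss         down p q = refl
sum-loss {n = n} flat p q = sum-replicate-zero n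

-- A sign 1 at one end is at worst cancelled by the sign at the other.
gain-up : ∀ σ {a b} → b ≤ a → loss up a b + loss σ a b ≤ gain up a b + gain σ a b
gain-up up   le = +-mono-≤ le le
gain-up down {a} {b} le = ≤-reflexive (+-comm b a)
gain-up flat le = +-monoˡ-≤ 0 le

gain-down : ∀ σ {a b} → a ≤ b → loss down a b + loss σ a b ≤ gain down a b + gain σ a b
gain-down up {a} {b} le = ≤-reflexive (+-comm a b)
gain-down down le = +-mono-≤ le le
gain-down flat le = +-monoˡ-≤ 0 le

gain≡loss : ∀ σ {a b} → a ≡ b → loss σ a b ≡ gain σ a b
gain≡loss up   e = sym e
gain≡loss down e = e
gain≡loss flat e = refl

-- Double counting of signed differences.

module Balance {n : ℕ} (side : Fin n → Side) (p X : Fin n → Fin n → ℕ)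
  (p-sym : ∀ i j → p i j ≡ p j i) (X-sym : ∀ i j → X i j ≡ X j i)
  (surplus : ∀ i j → X i j < p i j → side i ≡ up ⊎ side j ≡ up)
  (deficit : ∀ i j → i ≢ j → p i j < X i j → side i ≡ down ⊎ side j ≡ down)
  (diagonal : ∀ i → p i i < X i i → side i ≢ up)
  (row≤ : ∀ i → gain (side i) (sum (p i)) (sum (X i)) ≤ loss (side i) (sum (p i)) (sum (X i))) where

  -- Summed over all i and j, L − R is Σ (σ i + σ j) (p i j − X i j) with σ = ±1 on up/down: it is
  -- termwise nonnegative, but by row≤ its total is nonpositive.
  L R : Fin n → Fin n → ℕ
  L i j = gain (side i) (p i j) (X i j) + gain (side j) (p i j) (X i j)
  R i j = loss (side i) (p i j) (X i j) + loss (side j) (p i j) (X i j)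

  R≤L : ∀ i j → R i j ≤ L i j
  R≤L i j with <-cmp (p i j) (X i j)
  ... | tri≈ _ e _ = ≤-reflexive (cong₂ _+_ (gain≡loss (side i) e) (gain≡loss (side j) e))
  ... | tri> _ _ lt with surplus i j lt
  ...   | inj₁ u rewrite u = gain-up (side j) (<⇒≤ lt)
  ...   | inj₂ u rewrite u = subst₂ _≤_ (+-comm (X i j) _) (+-comm (p i j) _) (gain-up (side i) (<⇒≤ lt))
  R≤L i j | tri< lt _ _ with i ≟ j
  ... | no i≢j with deficit i j i≢j lt
  ...   | inj₁ d rewrite d = gain-down (side j) (<⇒≤ lt)
  ...   | inj₂ d rewrite d = subst₂ _≤_ (+-comm (p i j) _) (+-comm (X i j) _) (gain-down (side i) (<⇒≤ lt))
  -- On the diagonal, where fixed points make `X` positive, the same sign counts twice, so it is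
  -- enough to exclude `up`.
  R≤L i .i | tri< lt _ _ | yes refl with side i in eq
  ... | up   = ⊥-elim (diagonal i lt eq)
  ... | down = +-mono-≤ (<⇒≤ lt) (<⇒≤ lt)
  ... | flat = ≤-refl

  -- Exchanging the order of summation turns the terms of `j` into those of `i`, by the symmetry of
  -- `p` and `X`. The side is constant along a row and so moves out of the inner sum.
  double : ∀ (g : Side → ℕ → ℕ → ℕ) → (∀ σ (a b : Fin n → ℕ) → sum (λ j → g σ (a j) (b j)) ≡ g σ (sum a) (sum b)) →
           sum (λ i → sum (λ j → g (side i) (p i j) (X i j) + g (side j) (p i j) (X i j))) ≡
           sum (λ i → g (side i) (sum (p i)) (sum (X i))) + sum (λ i → g (side i) (sum (p i)) (sum (X i)))
  double g sum-g = trans (sum-cong-≗ λ i → ∑-distrib-+ (λ j → g (side i) (p i j) (X i j)) (λ j → g (side j) (p i j) (X i j)))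
    (trans (∑-distrib-+ (λ i → sum (λ j → g (side i) (p i j) (X i j))) (λ i → sum (λ j → g (side j) (p i j) (X i j))))
      (cong₂ _+_ rows (trans (∑-comm (λ i j → g (side j) (p i j) (X i j)))
        (trans (sum-cong-≗ λ j → sum-cong-≗ λ i → cong₂ (g (side j)) (p-sym i j) (X-sym i j)) rows))))
    where
    rows : sum (λ i → sum (λ j → g (side i) (p i j) (X i j))) ≡ sum (λ i → g (side i) (sum (p i)) (sum (X i)))
    rows = sum-cong-≗ λ i → sum-g (side i) (p i) (X i)

  L≤R : sum (λ i → sum (L i)) ≤ sum (λ i → sum (R i))
  L≤R = ≤-trans (≤-reflexive (double gain sum-gain)) (≤-trans (+-mono-≤ (sum-mono-≤ row≤) (sum-mono-≤ row≤)) (≤-reflexive (sym (double loss sum-loss))))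

  balanced : ∀ i j → R i j ≡ L i j
  balanced i j = sum-tight (R≤L i) (≤-reflexive (sym (sum-tight (λ i → sum-mono-≤ (R≤L i)) L≤R i))) j

  Opposite : Side → Side → Set
  Opposite σ τ = (σ ≡ up × τ ≡ down) ⊎ (σ ≡ down × τ ≡ up)

  -- Equality in every term means that the two signs add up to 0 wherever `p` and `X` differ. Both
  -- cannot be 0, because `surplus` or `deficit` gives one end a side.
  opposite : ∀ i j → i ≢ j → p i j ≢ X i j → Opposite (side i) (side j)
  opposite i j i≢j p≢X = go (side i) (side j) refl refl (balanced i j)
    where
    absurd : ∀ {a b : ℕ} → a ≢ b → a + a ≡ b + b → ⊥
    absurd {a} {b} a≢b e with <-cmp a b
    ... | tri< lt _ _ = <⇒≢ (+-mono-< lt lt) e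
    ... | tri≈ _ e′ _ = a≢b e′
    ... | tri> _ _ lt = <⇒≢ (+-mono-< lt lt) (sym e)
    both-flat : side i ≡ flat → side j ≡ flat → ⊥
    both-flat ei ej with <-cmp (p i j) (X i j)
    ... | tri≈ _ e _ = p≢X e
    ... | tri> _ _ lt = [ (λ u → up≢flat (trans (sym u) ei)) , (λ u → up≢flat (trans (sym u) ej)) ]′ (surplus i j lt)
      where
      up≢flat : up ≢ flat
      up≢flat ()
    ... | tri< lt _ _ = [ (λ d → down≢flat (trans (sym d) ei)) , (λ d → down≢flat (trans (sym d) ej)) ]′ (deficit i j i≢j lt)
      where
      down≢flat : down ≢ flat
      down≢flat ()
    go : ∀ σ τ → side i ≡ σ → side j ≡ τ → loss (side i) (p i j) (X i j) + loss (side j) (p i j) (X i j) ≡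
         gain (side i) (p i j) (X i j) + gain (side j) (p i j) (X i j) → Opposite (side i) (side j)
    go up   down ei ej _ = inj₁ (ei , ej)
    go down up   ei ej _ = inj₂ (ei , ej)
    go up   up   ei ej e rewrite ei | ej = ⊥-elim (absurd p≢X (sym e))
    go down down ei ej e rewrite ei | ej = ⊥-elim (absurd p≢X e)
    go up   flat ei ej e rewrite ei | ej = ⊥-elim (p≢X (sym (trans (sym (+-identityʳ _)) (trans e (+-identityʳ _)))))
    go down flat ei ej e rewrite ei | ej = ⊥-elim (p≢X (trans (sym (+-identityʳ _)) (trans e (+-identityʳ _))))
    go flat up   ei ej e rewrite ei | ej = ⊥-elim (p≢X (sym e))
    go flat down ei ej e rewrite ei | ej = ⊥-elim (p≢X e)
    go flat flat ei ej e = ⊥-elim (both-flat ei ej)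

-- A stable matching compared with a partition: no odd cycles.

module _ {n k : ℕ} (I : SF n) (M : Matching I) (stable : Stable I M) (Π : Fin k → Cycle n) (G : IsGSP I Π) where

  open SF I
  open Matching M using (partners; irrefl; capacity) renaming (sym to partners-sym)
  open IsGSP G

  before after : ∀ s → Fin (suc (m (Π s))) → Fin n
  before s t = elem (Π s) (prev (Π s) t)
  after  s t = elem (Π s) (next (Π s) t)

  x X p : Fin n → Fin n → ℕ
  x i j = countIdx (λ s → MapsTo? (Π s) i j)
  X i j = x i j + x j i
  p i j = ind (Vec.lookup (partners i) j) + ind (Vec.lookup (partners i) j)

  x-witness : ∀ i j → 1 ≤ x i j → ∃ λ s → MapsTo (Π s) i j
  x-witness i j le with any? (λ s → MapsTo? (Π s) i j)
  ... | yes w = w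
  ... | no ¬w = ⊥-elim (<⇒≢ le (sym (countIdx-none (λ s → MapsTo? (Π s) i j) λ s w → ¬w (s , w))))

  row-total : ∀ i → sum (x i) ≡ cap i
  row-total i = trans (sum-cong-≗ λ j → countIdx-sum (λ s → MapsTo? (Π s) i j))
    (trans (∑-comm (λ j s → ind (does (MapsTo? (Π s) i j))))
    (trans (sum-cong-≗ λ s → row-sum (Π s) i) (trans (sym (countIdx-sum (λ s → Mem? (Π s) i))) (F3 i))))

  column-total : ∀ i → sum (λ j → x j i) ≡ cap i
  column-total i = trans (sum-cong-≗ λ j → countIdx-sum (λ s → MapsTo? (Π s) j i))
    (trans (∑-comm (λ j s → ind (does (MapsTo? (Π s) j i))))
    (trans (sum-cong-≗ λ s → column-sum (Π s) i) (trans (sym (countIdx-sum (λ s → Mem? (Π s) i))) (F3 i))))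

  X-total : ∀ i → sum (X i) ≡ cap i + cap i
  X-total i = trans (∑-distrib-+ (x i) (λ j → x j i)) (cong₂ _+_ (row-total i) (column-total i))

  p-total : ∀ i → sum (p i) ≡ ∣ partners i ∣ + ∣ partners i ∣
  p-total i = trans (∑-distrib-+ (λ j → ind (Vec.lookup (partners i) j)) _) (cong₂ _+_ (sym (card-lookup (partners i))) (sym (card-lookup (partners i))))

  p-in : ∀ {i j} → j ∈ partners i → p i j ≡ 2
  p-in j∈ = cong (λ b → ind b + ind b) ([]=⇒lookup j∈)

  p-out : ∀ {i j} → j ∉ partners i → p i j ≡ 0
  p-out {i} {j} j∉ with Vec.lookup (partners i) j in eq
  ... | true  = ⊥-elim (j∉ (lookup⇒[]= j (partners i) eq))
  ... | false = refl

  p-sym : ∀ i j → p i j ≡ p j i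
  p-sym i j with j ∈? partners i
  ... | yes j∈ = trans (p-in j∈) (sym (p-in (partners-sym i j j∈)))
  ... | no j∉ = trans (p-out j∉) (sym (p-out (j∉ ∘ partners-sym j i)))

  Bounds : Fin n → Fin n → Set
  Bounds i j = ∀ s t → elem (Π s) t ≡ i → rank i (before s t) ≤ rank i j

  bounds? : ∀ i j → Dec (Bounds i j)
  bounds? i j = all? λ s → all? λ t → (elem (Π s) t ≟ i) →-dec (rank i (before s t) ≤? rank i j)

  Up : Fin n → Set
  Up i = ∃ λ j → j ∈ partners i × Bounds i j

  Dominates : Fin n → Fin n → Set
  Dominates i j = ∣ partners i ∣ ≡ cap i × (∀ l → l ∈ partners i → rank i l < rank i j)

  dominates? : ∀ i j → Dec (Dominates i j)
  dominates? i j = (∣ partners i ∣ Data.Nat.≟ cap i) ×-dec all? λ l → (l ∈? partners i) →-dec (rank i l <? rank i j)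

  Down : Fin n → Set
  Down i = ∃ λ j → 1 ≤ X i j × Dominates i j

  up? : ∀ i → Dec (Up i)
  up? i = any? λ j → (j ∈? partners i) ×-dec bounds? i j

  down? : ∀ i → Dec (Down i)
  down? i = any? λ j → (1 ≤? X i j) ×-dec dominates? i j

  -- Somewhere `j` is the successor or the predecessor of `i`; F1 compares a successor with its
  -- predecessor.
  X-bounded : ∀ i j → 1 ≤ X i j → ∃ λ s → ∃ λ t → elem (Π s) t ≡ i × rank i j ≤ rank i (before s t)
  X-bounded i j le with 1 ≤? x i j
  ... | yes le′ with x-witness i j le′
  ...   | s , t , refl , refl = s , t , refl , F1 s t
  X-bounded i j le | no ¬le′ with x-witness j i (subst (λ a → 1 ≤ a + x j i) (n≤0⇒n≡0 (≤-pred (≰⇒> ¬le′))) le)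
  ...   | s , t , refl , refl = s , next (Π s) t , refl , ≤-reflexive (cong (rank (after s t) ∘ elem (Π s)) (sym (prev-next (Π s) t)))

  -- The ranks form a circle: some predecessor is no worse than `j`, `j` is strictly better than
  -- `l`, and `l` is no worse than that predecessor.
  up∧down : ∀ i → Up i → Down i → ⊥
  up∧down i (j , j∈ , bound) (l , le , _ , beats) with X-bounded i l le
  ... | s , t , e , le′ = <⇒≱ (beats j j∈) (≤-trans le′ (bound s t e))

  not-transposed : ∀ i j → i ≢ j → X i j ≤ 1 → ¬ ∃ λ s → IsTransposition (Π s) i j
  not-transposed i j i≢j le (s , two , i∈ , j∈) = <⇒≱ (+-mono-≤
    (countIdx-pos (λ s → MapsTo? (Π s) i j) s (transposition-maps (Π s) i≢j (two , i∈ , j∈)))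
    (countIdx-pos (λ s → MapsTo? (Π s) j i) s (transposition-maps (Π s) (i≢j ∘ sym) (two , j∈ , i∈)))) le

  -- A transposition would contribute 2 to `X i j`, so the pair is not transposed and F2 forbids
  -- both ends to prefer each other to predecessors.
  surplus : ∀ i j → X i j < p i j → Up i ⊎ Up j
  surplus i j lt with j ∈? partners i
  ... | no j∉ = ⊥-elim (<⇒≱ lt (≤-trans (≤-reflexive (p-out j∉)) z≤n))
  ... | yes j∈ with bounds? i j | bounds? j i
  ...   | yes bound | _ = inj₁ (j , j∈ , bound)
  ...   | no _ | yes bound = inj₂ (i , partners-sym i j j∈ , bound)
  ...   | no ¬i | no ¬j = ⊥-elim (¬i λ s t e → ≮⇒≥ λ pref-i → ¬j λ s′ t′ e′ → ≮⇒≥ λ pref-j →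
            F2 i j i≢j (not-transposed i j i≢j (≤-pred (subst (X i j <_) (p-in j∈) lt))) s t s′ t′ e e′ (pref-i , pref-j))
    where
    i≢j : i ≢ j
    i≢j refl = irrefl i j∈

  accepts : ∀ i j → j ∉ partners i → ¬ Dominates i j → Accepts I M i j
  accepts i j j∉ ¬dom with ∣ partners i ∣ <? cap i
  ... | yes lt = inj₁ lt
  ... | no ¬lt with maximal (λ l → l ∈? partners i) (rank i)
  ...   | inj₂ alone = ⊥-elim (¬dom (≤-antisym (capacity i) (≮⇒≥ ¬lt) , λ l l∈ → ⊥-elim (alone l l∈)))
  ...   | inj₁ (l , l∈ , worst) = inj₂ (l , (l∈ , worst) , ≰⇒> λ le →
            ¬dom (≤-antisym (capacity i) (≮⇒≥ ¬lt) , λ l′ l′∈ → ≤∧≢⇒< (≤-trans (worst l′ l′∈) le)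
              λ e → j∉ (subst (_∈ partners i) (rank-inj i e) l′∈)))

  -- By F4 the pair cannot belong to `M`, so stability makes one end full with strictly better
  -- partners only.
  deficit : ∀ i j → i ≢ j → p i j < X i j → Down i ⊎ Down j
  deficit i j i≢j lt with j ∈? partners i
  ... | yes j∈ = ⊥-elim (<⇒≱ lt (≤-trans (F4 i j i≢j) (≤-reflexive (sym (p-in j∈)))))
  ... | no j∉ with dominates? i j | dominates? j i
  ...   | yes dom | _ = inj₁ (j , ≤-trans (s≤s z≤n) lt , dom)
  ...   | no _ | yes dom = inj₂ (i , ≤-trans (≤-trans (s≤s z≤n) lt) (≤-reflexive (+-comm (x i j) (x j i))) , dom)
  ...   | no ¬i | no ¬j = ⊥-elim (stable i j (i≢j , j∉ , accepts j i (j∉ ∘ partners-sym j i) ¬j , accepts i j j∉ ¬i))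

  loop-not-up : ∀ i → 1 ≤ X i i → ¬ Up i
  loop-not-up i le (j , j∈ , bound) with X-bounded i i le
  ... | s , t , e , le′ = <⇒≱ (self-last i j λ { refl → irrefl i j∈ }) (≤-trans le′ (bound s t e))

  side : Fin n → Side
  side i with up? i | down? i
  ... | yes _ | _     = up
  ... | no _  | yes _ = down
  ... | no _  | no _  = flat

  side-up : ∀ {i} → Up i → side i ≡ up
  side-up {i} u with up? i | down? i
  ... | yes _ | _ = refl
  ... | no ¬u | _ = ⊥-elim (¬u u)

  side-down : ∀ {i} → Down i → side i ≡ down
  side-down {i} d with up? i | down? i
  ... | yes u | _     = ⊥-elim (up∧down i u d)
  ... | no _  | yes _ = refl
  ... | no _  | no ¬d = ⊥-elim (¬d d)

  side-up⁻ : ∀ {i} → side i ≡ up → Up i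
  side-up⁻ {i} e with up? i | down? i
  ... | yes u | _ = u
  side-up⁻ {i} () | no _ | yes _
  side-up⁻ {i} () | no _ | no _

  side-down⁻ : ∀ {i} → side i ≡ down → ∣ partners i ∣ ≡ cap i
  side-down⁻ {i} e with up? i | down? i
  side-down⁻ {i} () | yes _ | _
  ... | no _ | yes (_ , _ , eq , _) = eq
  side-down⁻ {i} () | no _ | no _

  -- Rows of `X` always total twice the capacity by F3. Rows of `p` never exceed this, and reach it
  -- at down agents, which are full in `M`.
  row≤ : ∀ i → gain (side i) (sum (p i)) (sum (X i)) ≤ loss (side i) (sum (p i)) (sum (X i))
  row≤ i = subst₂ (λ a b → gain (side i) a b ≤ loss (side i) a b) (sym (p-total i)) (sym (X-total i)) (go (side i) refl)
    where
    go : ∀ σ → side i ≡ σ → gain σ (∣ partners i ∣ + ∣ partners i ∣) (cap i + cap i) ≤ loss σ (∣ partners i ∣ + ∣ partners i ∣) (cap i + cap i)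
    go up   e = +-mono-≤ (capacity i) (capacity i)
    go down e = ≤-reflexive (sym (cong₂ _+_ (side-down⁻ e) (side-down⁻ e)))
    go flat e = z≤n

  module Sides = Balance side p X p-sym (λ i j → +-comm (x i j) (x j i))
    (λ i j lt → [ inj₁ ∘ side-up , inj₂ ∘ side-up ]′ (surplus i j lt))
    (λ i j i≢j lt → [ inj₁ ∘ side-down , inj₂ ∘ side-down ]′ (deficit i j i≢j lt))
    (λ i lt e → loop-not-up i (≤-trans (s≤s z≤n) lt) (side-up⁻ e))
    row≤

  Long : Fin k → Set
  Long s = 2 ≤ m (Π s)

  long-step : ∀ {s} → Long s → ∀ t → elem (Π s) t ≢ after s t
  long-step {s} long t e = <⇒≢ (≤-trans (s≤s z≤n) long) (sym (next-fixed (Π s) t (sym (inj (Π s) e))))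

  long-turn : ∀ {s} → Long s → ∀ t → after s t ≢ before s t
  long-turn {s} long t e = <⇒≱ long (next²-fixed (Π s) t (trans (cong (next (Π s)) (inj (Π s) e)) (next-prev (Π s) t)))

  -- A transposition counts once in each direction; together with the edge of the long cycle this
  -- would exceed the 2 of F4.
  long-not-transposed : ∀ {s} → Long s → ∀ t → ¬ ∃ λ s′ → IsTransposition (Π s′) (elem (Π s) t) (after s t)
  long-not-transposed {s} long t (s′ , two , i∈ , j∈) = <⇒≱ (+-mono-≤
      (countIdx-two (λ s → MapsTo? (Π s) i j) s s′ (λ e → <⇒≢ long (sym (suc-injective (trans (cong (len ∘ Π) e) two))))
        (t , refl , refl) (transposition-maps (Π s′) i≢j (two , i∈ , j∈)))
      (countIdx-pos (λ s → MapsTo? (Π s) j i) s′ (transposition-maps (Π s′) (i≢j ∘ sym) (two , j∈ , i∈))))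
    (F4 i j i≢j)
    where
    i = elem (Π s) t
    j = after s t
    i≢j = long-step {s} long t

  -- In a long cycle F1 is strict, so each member prefers its successor to its predecessor. F2 then
  -- stops the successor from preferring this member to any predecessor of its own.
  long-worst : ∀ {s} → Long s → ∀ t → Bounds (after s t) (elem (Π s) t)
  long-worst {s} long t s′ t′ e = ≮⇒≥ λ pref → F2 (elem (Π s) t) (after s t) (long-step {s} long t) (long-not-transposed {s} long t)
    s t s′ t′ refl e (≤∧≢⇒< (F1 s t) (long-turn {s} long t ∘ rank-inj _) , pref)

  -- Both predecessors are the worst one.
  long-merge : ∀ {s s′} → Long s → Long s′ → ∀ t t′ → elem (Π s) t ≡ elem (Π s′) t′ → before s t ≡ before s′ t′
  long-merge {s} {s′} long long′ t t′ e = rank-inj (elem (Π s) t) (≤-antisym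
      (subst (λ a → rank a (before s t) ≤ rank a (before s′ t′)) (sym e)
        (half {s′} {s} long′ t′ t (sym e)))
      (half {s} {s′} long t t′ e))
    where
    half : ∀ {s s′} → Long s → ∀ t t′ → elem (Π s) t ≡ elem (Π s′) t′ →
           rank (elem (Π s) t) (before s′ t′) ≤ rank (elem (Π s) t) (before s t)
    half {s} {s′} long t t′ e = subst (λ a → rank a (before s′ t′) ≤ rank a (before s t)) (cong (elem (Π s)) (next-prev (Π s) t))
      (long-worst {s} long (prev (Π s) t) s′ t′ (trans (sym e) (cong (elem (Π s)) (sym (next-prev (Π s) t)))))

  -- Long cycles that meet agree on predecessors, hence stay together all the way backwards.
  long-within : ∀ {s s′} → Long s → Long s′ → ∀ t t′ → elem (Π s) t ≡ elem (Π s′) t′ → ∀ a → Mem (Π s) a → Mem (Π s′) a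
  long-within {s} {s′} long long′ t t′ e a (u , refl) = backwards (Π s) (Mem (Π s′)) t (t′ , sym e)
    (λ { v (v′ , e′) → prev (Π s′) v′ , trans (sym (long-merge {s} {s′} long long′ (next (Π s) v) v′ (sym e′))) (cong (elem (Π s)) (prev-next (Π s) v)) }) u

  long-same : ∀ {s s′} → Long s → Long s′ → ∀ t t′ → elem (Π s) t ≡ elem (Π s′) t′ → SameCycle (Π s) (Π s′)
  long-same {s} {s′} long long′ t t′ e = long-within {s} {s′} long long′ t t′ e , long-within {s′} {s} long′ long t′ t (sym e) , maps
    where
    maps : ∀ a b → MapsTo (Π s) a b → MapsTo (Π s′) a b
    maps _ _ (u , refl , refl) with long-within {s} {s′} long long′ t t′ e (after s u) (next (Π s) u , refl)
    ... | v , e′ = prev (Π s′) v , trans (sym (long-merge {s} {s′} long long′ (next (Π s) u) v (sym e′))) (cong (elem (Π s)) (prev-next (Π s) u)) ,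
                   trans (cong (elem (Π s′)) (next-prev (Π s′) v)) e′

  short-or-long : ∀ {s} {i j} → i ≢ j → MapsTo (Π s) i j → IsTransposition (Π s) i j ⊎ Long s
  short-or-long {s} i≢j (t , refl , refl) = go (m (Π s)) refl
    where
    go : ∀ l → m (Π s) ≡ l → IsTransposition (Π s) (elem (Π s) t) (after s t) ⊎ Long s
    go zero          eq = ⊥-elim (i≢j (cong (elem (Π s)) (toℕ-injective (trans (at-zero t) (sym (at-zero (next (Π s) t)))))))
      where
      at-zero : ∀ u → toℕ u ≡ 0
      at-zero u = n≤0⇒n≡0 (≤-trans (≤-pred (toℕ<n u)) (≤-reflexive eq))
    go (suc zero)    eq = inj₁ (cong suc eq , (t , refl) , (next (Π s) t , refl))
    go (suc (suc l)) eq = inj₂ (≤-trans (s≤s (s≤s z≤n)) (≤-reflexive (sym eq)))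

  -- A second cycle using the edge in the same direction would be a transposition or a copy of `s`.
  -- One using it in the opposite direction would be long, with equal successor and predecessor at
  -- some vertex, or again a transposition.
  long-X : ∀ {s} → Long s → ∀ t → X (elem (Π s) t) (after s t) ≡ 1
  long-X {s} long t = cong₂ _+_
      (countIdx-one (λ s → MapsTo? (Π s) i j) s (t , refl , refl) only)
      (countIdx-none (λ s → MapsTo? (Π s) j i) never)
    where
    i = elem (Π s) t
    j = after s t
    i≢j = long-step {s} long t
    only : ∀ s′ → MapsTo (Π s′) i j → s′ ≡ s
    only s′ mp with s′ ≟ s | short-or-long {s′} i≢j mp
    ... | yes e | _ = e
    ... | no _ | inj₁ tr = ⊥-elim (long-not-transposed {s} long t (s′ , tr))
    ... | no s′≢s | inj₂ long′ with distinct s s′ (s′≢s ∘ sym)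
    ...   | inj₁ single = ⊥-elim (<⇒≢ (≤-trans (s≤s z≤n) long) (sym (suc-injective single)))
    ...   | inj₂ ¬same = ⊥-elim (¬same (long-same {s} {s′} long long′ t (proj₁ mp) (sym (proj₁ (proj₂ mp)))))
    never : ∀ s′ → ¬ MapsTo (Π s′) j i
    never s′ mp@(u , eu , eu′) with short-or-long {s′} (i≢j ∘ sym) mp
    ... | inj₁ (two , j∈ , i∈) = long-not-transposed {s} long t (s′ , two , i∈ , j∈)
    ... | inj₂ long′ = long-turn {s′} long′ u (trans eu′ (trans (sym (cong (elem (Π s)) (prev-next (Π s) t)))
            (long-merge {s} {s′} long long′ (next (Π s) t) u (sym eu))))

  stable⇒no-odd : ∀ s → ¬ OddNontrivial (Π s)
  stable⇒no-odd s (nontrivial , odd) = odd (alternating⇒even (Π s) (colour ∘ side ∘ elem (Π s)) alternate)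
    where
    long : Long s
    long = go (m (Π s)) refl
      where
      go : ∀ l → m (Π s) ≡ l → Long s
      go zero          eq = ⊥-elim (<-irrefl refl (subst (λ l → 1 < suc l) eq nontrivial))
      go (suc zero)    eq = ⊥-elim (odd (divides 1 (cong suc eq)))
      go (suc (suc l)) eq = ≤-trans (s≤s (s≤s z≤n)) (≤-reflexive (sym eq))
    colour : Side → Bool
    colour up   = true
    colour down = false
    colour flat = false
    p≢1 : ∀ i j → p i j ≢ 1
    p≢1 i j e with Vec.lookup (partners i) j
    p≢1 i j () | true
    p≢1 i j () | false
    opposite-colour : ∀ {σ τ} → Sides.Opposite σ τ → colour τ ≡ not (colour σ)
    opposite-colour (inj₁ (refl , refl)) = refl
    opposite-colour (inj₂ (refl , refl)) = refl
    alternate : ∀ t → colour (side (after s t)) ≡ not (colour (side (elem (Π s) t)))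
    alternate t = opposite-colour (Sides.opposite (elem (Π s) t) (after s t) (long-step {s} long t)
      (λ e → p≢1 _ _ (trans e (long-X {s} long t))))

theorem12 : ∀ {n : ℕ} (I : SF n) →
    (Σ (Matching I) (λ M → Stable I M)) ⇔
    (∀ (k : ℕ) (Π : Fin k → Cycle n) → IsGSP I Π → ∀ r → ¬ OddNontrivial (Π r))
theorem12 I = mk⇔ (λ { (M , stable) k Π G → stable⇒no-odd I M stable Π G }) (no-odd⇒stable I)
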